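{- There exist absolute constants $c_1,c_2>0$ such that for every prime $p$ and every positive integer $k$, with $n=p^k$, \[c_1\, p^{\frac{k-\lfloor k/3\rfloor}{2}}\le \operatorname{disc}(\mathcal A_n)\le c_2\, p^{\frac{k-\lfloor k/3\rfloor}{2}}.\] Equivalently, $\operatorname{disc}(\mathcal A_n)=\Theta\big(n^{\frac13+\frac{r_k}{6k}}\big)$, where $r_k\in\{0,1,2\}$ is the remainder of $k$ upon division by $3$.
   Context: For a positive integer $n$, $\mathbb{Z}_n$ denotes the integers modulo $n$. An arithmetic progression in $\mathbb{Z}_n$ is a set of the form $\{a+kd: 0\le k<l\}$ with $a,d\in\mathbb{Z}_n$ and $l$ an integer with $0\le l\le n/\gcd(n,d)$; $\mathcal A_n$ is the family of all arithmetic progressions in $\mathbb{Z}_n$. For a function $\chi$ and a finite set $A$, $\chi(A)=\sum_{x\in A}\chi(x)$. The discrepancy is $\operatorname{disc}(\mathcal A_n)=\min_{\chi:\mathbb{Z}_n\to\{1,-1\}}\max_{A\in\mathcal A_n}|\chi(A)|$. -}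

module Defs where

open import Data.Nat using (ℕ; zero; suc; _+_; _*_; _⊔_; _⊓_; _%_; _≤ᵇ_)
open import Data.Nat.DivMod using (m%n<n)
open import Data.Nat.GCD using (gcd)
open import Data.Bool using (Bool; true; false)
open import Data.Integer using (ℤ; ∣_∣; +_; -_) renaming (_+_ to _+ℤ_)
open import Data.List using (List; []; _∷_; map; foldr; upTo; concatMap; filterᵇ)
open import Data.Vec using (Vec; lookup) renaming ([] to []ᵥ; _∷_ to _∷ᵥ_)
open import Data.Fin using (Fin; fromℕ<)
open import Data.Product using (_×_; _,_)

-- A coloring χ : ℤ_n → {1,-1} is a vector of n booleans (true ↦ +1, false ↦ -1).
sign : Bool → ℤ
sign true  = + 1
sign false = - (+ 1)

allColorings : (n : ℕ) → List (Vec Bool n)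
allColorings zero    = []ᵥ ∷ []
allColorings (suc n) =
  concatMap (λ v → (true ∷ᵥ v) ∷ (false ∷ᵥ v) ∷ []) (allColorings n)

χat : (m : ℕ) → Vec Bool (suc m) → ℕ → ℤ
χat m v x = sign (lookup v (fromℕ< (m%n<n x (suc m))))

-- χ({a + k d : 0 ≤ k < l}) (the elements are distinct since l ≤ n / gcd(n,d)).
apSum : (m : ℕ) → Vec Bool (suc m) → ℕ → ℕ → ℕ → ℤ
apSum m v a d l = foldr _+ℤ_ (+ 0) (map (λ k → χat m v (a + k * d)) (upTo l))

-- All arithmetic progressions of ℤ_n, n = suc m, given as (a , d , l) with
-- a, d ∈ {0,…,n-1} and 0 ≤ l ≤ n / gcd(n,d)  (written l * gcd(n,d) ≤ n).
aps : (m : ℕ) → List (ℕ × ℕ × ℕ)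
aps m =
  concatMap (λ a →
    concatMap (λ d →
      map (λ l → (a , d , l))
          (filterᵇ (λ l → l * gcd (suc m) d ≤ᵇ suc m) (upTo (suc (suc m)))))
      (upTo (suc m)))
    (upTo (suc m))

maxList : List ℕ → ℕ
maxList = foldr _⊔_ 0

minList : List ℕ → ℕ
minList []       = 0
minList (x ∷ xs) = foldr _⊓_ x xs

maxAP : (m : ℕ) → Vec Bool (suc m) → ℕ
maxAP m v = maxList (map (λ { (a , d , l) → ∣ apSum m v a d l ∣ }) (aps m))

-- disc(𝒜_n) = min_χ max_A |χ(A)|   (n = 0 is a dummy case, never used)
disc : ℕ → ℕ
disc zero    = 0
disc (suc m) = minList (map (maxAP m) (allColorings (suc m)))

{-# OPTIONS --safe #-}

-- Lower bound.  Write t = ⌊k/3⌋, e = k − t, n = p^k, and sum the squares of χ over all progressions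
-- of length l = ⌊p/2⌋ p^(e−1) whose difference is a unit.  Grouping pairs of indices by their
-- difference mod p, p², … telescopes everything except the diagonal and the square sums T_v of χ over
-- the classes mod p^v for v = 0, e−1, e; here T_0 ≥ 0, T_e is trivially bounded, and T_(e−1) is
-- small unless a class mod p^(e−1), itself a progression, already has large discrepancy.
--
-- Upper bound.  Colour x according to x mod q, q = p^e.  Order ℤ/q by reversed base-p digits, so that
-- every class mod p^j is an interval, and let consecutive points in this order get opposite
-- colours: then every class has sum at most 2, which controls the at most p^t ≤ √q full turns of a
-- progression around its class.  The remaining signs are chosen by iterated partial colouring.
-- For each d, list ℤ/q as a sequence of progressions with difference d and split prefixes into
-- 256-adic blocks.  A pigeonhole argument in which unlikely values of a block sum are priced, together
-- with fourth moments, yields two colourings with nearly equal block sums and large Hamming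
-- distance; half their difference is a partial colouring, with total error O(√q) and no logarithm.
module Submission where

open import Defs
open import Data.Nat using (ℕ; zero; suc; _+_; _*_; _∸_; _^_; _/_; _%_; _≤_; _<_; _≤?_; _<?_; _≤ᵇ_; _⊓_; ⌊_/2⌋; z≤n; s≤s; NonZero; >-nonZero; ≢-nonZero; ≢-nonZero⁻¹; nonTrivial⇒n>1)
open import Data.Nat.Properties
open import Data.Nat.DivMod
open import Data.Nat.Divisibility
open import Data.Nat.Primality using (Prime; prime⇒irreducible; prime⇒nonZero; prime⇒nonTrivial)
open import Data.Nat.Coprimality using (Coprime; coprime-Bézout; coprime-divisor; coprime⇒gcd≡1; gcd≡1⇒coprime)
import Data.Nat.Coprimality as Coprimality
open import Data.Nat.GCD using (module Bézout; gcd; gcd-comm; gcd[m,n]∣m; gcd[m,n]∣n; gcd-greatest; gcd[m,n]≢0; c*gcd[m,n]≡gcd[cm,cn])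
open import Data.Integer using (ℤ; -[1+_]; ∣_∣) renaming (+_ to pos; _+_ to _+ℤ_; _*_ to _*ℤ_; -_ to -ℤ_; _-_ to _-ℤ_; _≤_ to _≤ℤ_)
import Data.Integer as ℤ
import Data.Integer.Properties as ℤₚ
open import Data.Bool using (Bool; true; false; if_then_else_; _∧_; not; _xor_)
open import Data.Bool.Properties using (T?)
open import Data.Fin using (Fin; toℕ; fromℕ<)
import Data.Fin as Fin
import Data.Fin.Properties as Finₚ
import Data.Fin.Permutation as Perm
open import Data.Vec using (Vec; []; _∷_; lookup; zipWith; replicate; tabulate)
open import Data.Vec.Properties using (lookup-replicate; lookup∘tabulate)
open import Data.List using (List; []; _∷_; map; _++_; length; concatMap; filter; take; drop; upTo; applyUpTo; foldr)
open import Data.List.Properties using (length-++; length-take; length-drop; length-map; length-upTo)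
open import Data.List.Relation.Unary.All using (All; []; _∷_)
import Data.List.Relation.Unary.All as All
import Data.List.Relation.Unary.All.Properties as Allₚ
open import Data.List.Relation.Unary.Any using (here; there)
import Data.List.Relation.Unary.Any as Any
open import Data.List.Membership.Propositional using (_∈_; find)
open import Data.List.Membership.Propositional.Properties using (∈-map⁺; ∈-map⁻; ∈-upTo⁺; ∈-upTo⁻; ∈-++⁺ˡ; ∈-++⁺ʳ; ∈-concatMap⁺; ∈-concatMap⁻; ∈-filter⁺; ∈-filter⁻)
open import Data.Product using (Σ; ∃; _×_; _,_; proj₁; proj₂)
open import Data.Sum using (_⊎_; inj₁; inj₂)
open import Function using (_∘_; id)
open import Relation.Nullary using (¬_; Dec; yes; no; contradiction)
open import Relation.Nullary.Decidable using (toWitness)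
open import Relation.Binary.PropositionalEquality hiding (J)
open import Algebra.Properties.CommutativeMonoid.Sum ℤₚ.+-0-commutativeMonoid using (sum; sum-permute)
open import Algebra.Properties.AbelianGroup ℤₚ.+-0-abelianGroup using (∙-cancelˡ)
import Data.Nat.Tactic.RingSolver as ℕ-Ring
import Data.Integer.Tactic.RingSolver as ℤ-Ring

-- Sums over initial segments of ℕ

-- Lower bound: differences are averaged over units because then every length up to n is admissible,
-- and because the units are the complement of the multiples of p: both sums over d run over full
-- periods, where a factor prime to p can be substituted away. In the end T_(e-1) and the part of
-- the diagonal set against it share the factor H(p - H), where H is the leading factor of the
-- length; this is why H is half of p.
--
-- Upper bound: a logarithm would appear if all block lengths were given the same relative error.
-- With blocks of length 256^i, i ≤ Λ, the number of blocks grows by 256 per level down, while the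
-- errors have to decrease geometrically so that a prefix costs no more than its top block, up to a
-- constant. Errors of order 2^(3Λ+i) do this, being of order 8^(Λ-i) standard deviations. A second
-- moment bounds the excess by 64^(i-Λ), which loses to 256^(Λ-i); the fourth gives 4096^(i-Λ),
-- which wins and even pays for prices growing with the depth. Prices play the role of entropy:
-- weights 2^(-price·∣value∣) turn the partial colouring argument into inequalities between
-- integers.

∑ : ℕ → (ℕ → ℤ) → ℤ
∑ zero    f = pos 0
∑ (suc n) f = f 0 +ℤ ∑ n (f ∘ suc)

∑-cong< : ∀ n {f g : ℕ → ℤ} → (∀ i → i < n → f i ≡ g i) → ∑ n f ≡ ∑ n g
∑-cong< zero    eq = refl
∑-cong< (suc n) eq = cong₂ _+ℤ_ (eq 0 (s≤s z≤n)) (∑-cong< n (λ i i<n → eq (suc i) (s≤s i<n)))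

∑-cong : ∀ n {f g : ℕ → ℤ} → (∀ i → f i ≡ g i) → ∑ n f ≡ ∑ n g
∑-cong n eq = ∑-cong< n (λ i _ → eq i)

+ℤ-interchange : ∀ a b c d → (a +ℤ b) +ℤ (c +ℤ d) ≡ (a +ℤ c) +ℤ (b +ℤ d)
+ℤ-interchange = ℤ-Ring.solve-∀

∑-+ : ∀ n (f g : ℕ → ℤ) → ∑ n (λ i → f i +ℤ g i) ≡ ∑ n f +ℤ ∑ n g
∑-+ zero    f g = refl
∑-+ (suc n) f g = trans (cong (f 0 +ℤ g 0 +ℤ_) (∑-+ n (f ∘ suc) (g ∘ suc)))
                        (+ℤ-interchange (f 0) (g 0) (∑ n (f ∘ suc)) (∑ n (g ∘ suc)))

∑-*ˡ : ∀ n c (f : ℕ → ℤ) → ∑ n (λ i → c *ℤ f i) ≡ c *ℤ ∑ n f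
∑-*ˡ zero    c f = sym (ℤₚ.*-zeroʳ c)
∑-*ˡ (suc n) c f = trans (cong (c *ℤ f 0 +ℤ_) (∑-*ˡ n c (f ∘ suc)))
                         (sym (ℤₚ.*-distribˡ-+ c (f 0) (∑ n (f ∘ suc))))

∑-*ʳ : ∀ n c (f : ℕ → ℤ) → ∑ n (λ i → f i *ℤ c) ≡ ∑ n f *ℤ c
∑-*ʳ n c f = trans (∑-cong n (λ i → ℤₚ.*-comm (f i) c)) (trans (∑-*ˡ n c f) (ℤₚ.*-comm c (∑ n f)))

∑-const : ∀ n c → ∑ n (λ _ → c) ≡ pos n *ℤ c
∑-const zero    c = sym (ℤₚ.*-zeroˡ c)
∑-const (suc n) c = trans (cong (c +ℤ_) (∑-const n c)) (sym (ℤₚ.suc-* (pos n) c))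

∑-swap : ∀ m n (f : ℕ → ℕ → ℤ) → ∑ m (λ i → ∑ n (f i)) ≡ ∑ n (λ j → ∑ m (λ i → f i j))
∑-swap zero    n f = sym (trans (∑-const n (pos 0)) (ℤₚ.*-zeroʳ (pos n)))
∑-swap (suc m) n f = trans (cong (∑ n (f 0) +ℤ_) (∑-swap m n (f ∘ suc)))
                           (sym (∑-+ n (f 0) (λ j → ∑ m (λ i → f (suc i) j))))

∑-mono< : ∀ n {f g : ℕ → ℤ} → (∀ i → i < n → f i ≤ℤ g i) → ∑ n f ≤ℤ ∑ n g
∑-mono< zero    le = ℤₚ.≤-refl
∑-mono< (suc n) le = ℤₚ.+-mono-≤ (le 0 (s≤s z≤n)) (∑-mono< n (λ i i<n → le (suc i) (s≤s i<n)))

∑-bound : ∀ n {f : ℕ → ℤ} B → (∀ i → i < n → ∣ f i ∣ ≤ B) → ∣ ∑ n f ∣ ≤ n * B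
∑-bound zero    B le = z≤n
∑-bound (suc n) {f} B le = ≤-trans (ℤₚ.∣i+j∣≤∣i∣+∣j∣ (f 0) (∑ n (f ∘ suc)))
  (+-mono-≤ (le 0 (s≤s z≤n)) (∑-bound n B (λ i i<n → le (suc i) (s≤s i<n))))

∑-split : ∀ m n (f : ℕ → ℤ) → ∑ (m + n) f ≡ ∑ m f +ℤ ∑ n (λ i → f (m + i))
∑-split zero    n f = sym (ℤₚ.+-identityˡ _)
∑-split (suc m) n f = trans (cong (f 0 +ℤ_) (∑-split m n (f ∘ suc)))
                            (sym (ℤₚ.+-assoc (f 0) (∑ m (f ∘ suc)) _))

∑-blocks : ∀ a b (f : ℕ → ℤ) → ∑ (a * b) f ≡ ∑ a (λ c → ∑ b (λ y → f (c * b + y)))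
∑-blocks zero    b f = refl
∑-blocks (suc a) b f = trans (∑-split b (a * b) f) (cong (∑ b f +ℤ_)
  (trans (∑-blocks a b (λ i → f (b + i)))
    (∑-cong a (λ c → ∑-cong b (λ y → cong f (sym (+-assoc b (c * b) y)))))))

∑-residues : ∀ a b (f : ℕ → ℤ) → ∑ (a * b) f ≡ ∑ a (λ c → ∑ b (λ y → f (c + a * y)))
∑-residues a b f = trans (cong (λ m → ∑ m f) (*-comm a b)) (trans (∑-blocks b a f)
  (trans (∑-swap b a _) (∑-cong a (λ c → ∑-cong b (λ y → cong f
    (trans (+-comm (y * a) c) (cong (λ z → c + z) (*-comm y a))))))))

Periodic : ℕ → (ℕ → ℤ) → Set
Periodic n f = ∀ x → f (x + n) ≡ f x

periodic-+* : ∀ n {f} → Periodic n f → ∀ x k → f (x + k * n) ≡ f x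
periodic-+* n {f} per x zero    = cong f (+-identityʳ x)
periodic-+* n {f} per x (suc k) = trans (cong f (trans (cong (x +_) (+-comm n (k * n))) (sym (+-assoc x (k * n) n))))
                                  (trans (per (x + k * n)) (periodic-+* n per x k))

periodic-% : ∀ n .{{_ : NonZero n}} {f} → Periodic n f → ∀ x → f (x % n) ≡ f x
periodic-% n {f} per x = trans (sym (periodic-+* n per (x % n) (x / n))) (cong f (sym (m≡m%n+[m/n]*n x n)))

∑-last : ∀ n (f : ℕ → ℤ) → ∑ (suc n) f ≡ ∑ n f +ℤ f n
∑-last n f = trans (cong (λ m → ∑ m f) (+-comm 1 n)) (trans (∑-split n 1 f)
  (cong (∑ n f +ℤ_) (trans (ℤₚ.+-identityʳ _) (cong f (+-identityʳ n)))))

∑-shift₁ : ∀ n {f} → Periodic n f → ∑ n (f ∘ suc) ≡ ∑ n f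
∑-shift₁ n {f} per = ∙-cancelˡ (f 0) _ _ (trans (∑-last n f)
  (trans (ℤₚ.+-comm (∑ n f) (f n)) (cong (_+ℤ ∑ n f) (per 0))))

∑-shift : ∀ n {f} → Periodic n f → ∀ s → ∑ n (λ x → f (x + s)) ≡ ∑ n f
∑-shift n {f} per zero    = ∑-cong n (λ x → cong f (+-identityʳ x))
∑-shift n {f} per (suc s) = trans (∑-cong n (λ x → cong f (+-suc x s)))
  (trans (∑-shift₁ n {λ x → f (x + s)} (λ x → trans (cong f (trans (+-assoc x n s) (trans (cong (x +_) (+-comm n s)) (sym (+-assoc x s n))))) (per (x + s))))
         (∑-shift n per s))

∑-sum : ∀ n (f : ℕ → ℤ) → ∑ n f ≡ sum {n} (f ∘ toℕ)
∑-sum zero    f = refl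
∑-sum (suc n) f = cong (f 0 +ℤ_) (∑-sum n (f ∘ suc))

*-%-absorbʳ : ∀ w y n .{{_ : NonZero n}} → (w * (y % n)) % n ≡ (w * y) % n
*-%-absorbʳ w y n = trans (%-distribˡ-* w (y % n) n)
  (trans (cong (λ z → ((w % n) * z) % n) (m%n%n≡m%n y n)) (sym (%-distribˡ-* w y n)))

inverse-cancel : ∀ n .{{_ : NonZero n}} u w → (u * w) % n ≡ 1 % n → ∀ x → x < n → (w * ((u * x) % n)) % n ≡ x
inverse-cancel n u w eq x x<n = begin
  (w * ((u * x) % n)) % n         ≡⟨ *-%-absorbʳ w (u * x) n ⟩
  (w * (u * x)) % n               ≡⟨ cong (_% n) (lem w u x) ⟩
  ((u * w) * x) % n               ≡⟨ %-distribˡ-* (u * w) x n ⟩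
  (((u * w) % n) * (x % n)) % n   ≡⟨ cong (λ z → (z * (x % n)) % n) eq ⟩
  ((1 % n) * (x % n)) % n         ≡⟨ %-distribˡ-* 1 x n ⟨
  (1 * x) % n                     ≡⟨ cong (_% n) (*-identityˡ x) ⟩
  x % n                           ≡⟨ m<n⇒m%n≡m x<n ⟩
  x                               ∎
  where
  open ≡-Reasoning
  lem : ∀ w u x → w * (u * x) ≡ (u * w) * x
  lem = ℕ-Ring.solve-∀

∑-unit : ∀ n .{{_ : NonZero n}} {f} → Periodic n f → ∀ u w → (u * w) % n ≡ 1 % n →
         ∑ n (λ x → f (u * x)) ≡ ∑ n f
∑-unit n {f} per u w eq = sym (trans (∑-sum n f) (trans (sum-permute (f ∘ toℕ) π)
  (trans (sum-cong′ n (λ i → trans (cong f (Finₚ.toℕ-fromℕ< (m%n<n (u * toℕ i) n))) (periodic-% n per (u * toℕ i))))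
         (sym (∑-sum n (λ x → f (u * x)))))))
  where
  times : ℕ → Fin n → Fin n
  times v i = fromℕ< (m%n<n (v * toℕ i) n)
  sum-cong′ : ∀ m {g h : Fin m → ℤ} → (∀ i → g i ≡ h i) → sum g ≡ sum h
  sum-cong′ zero    e = refl
  sum-cong′ (suc m) e = cong₂ _+ℤ_ (e Fin.zero) (sum-cong′ m (e ∘ Fin.suc))
  inv : ∀ u w → (u * w) % n ≡ 1 % n → ∀ i → times w (times u i) ≡ i
  inv u w eq i = Finₚ.toℕ-injective (trans (Finₚ.toℕ-fromℕ< _) (trans
    (cong (λ z → (w * z) % n) (Finₚ.toℕ-fromℕ< (m%n<n (u * toℕ i) n)))
    (inverse-cancel n u w eq (toℕ i) (Finₚ.toℕ<n i))))
  π : Perm.Permutation n n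
  π = Perm.permutation (times u) (times w)
        (inv w u (trans (cong (_% n) (*-comm w u)) eq))
        (inv u w eq)

coprime⇒inverse : ∀ u n .{{_ : NonZero n}} → Coprime u n → ∃ λ w → (u * w) % n ≡ 1 % n
coprime⇒inverse u n@(suc n′) c with coprime-Bézout c
... | Bézout.+- x y eq = x , trans (cong (_% n) (trans (*-comm u x) (sym eq))) ([m+kn]%n≡m%n 1 y n)
-- Here `x * u` is -1 modulo `n`, and `x * n′` represents -x because `n′` is n - 1.
... | Bézout.-+ x y eq = x * n′ , trans (sym ([m+kn]%n≡m%n (u * (x * n′)) y n))
        (trans (cong (_% n) (trans (cong (u * (x * n′) +_) (sym eq)) (lem u x n′))) ([m+kn]%n≡m%n 1 (u * x) n))
  where
  lem : ∀ u x n′ → u * (x * n′) + (1 + x * u) ≡ 1 + u * x * (1 + n′)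
  lem = ℕ-Ring.solve-∀

-- Lower bound: averaging over units

∤⇒coprime : ∀ {p δ} → Prime p → ¬ p ∣ δ → Coprime δ p
∤⇒coprime pp p∤δ (e∣δ , e∣p) with prime⇒irreducible pp e∣p
... | inj₁ e≡1  = e≡1
... | inj₂ refl = contradiction e∣δ p∤δ

∣p^m⇒≡p^j : ∀ {p} → Prime p → ∀ m {d} → d ∣ p ^ m → ∃ λ j → j ≤ m × d ≡ p ^ j
∣p^m⇒≡p^j pp zero d∣1 = 0 , z≤n , ∣1⇒≡1 d∣1
∣p^m⇒≡p^j {p} pp (suc m) {d} d∣ with p ∣? d
... | no p∤d = let j , j≤m , eq = ∣p^m⇒≡p^j pp m (coprime-divisor (∤⇒coprime pp p∤d) d∣) in j , m≤n⇒m≤1+n j≤m , eq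
... | yes (divides q refl) =
  let instance _ = prime⇒nonZero pp
      j , j≤m , eq = ∣p^m⇒≡p^j pp m (*-cancelˡ-∣ p (subst (_∣ p * p ^ m) (*-comm q p) d∣))
  in suc j , s≤s j≤m , trans (*-comm q p) (cong (p *_) eq)

∤⇒coprime-^ : ∀ {p δ} → Prime p → ¬ p ∣ δ → ∀ m → Coprime δ (p ^ m)
∤⇒coprime-^ {p} pp p∤δ m (e∣δ , e∣p^m) with ∣p^m⇒≡p^j pp m e∣p^m
... | zero  , _ , eq = eq
... | suc j , _ , eq = contradiction (∣-trans (m∣m*n (p ^ j)) (subst (_∣ _) eq e∣δ)) p∤δ

∑-copies : ∀ a m {f} → Periodic m f → ∑ (a * m) f ≡ pos a *ℤ ∑ m f
∑-copies a m {f} per = trans (∑-blocks a m f) (trans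
  (∑-cong a (λ c → ∑-cong m (λ y → trans (cong f (+-comm (c * m) y)) (periodic-+* m per y c))))
  (∑-const a (∑ m f)))

∑-exceptional : ∀ n c (F : ℕ → ℤ) A B → c < suc n → F c ≡ A → (∀ i → i < suc n → i ≢ c → F i ≡ B) →
           ∑ (suc n) F ≡ A +ℤ pos n *ℤ B
∑-exceptional n zero F A B c< Fc Fo = cong₂ _+ℤ_ Fc (trans (∑-cong< n (λ i i<n → Fo (suc i) (s≤s i<n) λ ())) (∑-const n B))
∑-exceptional (suc n) (suc c) F A B (s≤s c<) Fc Fo =
  trans (cong₂ _+ℤ_ (Fo 0 (s≤s z≤n) λ ()) (∑-exceptional n c (F ∘ suc) A B c< Fc (λ i i< i≢c → Fo (suc i) (s≤s i<) (i≢c ∘ suc-injective))))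
        (lem A B (pos n))
  where
  lem : ∀ A B N → B +ℤ (A +ℤ N *ℤ B) ≡ A +ℤ (pos 1 +ℤ N) *ℤ B
  lem = ℤ-Ring.solve-∀

∑-square : ∀ n (f : ℕ → ℤ) → ∑ n f *ℤ ∑ n f ≡ ∑ n (λ i → ∑ n (λ j → f i *ℤ f j))
∑-square n f = trans (sym (∑-*ʳ n (∑ n f) f)) (∑-cong n (λ i → sym (∑-*ˡ n (f i) f)))

0≤i*i : ∀ i → pos 0 ≤ℤ i *ℤ i
0≤i*i i = subst (pos 0 ≤ℤ_) (trans (ℤₚ.pos-* ∣ i ∣ ∣ i ∣) (sq i)) (ℤ.+≤+ z≤n)
  where
  sq : ∀ i → pos ∣ i ∣ *ℤ pos ∣ i ∣ ≡ i *ℤ i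
  sq (pos n)  = refl
  sq -[1+ n ] = refl

i≤∣i∣ : ∀ i → i ≤ℤ pos ∣ i ∣
i≤∣i∣ (pos n)  = ℤₚ.≤-refl
i≤∣i∣ -[1+ n ] = ℤ.-≤+

i*i≤ : ∀ i D → ∣ i ∣ ≤ D → i *ℤ i ≤ℤ pos (D * D)
i*i≤ i D le = ℤₚ.≤-trans (i≤∣i∣ (i *ℤ i)) (ℤ.+≤+ (subst (_≤ D * D) (sym (ℤₚ.abs-* i i)) (*-mono-≤ le le)))

module Correlations (p′ k : ℕ) (pp : Prime (suc p′)) (f : ℕ → ℤ) (per : Periodic (suc p′ ^ k) f) where

  private
    p n : ℕ
    p = suc p′
    n = p ^ k

  corr : ℕ → ℕ → ℕ → ℤ
  corr i j y = ∑ n (λ a → f (a + i * y) *ℤ f (a + j * y))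

  f-shift-periodic : ∀ s t → Periodic n (λ a → f (a + s) *ℤ f (a + t))
  f-shift-periodic s t a = cong₂ _*ℤ_ (lem s) (lem t)
    where
    lem : ∀ s → f (a + n + s) ≡ f (a + s)
    lem s = trans (cong f (trans (+-assoc a n s) (trans (cong (a +_) (+-comm n s)) (sym (+-assoc a s n))))) (per (a + s))

  corr-shift : ∀ c i j y → corr (c + i) (c + j) y ≡ corr i j y
  corr-shift c i j y = trans (∑-cong n (λ a → cong₂ (λ u v → f u *ℤ f v) (lem a c i y) (lem a c j y)))
    (∑-shift n (f-shift-periodic (i * y) (j * y)) (c * y))
    where
    lem : ∀ a c i y → a + (c + i) * y ≡ a + c * y + i * y
    lem = ℕ-Ring.solve-∀

  corr-sym : ∀ i j y → corr i j y ≡ corr j i y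
  corr-sym i j y = ∑-cong n (λ a → ℤₚ.*-comm (f (a + i * y)) (f (a + j * y)))

  corr-scale : ∀ c i j y → corr (c * i) (c * j) y ≡ corr i j (c * y)
  corr-scale c i j y = ∑-cong n (λ a → cong₂ (λ u v → f (a + u) *ℤ f (a + v)) (lem c i y) (lem c j y))
    where
    lem : ∀ c i y → c * i * y ≡ i * (c * y)
    lem = ℕ-Ring.solve-∀

  p^[k∸v]*p^v : ∀ {v} → v ≤ k → p ^ (k ∸ v) * p ^ v ≡ n
  p^[k∸v]*p^v {v} v≤k = trans (sym (^-distribˡ-+-* p (k ∸ v) v)) (cong (p ^_) (m∸n+n≡m v≤k))

  corr-periodic : ∀ {v} → v ≤ k → ∀ i j → Periodic (p ^ (k ∸ v)) (λ d → corr i j (p ^ v * d))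
  corr-periodic {v} v≤k i j d = ∑-cong n (λ a → cong₂ _*ℤ_ (lem a i) (lem a j))
    where
    arith : ∀ a i V d w → a + i * (V * (d + w)) ≡ a + i * (V * d) + i * (w * V)
    arith = ℕ-Ring.solve-∀
    lem : ∀ a i → f (a + i * (p ^ v * (d + p ^ (k ∸ v)))) ≡ f (a + i * (p ^ v * d))
    lem a i = trans (cong f (trans (arith a i (p ^ v) d (p ^ (k ∸ v)))
        (cong (λ z → a + i * (p ^ v * d) + i * z) (p^[k∸v]*p^v v≤k))))
      (periodic-+* n per (a + i * (p ^ v * d)) i)

  -- Sum over one full period of the differences divisible by p^v. Because the period is full,
  -- factors of i - j prime to p can be removed, and the value depends only on the p-adic valuation
  -- of i - j.
  G : ℕ → ℕ → ℕ → ℤ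
  G v i j = ∑ (p ^ (k ∸ v)) (λ d → corr i j (p ^ v * d))

  T : ℕ → ℤ
  T v = G v 0 1

  -- The factor j - i passes from the indices to the difference, where it is a unit modulo p^(k∸v)
  -- and permutes the values of d.
  G-incongruent-≤ : ∀ {v} → v ≤ k → ∀ i j → i ≤ j → i % p ≢ j % p → G v i j ≡ T v
  G-incongruent-≤ {v} v≤k i j i≤j i≢j = trans
    (∑-cong (p ^ (k ∸ v)) (λ d → trans
      (cong₂ (λ u w → corr u w (p ^ v * d)) (sym (+-identityʳ i)) (sym (m+[n∸m]≡n i≤j)))
      (trans (corr-shift i 0 (j ∸ i) (p ^ v * d))
        (trans (cong₂ (λ u w → corr u w (p ^ v * d)) (sym (*-zeroʳ (j ∸ i))) (sym (*-identityʳ (j ∸ i))))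
          (trans (corr-scale (j ∸ i) 0 1 (p ^ v * d)) (cong (corr 0 1) (lem (j ∸ i) (p ^ v) d)))))))
    (∑-unit (p ^ (k ∸ v)) {{m^n≢0 p (k ∸ v)}} (corr-periodic v≤k 0 1) (j ∸ i) (proj₁ inverse) (proj₂ inverse))
    where
    lem : ∀ δ V d → δ * (V * d) ≡ V * (δ * d)
    lem = ℕ-Ring.solve-∀
    p∤ : ¬ p ∣ j ∸ i
    p∤ (divides q eq) = i≢j (sym (trans (cong (_% p) (trans (sym (m+[n∸m]≡n i≤j)) (cong (i +_) eq))) ([m+kn]%n≡m%n i q p)))
    inverse = coprime⇒inverse (j ∸ i) (p ^ (k ∸ v)) {{m^n≢0 p (k ∸ v)}} (∤⇒coprime-^ pp p∤ (k ∸ v))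

  G-incongruent : ∀ {v} → v ≤ k → ∀ i j → i % p ≢ j % p → G v i j ≡ T v
  G-incongruent {v} v≤k i j i≢j with ≤-total i j
  ... | inj₁ i≤j = G-incongruent-≤ v≤k i j i≤j i≢j
  ... | inj₂ j≤i = trans (∑-cong (p ^ (k ∸ v)) (λ d → corr-sym i j (p ^ v * d))) (G-incongruent-≤ v≤k j i j≤i (i≢j ∘ sym))

  -- A common factor p of the indices passes to the difference of the progression, p^v d becoming
  -- p^(v+1) d; the sum over d then runs through p copies of the shorter period.
  G-congruent : ∀ {v} → v < k → ∀ c i j → G v (c + p * i) (c + p * j) ≡ pos p *ℤ G (suc v) i j
  G-congruent {v} v<k c i j = trans
    (∑-cong (p ^ (k ∸ v)) (λ d → trans (corr-shift c (p * i) (p * j) (p ^ v * d))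
      (trans (corr-scale p i j (p ^ v * d)) (cong (corr i j) (sym (*-assoc p (p ^ v) d))))))
    (trans (cong (λ m → ∑ m (λ d → corr i j (p ^ suc v * d))) (cong (p ^_) (+-∸-assoc 1 v<k)))
      (∑-copies p (p ^ (k ∸ suc v)) (corr-periodic v<k i j)))

  -- Z v m is the sum over d of the squared sums along progressions of length m and difference p^v d.
  Z : ℕ → ℕ → ℤ
  Z v m = ∑ m (λ i → ∑ m (λ j → G v i j))

  -- Indices below p are distinct modulo p, so off the diagonal every entry is `T v`.
  Z-short : ∀ {v} → v ≤ k → (A : ℤ) → (∀ i → G v i i ≡ A) → ∀ h → suc h ≤ p →
            Z v (suc h) ≡ pos (suc h) *ℤ (A +ℤ pos h *ℤ T v)
  Z-short {v} v≤k A diag h h<p = trans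
    (∑-cong< (suc h) (λ i i<h → ∑-exceptional h i (G v i) A (T v) i<h (diag i)
      (λ j j<h j≢i → G-incongruent v≤k i j (λ eq → j≢i (sym (trans (sym (m<n⇒m%n≡m (<-≤-trans i<h h<p)))
        (trans eq (m<n⇒m%n≡m (<-≤-trans j<h h<p)))))))))
    (∑-const (suc h) _)

  -- Both indices are split by their residue modulo p: pairs from different residues contribute
  -- `T v`, pairs from the same residue descend to level v + 1.
  Z-long : ∀ {v} → v < k → ∀ m →
           Z v (p * m) ≡ pos p *ℤ (pos m *ℤ (pos p′ *ℤ (pos m *ℤ T v))) +ℤ pos p *ℤ (pos p *ℤ Z (suc v) m)
  Z-long {v} v<k m = begin
    Z v (p * m)
      ≡⟨ ∑-residues p m _ ⟩
    ∑ p (λ c → ∑ m (λ y → ∑ (p * m) (λ j → G v (c + p * y) j)))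
      ≡⟨ ∑-cong< p (λ c c<p → ∑-cong m (λ y → row c c<p y)) ⟩
    ∑ p (λ c → ∑ m (λ y → pos p *ℤ R y +ℤ pos p′ *ℤ (pos m *ℤ T v)))
      ≡⟨ ∑-const p _ ⟩
    pos p *ℤ ∑ m (λ y → pos p *ℤ R y +ℤ pos p′ *ℤ (pos m *ℤ T v))
      ≡⟨ cong (pos p *ℤ_) (trans (∑-+ m _ _) (cong₂ _+ℤ_ (∑-*ˡ m (pos p) R) (∑-const m _))) ⟩
    pos p *ℤ (pos p *ℤ Z (suc v) m +ℤ pos m *ℤ (pos p′ *ℤ (pos m *ℤ T v)))
      ≡⟨ lem (pos p) (pos p *ℤ Z (suc v) m) _ ⟩
    pos p *ℤ (pos m *ℤ (pos p′ *ℤ (pos m *ℤ T v))) +ℤ pos p *ℤ (pos p *ℤ Z (suc v) m) ∎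
    where
    open ≡-Reasoning
    R : ℕ → ℤ
    R y = ∑ m (λ y′ → G (suc v) y y′)
    lem : ∀ a b c → a *ℤ (b +ℤ c) ≡ a *ℤ c +ℤ a *ℤ b
    lem = ℤ-Ring.solve-∀
    mod : ∀ {c} y → c < p → (c + p * y) % p ≡ c
    mod {c} y c<p = trans (cong (λ z → (c + z) % p) (*-comm p y)) (trans ([m+kn]%n≡m%n c y p) (m<n⇒m%n≡m c<p))
    row : ∀ c → c < p → ∀ y → ∑ (p * m) (λ j → G v (c + p * y) j) ≡ pos p *ℤ R y +ℤ pos p′ *ℤ (pos m *ℤ T v)
    row c c<p y = trans (∑-residues p m _) (∑-exceptional p′ c _ _ _ c<p
      (trans (∑-cong m (λ y′ → G-congruent v<k c y y′)) (∑-*ˡ m (pos p) _))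
      (λ c′ c′<p c′≢c → trans (∑-cong m (λ y′ → G-incongruent (<⇒≤ v<k) (c + p * y) (c′ + p * y′)
          (λ eq → c′≢c (sym (trans (sym (mod y c<p)) (trans eq (mod y′ c′<p)))))))
        (∑-const m (T v))))

  -- For v < k, only the differences p^v d with d prime to p remain.
  Q : ℕ → ℕ → ℤ
  Q v m = Z v m -ℤ Z (suc v) m

  -- `Z-long` gives Q v (p m) = p p′ m² (T v - T (v+1)) + p² Q (v+1) m. With m = h p^(j-1) every
  -- level contributes the same coefficient p′ h² p^(2j-1), so the values of T telescope; the factor
  -- p on the left clears the odd power.
  Q-long : ∀ h j v → v + j < k →
    pos p *ℤ Q v (h * p ^ j) ≡
      pos p′ *ℤ (pos (p ^ j) *ℤ pos (p ^ j)) *ℤ (pos h *ℤ pos h) *ℤ (T v -ℤ T (v + j))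
      +ℤ pos p *ℤ (pos (p ^ j) *ℤ pos (p ^ j)) *ℤ Q (v + j) h
  Q-long h zero v v<k = trans (cong₂ (λ a b → pos p *ℤ Q a b) (sym (+-identityʳ v)) (*-identityʳ h))
    (trans (lem (pos p) (pos p′) (pos h) (T v) (Q (v + 0) h))
      (cong (λ z → pos p′ *ℤ (pos 1 *ℤ pos 1) *ℤ (pos h *ℤ pos h) *ℤ (T v -ℤ T z) +ℤ pos p *ℤ (pos 1 *ℤ pos 1) *ℤ Q (v + 0) h) (sym (+-identityʳ v))))
    where
    lem : ∀ p p′ h t q → p *ℤ q ≡ p′ *ℤ (pos 1 *ℤ pos 1) *ℤ (h *ℤ h) *ℤ (t -ℤ t) +ℤ p *ℤ (pos 1 *ℤ pos 1) *ℤ q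
    lem = ℤ-Ring.solve-∀
  Q-long h (suc j) v v<k = begin
    P *ℤ Q v (h * p ^ suc j)
      ≡⟨ cong (λ z → P *ℤ Q v z) (lem₁ h p (p ^ j)) ⟩
    P *ℤ (Z v (p * m) -ℤ Z (suc v) (p * m))
      ≡⟨ cong₂ (λ a b → P *ℤ (a -ℤ b)) (Z-long (≤-<-trans (m≤m+n v (suc j)) v<k) m)
           (Z-long (≤-<-trans (m≤m+n (suc v) j) v<k′) m) ⟩
    P *ℤ (P *ℤ (M *ℤ (P′ *ℤ (M *ℤ T v))) +ℤ P *ℤ (P *ℤ Z (suc v) m) -ℤ
      (P *ℤ (M *ℤ (P′ *ℤ (M *ℤ T (suc v)))) +ℤ P *ℤ (P *ℤ Z (suc (suc v)) m)))
      ≡⟨ lem₂ P P′ M (T v) (T (suc v)) (Z (suc v) m) (Z (suc (suc v)) m) ⟩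
    P *ℤ P *ℤ P′ *ℤ (M *ℤ M) *ℤ (T v -ℤ T (suc v)) +ℤ P *ℤ P *ℤ (P *ℤ Q (suc v) m)
      ≡⟨ cong₂ (λ a b → P *ℤ P *ℤ P′ *ℤ (a *ℤ a) *ℤ (T v -ℤ T (suc v)) +ℤ P *ℤ P *ℤ b) (ℤₚ.pos-* h (p ^ j)) (Q-long h j (suc v) v<k′) ⟩
    P *ℤ P *ℤ P′ *ℤ (H *ℤ J *ℤ (H *ℤ J)) *ℤ (T v -ℤ T (suc v)) +ℤ
      P *ℤ P *ℤ (P′ *ℤ (J *ℤ J) *ℤ (H *ℤ H) *ℤ (T (suc v) -ℤ T (suc v + j)) +ℤ P *ℤ (J *ℤ J) *ℤ Q (suc v + j) h)
      ≡⟨ lem₃ P P′ H J (T v) (T (suc v)) (T (suc v + j)) (Q (suc v + j) h) ⟩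
    P′ *ℤ (P *ℤ J *ℤ (P *ℤ J)) *ℤ (H *ℤ H) *ℤ (T v -ℤ T (suc v + j)) +ℤ P *ℤ (P *ℤ J *ℤ (P *ℤ J)) *ℤ Q (suc v + j) h
      ≡⟨ cong₂ (λ a b → P′ *ℤ (a *ℤ a) *ℤ (H *ℤ H) *ℤ (T v -ℤ T b) +ℤ P *ℤ (a *ℤ a) *ℤ Q b h) (sym (ℤₚ.pos-* p (p ^ j))) (sym (+-suc v j)) ⟩
    P′ *ℤ (pos (p ^ suc j) *ℤ pos (p ^ suc j)) *ℤ (H *ℤ H) *ℤ (T v -ℤ T (v + suc j))
      +ℤ P *ℤ (pos (p ^ suc j) *ℤ pos (p ^ suc j)) *ℤ Q (v + suc j) h ∎
    where
    open ≡-Reasoning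
    m = h * p ^ j
    P = pos p
    P′ = pos p′
    M = pos m
    H = pos h
    J = pos (p ^ j)
    v<k′ : suc v + j < k
    v<k′ = subst (_< k) (+-suc v j) v<k
    lem₁ : ∀ h p x → h * (p * x) ≡ p * (h * x)
    lem₁ = ℕ-Ring.solve-∀
    lem₂ : ∀ P P′ M t t₁ z z₁ → P *ℤ (P *ℤ (M *ℤ (P′ *ℤ (M *ℤ t))) +ℤ P *ℤ (P *ℤ z) -ℤ (P *ℤ (M *ℤ (P′ *ℤ (M *ℤ t₁))) +ℤ P *ℤ (P *ℤ z₁)))
      ≡ P *ℤ P *ℤ P′ *ℤ (M *ℤ M) *ℤ (t -ℤ t₁) +ℤ P *ℤ P *ℤ (P *ℤ (z -ℤ z₁))
    lem₂ = ℤ-Ring.solve-∀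
    lem₃ : ∀ P P′ H J t t₁ tₑ q → P *ℤ P *ℤ P′ *ℤ (H *ℤ J *ℤ (H *ℤ J)) *ℤ (t -ℤ t₁) +ℤ P *ℤ P *ℤ (P′ *ℤ (J *ℤ J) *ℤ (H *ℤ H) *ℤ (t₁ -ℤ tₑ) +ℤ P *ℤ (J *ℤ J) *ℤ q)
      ≡ P′ *ℤ (P *ℤ J *ℤ (P *ℤ J)) *ℤ (H *ℤ H) *ℤ (t -ℤ tₑ) +ℤ P *ℤ (P *ℤ J *ℤ (P *ℤ J)) *ℤ q
    lem₃ = ℤ-Ring.solve-∀

  energy : ℕ → ℕ → ℤ
  energy m d = ∑ n (λ a → ∑ m (λ i → f (a + i * d)) *ℤ ∑ m (λ i → f (a + i * d)))

  Z-energy : ∀ v m → Z v m ≡ ∑ (p ^ (k ∸ v)) (λ d → energy m (p ^ v * d))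
  Z-energy v m = begin
    ∑ m (λ i → ∑ m (λ j → ∑ N (λ d → corr i j (p ^ v * d))))
      ≡⟨ ∑-cong m (λ i → ∑-swap m N _) ⟩
    ∑ m (λ i → ∑ N (λ d → ∑ m (λ j → corr i j (p ^ v * d))))
      ≡⟨ ∑-swap m N _ ⟩
    ∑ N (λ d → ∑ m (λ i → ∑ m (λ j → corr i j (p ^ v * d))))
      ≡⟨ ∑-cong N (λ d → trans (∑-cong m (λ i → ∑-swap m n _)) (trans (∑-swap m n _) (∑-cong n (λ a → sym (∑-square m _))))) ⟩
    ∑ N (λ d → energy m (p ^ v * d)) ∎
    where
    open ≡-Reasoning
    N = p ^ (k ∸ v)

-- Lower bound: sign of the terms and choice of the length

0≤* : ∀ m {i} → pos 0 ≤ℤ i → pos 0 ≤ℤ pos m *ℤ i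
0≤* m {i} 0≤i = subst (_≤ℤ pos m *ℤ i) (ℤₚ.*-zeroʳ (pos m)) (ℤₚ.*-monoˡ-≤-nonNeg (pos m) 0≤i)

module LowerBound (p′ k : ℕ) (pp : Prime (suc p′)) (0<k : 0 < k) (f : ℕ → ℤ) (per : Periodic (suc p′ ^ k) f)
  (f²≡1 : ∀ x → f x *ℤ f x ≡ pos 1) (D : ℕ)
  (apBound : ∀ a d l → l * gcd (suc p′ ^ k) d ≤ suc p′ ^ k → ∣ ∑ l (λ i → f (a + i * d)) ∣ ≤ D) where

  open Correlations p′ k pp f per

  private
    p n : ℕ
    p = suc p′
    n = p ^ k

  ∣f∣≡1 : ∀ x → ∣ f x ∣ ≡ 1
  ∣f∣≡1 x = m*n≡1⇒m≡1 ∣ f x ∣ ∣ f x ∣ (trans (sym (ℤₚ.abs-* (f x) (f x))) (cong ∣_∣ (f²≡1 x)))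

  -- Subtracting the multiples of p leaves differences that are units modulo n. Their gcd with n is
  -- 1, so any length up to n is a legal progression and each square is at most D².
  Q₀-upper : ∀ l → l ≤ n → Q 0 l ≤ℤ pos p′ *ℤ (pos (p ^ (k ∸ 1)) *ℤ (pos n *ℤ pos (D * D)))
  Q₀-upper l l≤n = ℤₚ.≤-trans (ℤₚ.≤-reflexive Q₀-units) (ℤₚ.≤-trans
    (∑-mono< p′ (λ c c<p′ → ℤₚ.≤-trans (∑-mono< N (λ y _ → energy≤ c c<p′ y)) (ℤₚ.≤-reflexive (∑-const N _))))
    (ℤₚ.≤-reflexive (∑-const p′ _)))
    where
    N = p ^ (k ∸ 1)
    E : ℕ → ℤ
    E = energy l
    Q₀-units : Q 0 l ≡ ∑ p′ (λ c → ∑ N (λ y → E (suc c + p * y)))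
    Q₀-units = trans (cong₂ _-ℤ_
        (trans (Z-energy 0 l) (trans (cong₂ ∑ (cong (p ^_) (sym (m+[n∸m]≡n 0<k))) refl)
          (trans (∑-cong (p * N) (λ d → cong E (*-identityˡ d))) (∑-residues p N E))))
        (trans (Z-energy 1 l) (∑-cong N (λ d → cong (λ z → E (z * d)) (*-identityʳ p)))))
      (lem (∑ N (λ y → E (p * y))) _)
      where
      lem : ∀ a b → (a +ℤ b) -ℤ a ≡ b
      lem = ℤ-Ring.solve-∀
    energy≤ : ∀ c → c < p′ → ∀ y → E (suc c + p * y) ≤ℤ pos n *ℤ pos (D * D)
    energy≤ c c<p′ y = ℤₚ.≤-trans (∑-mono< n (λ a _ → i*i≤ (∑ l (λ i → f (a + i * d))) D (apBound a d l
        (subst (λ g → l * g ≤ n) (sym gcd≡1) (subst (_≤ n) (sym (*-identityʳ l)) l≤n)))))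
      (ℤₚ.≤-reflexive (∑-const n _))
      where
      d = suc c + p * y
      p∤d : ¬ p ∣ d
      p∤d p∣d = 1+n≢0 (trans (sym (m<n⇒m%n≡m (s≤s c<p′))) (trans (sym ([m+kn]%n≡m%n (suc c) y p))
        (trans (cong (λ z → (suc c + z) % p) (*-comm y p)) (n∣m⇒m%n≡0 d p p∣d))))
      gcd≡1 : gcd n d ≡ 1
      gcd≡1 = coprime⇒gcd≡1 (Coprimality.sym (∤⇒coprime-^ pp p∤d k))

  T-coset : ∀ v → T v ≡ ∑ n (λ a → f a *ℤ ∑ (p ^ (k ∸ v)) (λ d → f (a + d * p ^ v)))
  T-coset v = trans (∑-swap (p ^ (k ∸ v)) n _) (∑-cong n (λ a → trans
    (∑-cong (p ^ (k ∸ v)) (λ d → cong₂ (λ x y → f x *ℤ f (a + y)) (+-identityʳ a)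
      (trans (*-identityˡ (p ^ v * d)) (*-comm (p ^ v) d))))
    (∑-*ˡ (p ^ (k ∸ v)) (f a) _)))

  T≤ : ∀ v B → (∀ a → ∣ ∑ (p ^ (k ∸ v)) (λ d → f (a + d * p ^ v)) ∣ ≤ B) → T v ≤ℤ pos n *ℤ pos B
  T≤ v B bound = ℤₚ.≤-trans (ℤₚ.≤-reflexive (T-coset v)) (ℤₚ.≤-trans
    (∑-mono< n (λ a _ → ℤₚ.≤-trans (i≤∣i∣ _) (ℤ.+≤+ (≤-trans (≤-reflexive (trans (ℤₚ.abs-* (f a) _)
      (trans (cong (_* ∣ ∑ (p ^ (k ∸ v)) (λ d → f (a + d * p ^ v)) ∣) (∣f∣≡1 a)) (*-identityˡ _)))) (bound a)))))
    (ℤₚ.≤-reflexive (∑-const n _)))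

  -- A residue class modulo p^v is itself a progression, of difference p^v and full length.
  T≤nD : ∀ v → v ≤ k → T v ≤ℤ pos n *ℤ pos D
  T≤nD v v≤k = T≤ v D (λ a → apBound a (p ^ v) (p ^ (k ∸ v))
    (≤-trans (*-monoʳ-≤ (p ^ (k ∸ v)) (∣⇒≤ {{m^n≢0 p v}} (gcd[m,n]∣n n (p ^ v)))) (≤-reflexive (p^[k∸v]*p^v v≤k))))

  T≤trivial : ∀ v → T v ≤ℤ pos n *ℤ pos (p ^ (k ∸ v))
  T≤trivial v = T≤ v (p ^ (k ∸ v)) (λ a → ≤-trans (∑-bound (p ^ (k ∸ v)) 1 (λ d _ → ≤-reflexive (∣f∣≡1 _)))
    (≤-reflexive (*-identityʳ _)))

  -- The inner sum of `T 0` covers all of ℤ/n, so `T 0` is the square of the total sum.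
  0≤T₀ : pos 0 ≤ℤ T 0
  0≤T₀ = subst (pos 0 ≤ℤ_) (sym (trans (T-coset 0) (trans
    (∑-cong n (λ a → cong (f a *ℤ_) (trans (∑-cong n (λ d → cong f (trans (+-comm a (d * 1)) (cong (_+ a) (*-identityʳ d)))))
      (∑-shift n per a))))
    (∑-*ʳ n (∑ n f) f)))) (0≤i*i (∑ n f))

  G-diagonal : ∀ v i → G v i i ≡ pos (p ^ (k ∸ v)) *ℤ pos n
  G-diagonal v i = trans (∑-cong (p ^ (k ∸ v)) (λ d → trans (∑-cong n (λ a → f²≡1 _))
    (trans (∑-const n (pos 1)) (ℤₚ.*-identityʳ (pos n))))) (∑-const (p ^ (k ∸ v)) (pos n))

  module _ (e h h′ : ℕ) (e<k : suc e ≤ k) (p≡ : p ≡ suc h + h′) where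

    private
      P s : ℕ
      P = p ^ e
      s = p ^ (k ∸ suc e)
      h<p : suc h ≤ p
      h<p = subst (suc h ≤_) (sym p≡) (m≤m+n (suc h) h′)
      H H′ p̂ p̂′ N Ŝ : ℤ
      H = pos (suc h)
      H′ = pos h′
      p̂ = pos p
      p̂′ = pos p′
      N = pos n
      Ŝ = pos s

    -- After `Q-long` and `Z-short`, with H = h + 1 and up to the factor P², the coefficients are
    -- p′H² for T 0, -Hh′ for T e and -pHh for T (e+1). The diagonal gives p p′ H S N, where S is
    -- `s` and p′ = h + h′: the part with h pays for T (e+1), and the part with h′, less the cost of
    -- T e, is the gain.
    Q₀-lower : pos P *ℤ pos P *ℤ (H *ℤ H′ *ℤ N) *ℤ (p̂ *ℤ Ŝ -ℤ pos D) ≤ℤ p̂ *ℤ Q 0 (suc h * P)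
    Q₀-lower = ℤₚ.≤-trans (subst (_≤ℤ lower +ℤ rest) (ℤₚ.+-identityʳ lower) (ℤₚ.+-monoʳ-≤ lower 0≤rest)) (ℤₚ.≤-reflexive (sym expand))
      where
      T₁ = T e
      T₂ = T (suc e)
      lower = pos P *ℤ pos P *ℤ (H *ℤ H′ *ℤ N) *ℤ (p̂ *ℤ Ŝ -ℤ pos D)
      r₁ = pos (p′ * (suc h * suc h)) *ℤ T 0
      r₂ = pos (suc h * h′) *ℤ (N *ℤ pos D -ℤ T₁)
      r₃ = pos (p * (suc h * h)) *ℤ (N *ℤ Ŝ -ℤ T₂)
      rest = pos (P * P) *ℤ (r₁ +ℤ r₂ +ℤ r₃)
      0≤rest : pos 0 ≤ℤ rest
      0≤rest = 0≤* (P * P) (ℤₚ.+-mono-≤ (ℤₚ.+-mono-≤ (0≤* (p′ * (suc h * suc h)) 0≤T₀)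
        (0≤* (suc h * h′) (ℤₚ.i≤j⇒0≤j-i (T≤nD e (<⇒≤ e<k))))) (0≤* (p * (suc h * h)) (ℤₚ.i≤j⇒0≤j-i (T≤trivial (suc e)))))
      identity : ∀ h h′ S N D T₀ T₁ T₂ J →
        let H = pos 1 +ℤ h ; p = H +ℤ h′ ; p′ = h +ℤ h′ in
        p′ *ℤ (J *ℤ J) *ℤ (H *ℤ H) *ℤ (T₀ -ℤ T₁)
          +ℤ p *ℤ (J *ℤ J) *ℤ (H *ℤ (p *ℤ S *ℤ N +ℤ h *ℤ T₁) -ℤ H *ℤ (S *ℤ N +ℤ h *ℤ T₂))
        ≡ J *ℤ J *ℤ (H *ℤ h′ *ℤ N) *ℤ (p *ℤ S -ℤ D) +ℤ
          J *ℤ J *ℤ (p′ *ℤ (H *ℤ H) *ℤ T₀ +ℤ H *ℤ h′ *ℤ (N *ℤ D -ℤ T₁) +ℤ p *ℤ (H *ℤ h) *ℤ (N *ℤ S -ℤ T₂))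
      identity = ℤ-Ring.solve-∀
      p′≡ : p′ ≡ h + h′
      p′≡ = suc-injective p≡
      expand : p̂ *ℤ Q 0 (suc h * P) ≡ lower +ℤ rest
      expand = begin
        p̂ *ℤ Q 0 (suc h * P)
          ≡⟨ Q-long (suc h) e 0 e<k ⟩
        p̂′ *ℤ (pos P *ℤ pos P) *ℤ (H *ℤ H) *ℤ (T 0 -ℤ T₁) +ℤ p̂ *ℤ (pos P *ℤ pos P) *ℤ Q e (suc h)
          ≡⟨ cong (λ z → p̂′ *ℤ (pos P *ℤ pos P) *ℤ (H *ℤ H) *ℤ (T 0 -ℤ T₁) +ℤ p̂ *ℤ (pos P *ℤ pos P) *ℤ z)
               (cong₂ _-ℤ_
                 (trans (Z-short (<⇒≤ e<k) _ (G-diagonal e) h h<p)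
                   (cong (λ z → H *ℤ (z *ℤ N +ℤ pos h *ℤ T₁)) (trans (cong (λ z → pos (p ^ z)) (+-∸-assoc 1 e<k)) (ℤₚ.pos-* p s))))
                 (Z-short e<k _ (G-diagonal (suc e)) h h<p)) ⟩
        p̂′ *ℤ (pos P *ℤ pos P) *ℤ (H *ℤ H) *ℤ (T 0 -ℤ T₁) +ℤ p̂ *ℤ (pos P *ℤ pos P) *ℤ
          (H *ℤ (p̂ *ℤ Ŝ *ℤ N +ℤ pos h *ℤ T₁) -ℤ H *ℤ (Ŝ *ℤ N +ℤ pos h *ℤ T₂))
          ≡⟨ cong₂ (λ a b → a *ℤ (pos P *ℤ pos P) *ℤ (H *ℤ H) *ℤ (T 0 -ℤ T₁) +ℤ b *ℤ (pos P *ℤ pos P) *ℤ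
               (H *ℤ (b *ℤ Ŝ *ℤ N +ℤ pos h *ℤ T₁) -ℤ H *ℤ (Ŝ *ℤ N +ℤ pos h *ℤ T₂))) (cong pos p′≡) (cong pos p≡) ⟩
        _
          ≡⟨ identity (pos h) (pos h′) Ŝ N (pos D) (T 0) T₁ T₂ (pos P) ⟩
        _
          ≡⟨ cong₂ (λ a b → pos P *ℤ pos P *ℤ (H *ℤ H′ *ℤ N) *ℤ (b *ℤ Ŝ -ℤ pos D) +ℤ
               pos P *ℤ pos P *ℤ (a *ℤ (H *ℤ H) *ℤ T 0 +ℤ H *ℤ H′ *ℤ (N *ℤ pos D -ℤ T₁) +ℤ b *ℤ (H *ℤ pos h) *ℤ (N *ℤ Ŝ -ℤ T₂)))
               (cong pos (sym p′≡)) (cong pos (sym p≡)) ⟩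
        lower +ℤ pos P *ℤ pos P *ℤ (p̂′ *ℤ (H *ℤ H) *ℤ T 0 +ℤ H *ℤ H′ *ℤ (N *ℤ pos D -ℤ T₁) +ℤ p̂ *ℤ (H *ℤ pos h) *ℤ (N *ℤ Ŝ -ℤ T₂))
          ≡⟨ cong (lower +ℤ_) (cong₂ _*ℤ_ (sym (ℤₚ.pos-* P P)) (cong₂ _+ℤ_ (cong₂ _+ℤ_
               (cong (_*ℤ T 0) (pos-*³ p′ (suc h) (suc h)))
               (cong (_*ℤ (N *ℤ pos D -ℤ T₁)) (sym (ℤₚ.pos-* (suc h) h′))))
               (cong (_*ℤ (N *ℤ Ŝ -ℤ T₂)) (pos-*³ p (suc h) h)))) ⟩
        lower +ℤ rest ∎
        where
        open ≡-Reasoning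
        pos-*³ : ∀ a b c → pos a *ℤ (pos b *ℤ pos c) ≡ pos (a * (b * c))
        pos-*³ a b c = sym (trans (ℤₚ.pos-* a (b * c)) (cong (pos a *ℤ_) (ℤₚ.pos-* b c)))

    -- Since 2D ≤ ps, the deduction of D in `Q₀-lower` costs at most half of the main term. The two
    -- sides are compared after multiplication by n · P · ps, which is n².
    unit-average : suc h * P ≤ n → 2 * D ≤ p * s → P * (suc h * h′) ≤ 2 * (p′ * (D * D))
    unit-average l≤n 2D≤ps = *-cancelʳ-≤ _ _ (n * (P * (p * s))) {{nz}} (begin
      P * (suc h * h′) * (n * (P * (p * s)))       ≡⟨ lem₁ P (suc h) h′ n (p * s) ⟩
      P * P * (suc h * h′ * n) * (p * s)           ≤⟨ *-monoʳ-≤ (P * P * (suc h * h′ * n)) ps≤2x ⟩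
      P * P * (suc h * h′ * n) * (2 * x)           ≡⟨ lem₂ (P * P * (suc h * h′ * n)) x ⟩
      2 * (P * P * (suc h * h′ * n) * x)           ≤⟨ *-monoʳ-≤ 2 key ⟩
      2 * (p * (p′ * (p ^ (k ∸ 1) * (n * (D * D))))) ≡⟨ lem₃ p p′ (p ^ (k ∸ 1)) n (D * D) ⟩
      2 * (p′ * (D * D)) * (n * (p * p ^ (k ∸ 1))) ≡⟨ cong (λ z → 2 * (p′ * (D * D)) * (n * z)) p*N≡ ⟩
      2 * (p′ * (D * D)) * (n * (P * (p * s)))     ∎)
      where
      open ≤-Reasoning
      x = p * s ∸ D
      D≤ps : D ≤ p * s
      D≤ps = ≤-trans (m≤n*m D 2) 2D≤ps
      x+D≡ : x + D ≡ p * s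
      x+D≡ = m∸n+n≡m D≤ps
      ps≤2x : p * s ≤ 2 * x
      ps≤2x = subst₂ _≤_ x+D≡ (lem x) (+-monoʳ-≤ x (+-cancelʳ-≤ D D x
        (subst₂ _≤_ (cong (D +_) (+-identityʳ D)) (sym x+D≡) 2D≤ps)))
        where
        lem : ∀ x → x + x ≡ 2 * x
        lem = ℕ-Ring.solve-∀
      P*ps≡n : P * (p * s) ≡ n
      P*ps≡n = trans (lem P p s) (trans (sym (^-distribˡ-+-* p (suc e) (k ∸ suc e))) (cong (p ^_) (m+[n∸m]≡n e<k)))
        where
        lem : ∀ P p s → P * (p * s) ≡ p * P * s
        lem = ℕ-Ring.solve-∀
      p*N≡ : p * p ^ (k ∸ 1) ≡ P * (p * s)
      p*N≡ = trans (cong (p ^_) (m+[n∸m]≡n 0<k)) (sym P*ps≡n)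
      nz : NonZero (n * (P * (p * s)))
      nz = subst (λ z → NonZero (n * z)) (sym P*ps≡n) (m*n≢0 n n {{m^n≢0 p k}} {{m^n≢0 p k}})
      lem₁ : ∀ P h h′ n y → P * (h * h′) * (n * (P * y)) ≡ P * P * (h * h′ * n) * y
      lem₁ = ℕ-Ring.solve-∀
      lem₂ : ∀ a x → a * (2 * x) ≡ 2 * (a * x)
      lem₂ = ℕ-Ring.solve-∀
      lem₃ : ∀ p p′ N n d → 2 * (p * (p′ * (N * (n * d)))) ≡ 2 * (p′ * d) * (n * (p * N))
      lem₃ = ℕ-Ring.solve-∀
      diff : p̂ *ℤ Ŝ -ℤ pos D ≡ pos x
      diff = trans (cong (_-ℤ pos D) (trans (sym (ℤₚ.pos-* p s)) (cong pos (sym x+D≡)))) (lem (pos x) (pos D))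
        where
        lem : ∀ x d → x +ℤ d -ℤ d ≡ x
        lem = ℤ-Ring.solve-∀
      castˡ : pos P *ℤ pos P *ℤ (H *ℤ H′ *ℤ N) *ℤ (p̂ *ℤ Ŝ -ℤ pos D) ≡ pos (P * P * (suc h * h′ * n) * x)
      castˡ = trans (cong₂ _*ℤ_ (trans (cong₂ _*ℤ_ (sym (ℤₚ.pos-* P P))
        (trans (cong (_*ℤ N) (sym (ℤₚ.pos-* (suc h) h′))) (sym (ℤₚ.pos-* (suc h * h′) n)))) (sym (ℤₚ.pos-* (P * P) (suc h * h′ * n)))) diff)
        (sym (ℤₚ.pos-* (P * P * (suc h * h′ * n)) x))
      castʳ : p̂ *ℤ (p̂′ *ℤ (pos (p ^ (k ∸ 1)) *ℤ (N *ℤ pos (D * D)))) ≡ pos (p * (p′ * (p ^ (k ∸ 1) * (n * (D * D)))))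
      castʳ = sym (trans (ℤₚ.pos-* p _) (cong (p̂ *ℤ_) (trans (ℤₚ.pos-* p′ _) (cong (p̂′ *ℤ_)
        (trans (ℤₚ.pos-* (p ^ (k ∸ 1)) _) (cong (pos (p ^ (k ∸ 1)) *ℤ_) (ℤₚ.pos-* n (D * D))))))))
      key : P * P * (suc h * h′ * n) * x ≤ p * (p′ * (p ^ (k ∸ 1) * (n * (D * D))))
      key = ℤₚ.drop‿+≤+ (subst₂ _≤ℤ_ castˡ castʳ (ℤₚ.≤-trans Q₀-lower
        (ℤₚ.*-monoˡ-≤-nonNeg p̂ (Q₀-upper (suc h * P) l≤n))))

  -- If D exceeds p^(t+1)/2, its square already suffices, because k - t ≤ 2t + 2. Otherwise
  -- `unit-average` applies with the leading factor ⌊p/2⌋; then ⌊p/2⌋ (p - ⌊p/2⌋) ≥ p²/6, and 12 = 6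
  -- · 2.
  lower : p ^ (k ∸ k / 3) ≤ 12 * (D * D)
  lower with 2 * D ≤? p * p ^ (k / 3)
  ... | no 2D≰ps = begin
    p ^ (k ∸ t)                       ≤⟨ ^-monoʳ-≤ p e≤ ⟩
    p ^ (suc t + suc t)               ≡⟨ ^-distribˡ-+-* p (suc t) (suc t) ⟩
    p ^ suc t * p ^ suc t             ≤⟨ *-mono-≤ ps≤2D ps≤2D ⟩
    2 * D * (2 * D)                   ≡⟨ lem D ⟩
    4 * (D * D)                       ≤⟨ *-monoˡ-≤ (D * D) (m≤m+n 4 8) ⟩
    12 * (D * D)                      ∎
    where
    open ≤-Reasoning
    t = k / 3
    ps≤2D : p ^ suc t ≤ 2 * D
    ps≤2D = <⇒≤ (≰⇒> 2D≰ps)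
    lem : ∀ D → 2 * D * (2 * D) ≡ 4 * (D * D)
    lem = ℕ-Ring.solve-∀
    k≤ : k ≤ t + (suc t + suc t)
    k≤ = begin
      k                     ≡⟨ m≡m%n+[m/n]*n k 3 ⟩
      k % 3 + t * 3         ≤⟨ +-monoˡ-≤ (t * 3) (≤-pred (m%n<n k 3)) ⟩
      2 + t * 3             ≡⟨ lem′ t ⟩
      t + (suc t + suc t)   ∎
      where
      lem′ : ∀ t → 2 + t * 3 ≡ t + ((1 + t) + (1 + t))
      lem′ = ℕ-Ring.solve-∀
    e≤ : k ∸ t ≤ suc t + suc t
    e≤ = m≤n+o⇒m∸n≤o k t k≤
  ... | yes 2D≤ps = *-cancelʳ-≤ _ _ p (begin
    p ^ (k ∸ t) * p               ≡⟨ cong (λ z → p ^ z * p) e≡ ⟩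
    p * P * p                     ≡⟨ lem₁ p P ⟩
    P * (p * p)                   ≤⟨ *-monoʳ-≤ P pp≤ ⟩
    P * (6 * (suc h * h′))        ≡⟨ lem₂ P (suc h * h′) ⟩
    6 * (P * (suc h * h′))        ≤⟨ *-monoʳ-≤ 6 (unit-average e₁ h h′ e<k p≡ l≤n (subst (λ z → 2 * D ≤ p * p ^ z) t≡ 2D≤ps)) ⟩
    6 * (2 * (p′ * (D * D)))      ≡⟨ lem₃ p′ (D * D) ⟩
    12 * (D * D) * p′             ≤⟨ *-monoʳ-≤ (12 * (D * D)) (n≤1+n p′) ⟩
    12 * (D * D) * p              ∎)
    where
    open ≤-Reasoning
    t = k / 3
    t<k : t < k
    t<k = m/n<m k 3 {{>-nonZero 0<k}} (s≤s (s≤s z≤n))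
    e₁ = k ∸ suc t
    P = p ^ e₁
    e≡ : k ∸ t ≡ suc e₁
    e≡ = +-∸-assoc 1 t<k
    e<k : suc e₁ ≤ k
    e<k = subst (_≤ k) e≡ (m∸n≤m k t)
    t≡ : t ≡ k ∸ suc e₁
    t≡ = trans (sym (m∸[m∸n]≡n (<⇒≤ t<k))) (cong (k ∸_) e≡)
    half = p / 2
    1≤half : 1 ≤ half
    1≤half = /-monoˡ-≤ 2 (nonTrivial⇒n>1 p {{prime⇒nonTrivial pp}})
    h = half ∸ 1
    h≡ : suc h ≡ half
    h≡ = m+[n∸m]≡n 1≤half
    h′ = p ∸ suc h
    h≤p : suc h ≤ p
    h≤p = subst (_≤ p) (sym h≡) (m/n≤m p 2)
    p≡ : p ≡ suc h + h′
    p≡ = sym (m+[n∸m]≡n h≤p)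
    p≡2h+r : p ≡ p % 2 + suc h * 2
    p≡2h+r = trans (m≡m%n+[m/n]*n p 2) (cong (λ z → p % 2 + z * 2) (sym h≡))
    -- Equality holds for p = 3.
    p≤3h : p ≤ 3 * suc h
    p≤3h = begin
      p                    ≡⟨ p≡2h+r ⟩
      p % 2 + suc h * 2    ≤⟨ +-monoˡ-≤ (suc h * 2) (≤-trans (≤-pred (m%n<n p 2)) (s≤s z≤n)) ⟩
      suc h + suc h * 2    ≡⟨ lem (suc h) ⟩
      3 * suc h            ∎
      where
      lem : ∀ h → h + h * 2 ≡ 3 * h
      lem = ℕ-Ring.solve-∀
    h≤h′ : suc h ≤ h′
    h≤h′ = +-cancelˡ-≤ (suc h) (suc h) h′ (begin
      suc h + suc h        ≡⟨ lem (suc h) ⟩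
      suc h * 2            ≤⟨ m≤n+m (suc h * 2) (p % 2) ⟩
      p % 2 + suc h * 2    ≡⟨ trans (sym p≡2h+r) p≡ ⟩
      suc h + h′           ∎)
      where
      lem : ∀ h → h + h ≡ h * 2
      lem = ℕ-Ring.solve-∀
    pp≤ : p * p ≤ 6 * (suc h * h′)
    pp≤ = begin
      p * p                         ≤⟨ *-mono-≤ p≤3h (≤-trans (≤-reflexive p≡) (+-monoˡ-≤ h′ h≤h′)) ⟩
      3 * suc h * (h′ + h′)         ≡⟨ lem (suc h) h′ ⟩
      6 * (suc h * h′)              ∎
      where
      lem : ∀ h h′ → 3 * h * (h′ + h′) ≡ 6 * (h * h′)
      lem = ℕ-Ring.solve-∀
    l≤n : suc h * P ≤ n
    l≤n = ≤-trans (*-monoˡ-≤ P h≤p) (^-monoʳ-≤ p e<k)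
    lem₁ : ∀ p P → p * P * p ≡ P * (p * p)
    lem₁ = ℕ-Ring.solve-∀
    lem₂ : ∀ P x → P * (6 * x) ≡ 6 * (P * x)
    lem₂ = ℕ-Ring.solve-∀
    lem₃ : ∀ p′ d → 6 * (2 * (p′ * d)) ≡ 12 * d * p′
    lem₃ = ℕ-Ring.solve-∀

-- Pigeonhole with priced statistics

private variable
  X Y : Set

Σₗ : (X → ℕ) → List X → ℕ
Σₗ f []       = 0
Σₗ f (x ∷ xs) = f x + Σₗ f xs

Σₗ-cong : ∀ {f g : X → ℕ} → (∀ x → f x ≡ g x) → ∀ xs → Σₗ f xs ≡ Σₗ g xs
Σₗ-cong eq []       = refl
Σₗ-cong eq (x ∷ xs) = cong₂ _+_ (eq x) (Σₗ-cong eq xs)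

Σₗ-mono : ∀ {f g : X → ℕ} {xs} → All (λ x → f x ≤ g x) xs → Σₗ f xs ≤ Σₗ g xs
Σₗ-mono []         = z≤n
Σₗ-mono (le ∷ les) = +-mono-≤ le (Σₗ-mono les)

Σₗ-mono′ : ∀ {f g : X → ℕ} → (∀ x → f x ≤ g x) → ∀ xs → Σₗ f xs ≤ Σₗ g xs
Σₗ-mono′ le xs = Σₗ-mono (All.universal le xs)

+-interchange : ∀ a b c d → (a + b) + (c + d) ≡ (a + c) + (b + d)
+-interchange = ℕ-Ring.solve-∀

Σₗ-+ : ∀ (f g : X → ℕ) xs → Σₗ (λ x → f x + g x) xs ≡ Σₗ f xs + Σₗ g xs
Σₗ-+ f g []       = refl
Σₗ-+ f g (x ∷ xs) = trans (cong (f x + g x +_) (Σₗ-+ f g xs)) (+-interchange (f x) (g x) (Σₗ f xs) (Σₗ g xs))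

Σₗ-*ˡ : ∀ c (f : X → ℕ) xs → Σₗ (λ x → c * f x) xs ≡ c * Σₗ f xs
Σₗ-*ˡ c f []       = sym (*-zeroʳ c)
Σₗ-*ˡ c f (x ∷ xs) = trans (cong (c * f x +_) (Σₗ-*ˡ c f xs)) (sym (*-distribˡ-+ c (f x) (Σₗ f xs)))

Σₗ-const : ∀ c (xs : List X) → Σₗ (λ _ → c) xs ≡ length xs * c
Σₗ-const c []       = refl
Σₗ-const c (x ∷ xs) = cong (c +_) (Σₗ-const c xs)

Σₗ-++ : ∀ (f : X → ℕ) xs ys → Σₗ f (xs ++ ys) ≡ Σₗ f xs + Σₗ f ys
Σₗ-++ f []       ys = refl
Σₗ-++ f (x ∷ xs) ys = trans (cong (f x +_) (Σₗ-++ f xs ys)) (sym (+-assoc (f x) _ _))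

Σₗ-map : ∀ (f : Y → ℕ) (g : X → Y) xs → Σₗ f (map g xs) ≡ Σₗ (f ∘ g) xs
Σₗ-map f g []       = refl
Σₗ-map f g (x ∷ xs) = cong (f (g x) +_) (Σₗ-map f g xs)

Σₗ-concatMap : ∀ (f : Y → ℕ) (g : X → List Y) xs → Σₗ f (concatMap g xs) ≡ Σₗ (Σₗ f ∘ g) xs
Σₗ-concatMap f g []       = refl
Σₗ-concatMap f g (x ∷ xs) = trans (Σₗ-++ f (g x) (concatMap g xs)) (cong (Σₗ f (g x) +_) (Σₗ-concatMap f g xs))

Σₗ-swap : ∀ (f : X → Y → ℕ) xs ys → Σₗ (λ x → Σₗ (f x) ys) xs ≡ Σₗ (λ y → Σₗ (λ x → f x y) xs) ys
Σₗ-swap f []       ys = sym (trans (Σₗ-const 0 ys) (*-zeroʳ (length ys)))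
Σₗ-swap f (x ∷ xs) ys = trans (cong (Σₗ (f x) ys +_) (Σₗ-swap f xs ys)) (sym (Σₗ-+ (f x) _ ys))

argmax : (g : X → ℕ) (y : X) (ys : List X) → ∃ λ b → All (λ x → g x ≤ g b) (y ∷ ys)
argmax g y []       = y , ≤-refl ∷ []
argmax g y (z ∷ zs) with argmax g z zs
... | b , best with ≤-total (g y) (g b)
...   | inj₁ y≤b = b , y≤b ∷ best
...   | inj₂ b≤y = y , ≤-refl ∷ All.map (λ le → ≤-trans le b≤y) best

-- Weighted pigeonhole: the left side is at most the sum over the keys of ω times the g-mass of the
-- fibre, hence at most the total of ω times the largest g-mass. Unlikely keys get small ω and
-- hardly enlarge that total.
heaviest-fibre : (κ : X → ℤ) (ω : ℤ → ℕ) (keys : List ℤ) (k₀ : ℤ) → (∀ x → κ x ∈ k₀ ∷ keys) →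
  (g : X → ℕ) (xs : List X) →
  ∃ λ b → Σₗ (λ x → ω (κ x) * g x) xs ≤ Σₗ ω (k₀ ∷ keys) * Σₗ g (filter (λ x → κ x ℤ.≟ b) xs)
heaviest-fibre κ ω keys k₀ κ∈ g xs = b , (begin
  Σₗ (λ x → ω (κ x) * g x) xs                 ≤⟨ split xs ⟩
  Σₗ (λ c → ω c * fibre c xs) (k₀ ∷ keys)     ≤⟨ Σₗ-mono (All.map (λ {c} le → *-monoʳ-≤ (ω c) le) best) ⟩
  Σₗ (λ c → ω c * fibre b xs) (k₀ ∷ keys)     ≡⟨ Σₗ-cong (λ c → *-comm (ω c) (fibre b xs)) (k₀ ∷ keys) ⟩
  Σₗ (λ c → fibre b xs * ω c) (k₀ ∷ keys)     ≡⟨ Σₗ-*ˡ (fibre b xs) ω (k₀ ∷ keys) ⟩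
  fibre b xs * Σₗ ω (k₀ ∷ keys)               ≡⟨ *-comm (fibre b xs) _ ⟩
  Σₗ ω (k₀ ∷ keys) * fibre b xs               ∎)
  where
  open ≤-Reasoning
  fibre : ℤ → List _ → ℕ
  fibre c ys = Σₗ g (filter (λ x → κ x ℤ.≟ c) ys)
  b = proj₁ (argmax (λ c → fibre c xs) k₀ keys)
  best = proj₂ (argmax (λ c → fibre c xs) k₀ keys)
  fibre-∷ : ∀ x ys → g x + fibre (κ x) ys ≤ fibre (κ x) (x ∷ ys)
  fibre-∷ x ys with κ x ℤ.≟ κ x
  ... | yes _ = ≤-refl
  ... | no ¬p = contradiction refl ¬p
  fibre-mono : ∀ c x ys → fibre c ys ≤ fibre c (x ∷ ys)
  fibre-mono c x ys with κ x ℤ.≟ c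
  ... | yes _ = m≤n+m _ (g x)
  ... | no  _ = ≤-refl
  gain : ∀ x ys {cs} → κ x ∈ cs →
    ω (κ x) * g x + Σₗ (λ c → ω c * fibre c ys) cs ≤ Σₗ (λ c → ω c * fibre c (x ∷ ys)) cs
  gain x ys {c ∷ cs} (here refl) = begin
    ω (κ x) * g x + (ω (κ x) * fibre (κ x) ys + rest ys)   ≡⟨ lem (ω (κ x)) (g x) (fibre (κ x) ys) (rest ys) ⟩
    ω (κ x) * (g x + fibre (κ x) ys) + rest ys             ≤⟨ +-mono-≤ (*-monoʳ-≤ (ω (κ x)) (fibre-∷ x ys))
                                                                (Σₗ-mono′ (λ c → *-monoʳ-≤ (ω c) (fibre-mono c x ys)) cs) ⟩
    ω (κ x) * fibre (κ x) (x ∷ ys) + rest (x ∷ ys)         ∎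
    where
    rest : List _ → ℕ
    rest zs = Σₗ (λ c → ω c * fibre c zs) cs
    lem : ∀ w g f r → w * g + (w * f + r) ≡ w * (g + f) + r
    lem = ℕ-Ring.solve-∀
  gain x ys {c ∷ cs} (there x∈) = begin
    ω (κ x) * g x + (ω c * fibre c ys + rest ys)   ≡⟨ lem (ω (κ x) * g x) (ω c * fibre c ys) (rest ys) ⟩
    ω c * fibre c ys + (ω (κ x) * g x + rest ys)   ≤⟨ +-mono-≤ (*-monoʳ-≤ (ω c) (fibre-mono c x ys)) (gain x ys x∈) ⟩
    ω c * fibre c (x ∷ ys) + rest (x ∷ ys)         ∎
    where
    rest : List _ → ℕ
    rest zs = Σₗ (λ c → ω c * fibre c zs) cs
    lem : ∀ a b c → a + (b + c) ≡ b + (a + c)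
    lem = ℕ-Ring.solve-∀
  split : ∀ ys → Σₗ (λ x → ω (κ x) * g x) ys ≤ Σₗ (λ c → ω c * fibre c ys) (k₀ ∷ keys)
  split []       = z≤n
  split (y ∷ ys) = ≤-trans (+-monoʳ-≤ (ω (κ y) * g y) (split ys)) (gain y ys (κ∈ y))

keys : ℕ → List ℤ
keys zero    = []
keys (suc S) = pos (suc S) ∷ -[1+ S ] ∷ keys S

∈-keys : ∀ S z → ∣ z ∣ ≤ S → z ∈ pos 0 ∷ keys S
∈-keys zero    (pos zero) z≤n = here refl
∈-keys (suc S) z le with ∣ z ∣ ≤? S
... | yes le′ = skip (∈-keys S z le′)
  where
  skip : ∀ {z a b : ℤ} {cs} → z ∈ pos 0 ∷ cs → z ∈ pos 0 ∷ a ∷ b ∷ cs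
  skip (here eq)   = here eq
  skip (there z∈)  = there (there (there z∈))
... | no ≰S = top z (≤-antisym le (≰⇒> ≰S))
  where
  top : ∀ z → ∣ z ∣ ≡ suc S → z ∈ pos 0 ∷ keys (suc S)
  top (pos n)  refl = there (here refl)
  top -[1+ n ] refl = there (there (here refl))

-- This is 2^(-κ∣b∣), scaled by 2^(κS) to remain a natural number.
keyWeight : ℕ → ℕ → ℤ → ℕ
keyWeight S κ b = 2 ^ (κ * (S ∸ ∣ b ∣))

keyMass : ℕ → ℕ → ℕ
keyMass S κ = Σₗ (keyWeight S κ) (pos 0 ∷ keys S)

keys-bounded : ∀ S → All (λ b → ∣ b ∣ ≤ S) (pos 0 ∷ keys S)
keys-bounded zero    = z≤n ∷ []
keys-bounded (suc S) with keys-bounded S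
... | le ∷ les = z≤n ∷ ≤-refl ∷ ≤-refl ∷ All.map m≤n⇒m≤1+n les

keyMass-suc : ∀ S κ → keyMass (suc S) κ ≡ 2 + 2 ^ κ * keyMass S κ
keyMass-suc S κ = begin
  w₀ + (w₁ + (w₁ + Σₗ (keyWeight (suc S) κ) (keys S)))
    ≡⟨ cong (λ z → w₀ + (z + (z + Σₗ (keyWeight (suc S) κ) (keys S)))) w₁≡1 ⟩
  w₀ + (1 + (1 + Σₗ (keyWeight (suc S) κ) (keys S)))
    ≡⟨ lem w₀ _ ⟩
  2 + Σₗ (keyWeight (suc S) κ) (pos 0 ∷ keys S)
    ≡⟨ cong (2 +_) (scale (keys-bounded S)) ⟩
  2 + 2 ^ κ * keyMass S κ ∎
  where
  open ≡-Reasoning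
  w₀ = keyWeight (suc S) κ (pos 0)
  w₁ = keyWeight (suc S) κ (pos (suc S))
  w₁≡1 : w₁ ≡ 1
  w₁≡1 = cong (2 ^_) (trans (cong (κ *_) (n∸n≡0 (suc S))) (*-zeroʳ κ))
  lem : ∀ a b → a + (1 + (1 + b)) ≡ 2 + (a + b)
  lem = ℕ-Ring.solve-∀
  scale : ∀ {bs} → All (λ b → ∣ b ∣ ≤ S) bs → Σₗ (keyWeight (suc S) κ) bs ≡ 2 ^ κ * Σₗ (keyWeight S κ) bs
  scale [] = sym (*-zeroʳ (2 ^ κ))
  scale {b ∷ bs} (le ∷ les) = trans (cong₂ _+_
      (trans (cong (2 ^_) (trans (cong (κ *_) (+-∸-assoc 1 le)) (*-suc κ (S ∸ ∣ b ∣)))) (^-distribˡ-+-* 2 κ (κ * (S ∸ ∣ b ∣))))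
      (scale les))
    (sym (*-distribˡ-+ (2 ^ κ) (keyWeight S κ b) _))

-- The mass is a two-sided geometric series of ratio 2^(-κ). The extra 2 on the left strengthens the
-- induction: it absorbs the two new keys counted by `keyMass-suc`.
keyMass-bound′ : ∀ S κ → 2 ≤ 2 ^ κ → keyMass (suc S) κ + 2 ≤ 2 ^ (κ * S) * (2 ^ κ + 4)
keyMass-bound′ zero κ _ = ≤-reflexive (begin
  keyMass 1 κ + 2                    ≡⟨ cong (_+ 2) (keyMass-suc 0 κ) ⟩
  2 + 2 ^ κ * keyMass 0 κ + 2        ≡⟨ cong (λ z → 2 + 2 ^ κ * (2 ^ z + 0) + 2) (*-zeroʳ κ) ⟩
  2 + 2 ^ κ * 1 + 2                  ≡⟨ lem (2 ^ κ) ⟩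
  1 * (2 ^ κ + 4)                    ≡⟨ cong (λ z → 2 ^ z * (2 ^ κ + 4)) (sym (*-zeroʳ κ)) ⟩
  2 ^ (κ * 0) * (2 ^ κ + 4)          ∎)
  where
  open ≡-Reasoning
  lem : ∀ x → 2 + x * 1 + 2 ≡ 1 * (x + 4)
  lem = ℕ-Ring.solve-∀
keyMass-bound′ (suc S) κ 2≤ = begin
  keyMass (2 + S) κ + 2                       ≡⟨ cong (_+ 2) (keyMass-suc (suc S) κ) ⟩
  2 + 2 ^ κ * keyMass (suc S) κ + 2           ≡⟨ lem (2 ^ κ * keyMass (suc S) κ) ⟩
  2 ^ κ * keyMass (suc S) κ + 2 * 2           ≤⟨ +-monoʳ-≤ (2 ^ κ * keyMass (suc S) κ) (*-monoˡ-≤ 2 2≤) ⟩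
  2 ^ κ * keyMass (suc S) κ + 2 ^ κ * 2       ≡⟨ *-distribˡ-+ (2 ^ κ) _ 2 ⟨
  2 ^ κ * (keyMass (suc S) κ + 2)             ≤⟨ *-monoʳ-≤ (2 ^ κ) (keyMass-bound′ S κ 2≤) ⟩
  2 ^ κ * (2 ^ (κ * S) * (2 ^ κ + 4))         ≡⟨ *-assoc (2 ^ κ) (2 ^ (κ * S)) _ ⟨
  2 ^ κ * 2 ^ (κ * S) * (2 ^ κ + 4)           ≡⟨ cong (_* (2 ^ κ + 4)) (trans (sym (^-distribˡ-+-* 2 κ (κ * S))) (cong (2 ^_) (sym (*-suc κ S)))) ⟩
  2 ^ (κ * suc S) * (2 ^ κ + 4)               ∎
  where
  open ≤-Reasoning
  lem : ∀ x → 2 + x + 2 ≡ x + 2 * 2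
  lem = ℕ-Ring.solve-∀

keyMass-bound : ∀ S κ → 1 ≤ κ → keyMass (suc S) κ ≤ 2 ^ (κ * S) * (2 ^ κ + 4)
keyMass-bound S κ 1≤κ = ≤-trans (m≤m+n _ 2) (keyMass-bound′ S κ (^-monoʳ-≤ 2 1≤κ))

-- A test is a statistic of the points together with the price (in bits) of one unit of it.
module Pigeonhole {X C : Set} (key : C → X → ℤ) (price : C → ℕ) (S : ℕ) (key≤S : ∀ c x → ∣ key c x ∣ ≤ S) where

  weight : List C → X → ℕ
  weight []       x = 1
  weight (c ∷ cs) x = keyWeight S (price c) (key c x) * weight cs x

  mass : List C → ℕ
  mass []       = 1
  mass (c ∷ cs) = keyMass S (price c) * mass cs

  cost : List C → X → ℕ
  cost cs x = Σₗ (λ c → price c * ∣ key c x ∣) cs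

  Constant : List X → C → Set
  Constant xs c = ∃ λ b → All (λ x → key c x ≡ b) xs

  record CommonFibre (cs : List C) (xs : List X) : Set₁ where
    field
      fibre    : List X
      ⊆-All    : ∀ {P : X → Set} → All P xs → All P fibre
      ⊆-Σₗ     : ∀ f → Σₗ f fibre ≤ Σₗ f xs
      constant : All (Constant fibre) cs
      large    : Σₗ (weight cs) xs ≤ mass cs * length fibre

  Σₗ-filter : ∀ {P : X → Set} (P? : ∀ x → Dec (P x)) f xs → Σₗ f (filter P? xs) ≤ Σₗ f xs
  Σₗ-filter P? f [] = z≤n
  Σₗ-filter P? f (x ∷ xs) with P? x
  ... | yes _ = +-monoʳ-≤ (f x) (Σₗ-filter P? f xs)
  ... | no  _ = ≤-trans (Σₗ-filter P? f xs) (m≤n+m _ (f x))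

  -- The fibre of the first test is chosen heaviest for the weight of the remaining tests, so the
  -- recursive call starts from a list that has kept its share of that weight.
  commonFibre : ∀ cs xs → CommonFibre cs xs
  commonFibre [] xs = record
    { fibre = xs ; ⊆-All = id ; ⊆-Σₗ = λ f → ≤-refl ; constant = []
    ; large = ≤-reflexive (trans (Σₗ-const 1 xs) (*-comm (length xs) 1)) }
  commonFibre (c ∷ cs) xs = record
    { fibre    = F.fibre
    ; ⊆-All    = λ all → F.⊆-All (Allₚ.filter⁺ sel all)
    ; ⊆-Σₗ     = λ f → ≤-trans (F.⊆-Σₗ f) (Σₗ-filter sel f xs)
    ; constant = (b , F.⊆-All (Allₚ.all-filter sel xs)) ∷ F.constant
    ; large    = ≤-trans (proj₂ best) (≤-trans (*-monoʳ-≤ (keyMass S (price c)) F.large)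
                   (≤-reflexive (sym (*-assoc (keyMass S (price c)) (mass cs) _)))) }
    where
    best = heaviest-fibre (key c) (keyWeight S (price c)) (keys S) (pos 0) (λ x → ∈-keys S _ (key≤S c x)) (weight cs) xs
    b = proj₁ best
    sel = λ x → key c x ℤ.≟ b
    module F = CommonFibre (commonFibre cs (filter sel xs))

  totalPrice : List C → ℕ
  totalPrice = Σₗ price

  weight-cost : ∀ cs x → weight cs x * 2 ^ cost cs x ≡ 2 ^ (S * totalPrice cs)
  weight-cost []       x = cong (2 ^_) (sym (*-zeroʳ S))
  weight-cost (c ∷ cs) x = begin
    w * weight cs x * 2 ^ (price c * k + cost cs x)
      ≡⟨ cong (w * weight cs x *_) (^-distribˡ-+-* 2 (price c * k) (cost cs x)) ⟩
    w * weight cs x * (2 ^ (price c * k) * 2 ^ cost cs x)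
      ≡⟨ lem w (weight cs x) (2 ^ (price c * k)) (2 ^ cost cs x) ⟩
    w * 2 ^ (price c * k) * (weight cs x * 2 ^ cost cs x)
      ≡⟨ cong₂ _*_ one (weight-cost cs x) ⟩
    2 ^ (S * price c) * 2 ^ (S * totalPrice cs)
      ≡⟨ ^-distribˡ-+-* 2 (S * price c) (S * totalPrice cs) ⟨
    2 ^ (S * price c + S * totalPrice cs)
      ≡⟨ cong (2 ^_) (*-distribˡ-+ S (price c) (totalPrice cs)) ⟨
    2 ^ (S * (price c + totalPrice cs)) ∎
    where
    open ≡-Reasoning
    k = ∣ key c x ∣
    w = keyWeight S (price c) (key c x)
    lem : ∀ a b c d → a * b * (c * d) ≡ a * c * (b * d)
    lem = ℕ-Ring.solve-∀
    one : w * 2 ^ (price c * k) ≡ 2 ^ (S * price c)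
    one = trans (sym (^-distribˡ-+-* 2 (price c * (S ∸ k)) (price c * k)))
      (cong (2 ^_) (trans (sym (*-distribˡ-+ (price c) (S ∸ k) k))
        (trans (cong (price c *_) (m∸n+n≡m (key≤S c x))) (*-comm (price c) S))))

  -- Convexity of 2^(-cost), in the form 2^m ≥ 1 + m.
  weight-average : ∀ cs xs h → Σₗ (cost cs) xs ≤ length xs * h →
    length xs * 2 ^ (S * totalPrice cs) ≤ 2 ^ h * Σₗ (weight cs) xs
  weight-average cs xs h avg = +-cancelʳ-≤ (K * (length xs * h)) _ _ (begin
    length xs * K + K * (length xs * h)                  ≡⟨ lem (length xs) K h ⟩
    length xs * (K * (1 + h))                            ≡⟨ Σₗ-const (K * (1 + h)) xs ⟨
    Σₗ (λ _ → K * (1 + h)) xs                            ≤⟨ Σₗ-mono′ pointwise xs ⟩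
    Σₗ (λ x → 2 ^ h * weight cs x + K * cost cs x) xs    ≡⟨ Σₗ-+ _ _ xs ⟩
    Σₗ (λ x → 2 ^ h * weight cs x) xs + Σₗ (λ x → K * cost cs x) xs
      ≡⟨ cong₂ _+_ (Σₗ-*ˡ (2 ^ h) (weight cs) xs) (Σₗ-*ˡ K (cost cs) xs) ⟩
    2 ^ h * Σₗ (weight cs) xs + K * Σₗ (cost cs) xs      ≤⟨ +-monoʳ-≤ _ (*-monoʳ-≤ K avg) ⟩
    2 ^ h * Σₗ (weight cs) xs + K * (length xs * h)      ∎)
    where
    open ≤-Reasoning
    K = 2 ^ (S * totalPrice cs)
    lem : ∀ l K h → l * K + K * (l * h) ≡ l * (K * (1 + h))
    lem = ℕ-Ring.solve-∀
    1+m≤2^m : ∀ m → 1 + m ≤ 2 ^ m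
    1+m≤2^m zero    = ≤-refl
    1+m≤2^m (suc m) = ≤-trans (s≤s (1+m≤2^m m)) (≤-trans (+-monoˡ-≤ (2 ^ m) (m^n>0 2 m)) (≤-reflexive (cong (2 ^ m +_) (sym (+-identityʳ (2 ^ m))))))
    pointwise : ∀ x → K * (1 + h) ≤ 2 ^ h * weight cs x + K * cost cs x
    pointwise x with cost cs x ≤? h
    ... | no c≰h = ≤-trans (*-monoʳ-≤ K (≰⇒> c≰h)) (m≤n+m _ (2 ^ h * weight cs x))
    ... | yes c≤h = begin
      K * (1 + h)                        ≡⟨ cong (λ z → K * (1 + z)) (sym (m∸n+n≡m c≤h)) ⟩
      K * ((1 + (h ∸ c)) + c)            ≡⟨ *-distribˡ-+ K (1 + (h ∸ c)) c ⟩
      K * (1 + (h ∸ c)) + K * c          ≤⟨ +-monoˡ-≤ (K * c) (*-monoʳ-≤ K (1+m≤2^m (h ∸ c))) ⟩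
      K * 2 ^ (h ∸ c) + K * c            ≡⟨ cong (λ z → z * 2 ^ (h ∸ c) + K * c) (sym (weight-cost cs x)) ⟩
      W * 2 ^ c * 2 ^ (h ∸ c) + K * c    ≡⟨ cong (_+ K * c) (lem′ W (2 ^ c) (2 ^ (h ∸ c))) ⟩
      2 ^ (h ∸ c) * 2 ^ c * W + K * c    ≡⟨ cong (λ z → z * W + K * c) (trans (sym (^-distribˡ-+-* 2 (h ∸ c) c)) (cong (2 ^_) (m∸n+n≡m c≤h))) ⟩
      2 ^ h * W + K * c                  ∎
      where
      c = cost cs x
      W = weight cs x
      lem′ : ∀ a b c → a * b * c ≡ c * b * a
      lem′ = ℕ-Ring.solve-∀

-- Bernoulli's inequality (1 - 1/(1+t))^h ≥ 1 - h/(1+t), with denominators cleared.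
bernoulli : ∀ t h → h ≤ t → (1 + t) ^ h * (1 + t ∸ h) ≤ t ^ h * (1 + t)
bernoulli t zero    _   = ≤-refl
bernoulli t (suc h) h<t = begin
  (1 + t) * (1 + t) ^ h * (t ∸ h)          ≡⟨ lem₁ t ((1 + t) ^ h) (t ∸ h) ⟩
  (1 + t) ^ h * ((1 + t) * (t ∸ h))        ≤⟨ *-monoʳ-≤ ((1 + t) ^ h) step ⟩
  (1 + t) ^ h * (t * (1 + (t ∸ h)))        ≡⟨ cong (λ z → (1 + t) ^ h * (t * z)) (sym (+-∸-assoc 1 h≤t)) ⟩
  (1 + t) ^ h * (t * (1 + t ∸ h))          ≡⟨ lem₂ ((1 + t) ^ h) t (1 + t ∸ h) ⟩
  t * ((1 + t) ^ h * (1 + t ∸ h))          ≤⟨ *-monoʳ-≤ t (bernoulli t h h≤t) ⟩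
  t * (t ^ h * (1 + t))                    ≡⟨ *-assoc t (t ^ h) (1 + t) ⟨
  t * t ^ h * (1 + t)                      ∎
  where
  open ≤-Reasoning
  h≤t = <⇒≤ h<t
  lem₁ : ∀ t x y → (1 + t) * x * y ≡ x * ((1 + t) * y)
  lem₁ = ℕ-Ring.solve-∀
  lem₂ : ∀ x t y → x * (t * y) ≡ t * (x * y)
  lem₂ = ℕ-Ring.solve-∀
  lem₃ : ∀ t x → t * (1 + x) ≡ t + t * x
  lem₃ = ℕ-Ring.solve-∀
  step : (1 + t) * (t ∸ h) ≤ t * (1 + (t ∸ h))
  step = ≤-trans (+-monoˡ-≤ (t * (t ∸ h)) (m∸n≤m t h)) (≤-reflexive (sym (lem₃ t (t ∸ h))))

-- For t = 2r, Bernoulli with exponent r gives (1 + 1/t)^r ≤ 2; squaring gives the bound 4.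
[1+t]^t≤4t^t : ∀ r → (1 + 2 * r) ^ (2 * r) ≤ 4 * (2 * r) ^ (2 * r)
[1+t]^t≤4t^t r = begin
  (1 + t) ^ (2 * r)              ≡⟨ cong ((1 + t) ^_) 2r≡ ⟩
  (1 + t) ^ (r + r)              ≡⟨ ^-distribˡ-+-* (1 + t) r r ⟩
  (1 + t) ^ r * (1 + t) ^ r      ≤⟨ *-mono-≤ half half ⟩
  2 * t ^ r * (2 * t ^ r)        ≡⟨ lem (t ^ r) ⟩
  4 * (t ^ r * t ^ r)            ≡⟨ cong (4 *_) (^-distribˡ-+-* t r r) ⟨
  4 * t ^ (r + r)                ≡⟨ cong (λ z → 4 * t ^ z) (sym 2r≡) ⟩
  4 * t ^ (2 * r)                ∎
  where
  open ≤-Reasoning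
  t = 2 * r
  2r≡ : 2 * r ≡ r + r
  2r≡ = cong (r +_) (+-identityʳ r)
  lem : ∀ x → 2 * x * (2 * x) ≡ 4 * (x * x)
  lem = ℕ-Ring.solve-∀
  1+t∸r≡ : 1 + t ∸ r ≡ 1 + r
  1+t∸r≡ = trans (cong (λ z → 1 + z ∸ r) 2r≡) (m+n∸n≡m (1 + r) r)
  lem₂ : ∀ x r → x * 1 + x * r + (x + x * r) ≡ x * (1 + r) * 2
  lem₂ = ℕ-Ring.solve-∀
  lem₃ : ∀ y r → y * (2 + 2 * r) ≡ 2 * y * (1 + r)
  lem₃ = ℕ-Ring.solve-∀
  half : (1 + t) ^ r ≤ 2 * t ^ r
  half = *-cancelʳ-≤ _ _ (1 + r) (begin
    (1 + t) ^ r * (1 + r)        ≡⟨ cong ((1 + t) ^ r *_) (sym 1+t∸r≡) ⟩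
    (1 + t) ^ r * (1 + t ∸ r)    ≤⟨ bernoulli t r (m≤n*m r 2) ⟩
    t ^ r * (1 + t)              ≤⟨ *-monoʳ-≤ (t ^ r) (n≤1+n (1 + t)) ⟩
    t ^ r * (2 + 2 * r)          ≡⟨ lem₃ (t ^ r) r ⟩
    2 * t ^ r * (1 + r)          ∎)

^-cancelˡ-≤ : ∀ T .{{_ : NonZero T}} {a b} → a ^ T ≤ b ^ T → a ≤ b
^-cancelˡ-≤ T {a} {b} le with a ≤? b
... | yes a≤b = a≤b
... | no  a≰b = contradiction (^-monoˡ-< T (≰⇒> a≰b)) (≤⇒≯ le)

[a*b]^n : ∀ a b n → (a * b) ^ n ≡ a ^ n * b ^ n
[a*b]^n a b zero    = refl
[a*b]^n a b (suc n) = trans (cong (a * b *_) ([a*b]^n a b n)) (lem a b (a ^ n) (b ^ n))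
  where
  lem : ∀ a b x y → a * b * (x * y) ≡ a * x * (b * y)
  lem = ℕ-Ring.solve-∀

-- T-th powers avoid rounding: the excess factor of keyMass over 2^(suc S * κ) is 4^(τ/T), with τ/T = 4/2^κ.
keyMass-^ : ∀ S κ′ τ → let T = 2 * 2 ^ κ′ * τ ; κ = 3 + κ′ in
  keyMass (suc S) κ ^ T ≤ 2 ^ (T * (suc S * κ) + 2 * τ)
keyMass-^ S κ′ τ = begin
  keyMass (suc S) κ ^ T                             ≤⟨ ^-monoˡ-≤ T (keyMass-bound S κ (s≤s z≤n)) ⟩
  (2 ^ (κ * S) * (2 ^ κ + 4)) ^ T                   ≡⟨ [a*b]^n (2 ^ (κ * S)) (2 ^ κ + 4) T ⟩
  (2 ^ (κ * S)) ^ T * (2 ^ κ + 4) ^ T               ≤⟨ *-monoʳ-≤ ((2 ^ (κ * S)) ^ T) top ⟩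
  (2 ^ (κ * S)) ^ T * ((2 ^ κ) ^ T * 2 ^ (2 * τ))   ≡⟨ cong₂ (λ a b → a * (b * 2 ^ (2 * τ))) (^-*-assoc 2 (κ * S) T) (^-*-assoc 2 κ T) ⟩
  2 ^ (κ * S * T) * (2 ^ (κ * T) * 2 ^ (2 * τ))     ≡⟨ cong (2 ^ (κ * S * T) *_) (sym (^-distribˡ-+-* 2 (κ * T) (2 * τ))) ⟩
  2 ^ (κ * S * T) * 2 ^ (κ * T + 2 * τ)             ≡⟨ ^-distribˡ-+-* 2 (κ * S * T) (κ * T + 2 * τ) ⟨
  2 ^ (κ * S * T + (κ * T + 2 * τ))                 ≡⟨ cong (2 ^_) (lem κ S T (2 * τ)) ⟩
  2 ^ (T * (suc S * κ) + 2 * τ)                     ∎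
  where
  open ≤-Reasoning
  r = 2 ^ κ′
  t = 2 * r
  T = t * τ
  κ = 3 + κ′
  lem : ∀ k s T y → k * s * T + (k * T + y) ≡ T * ((1 + s) * k) + y
  lem = ℕ-Ring.solve-∀
  2^κ≡4t : 2 ^ κ ≡ 4 * t
  2^κ≡4t = lem′ r
    where
    lem′ : ∀ r → 2 * (2 * (2 * r)) ≡ 4 * (2 * r)
    lem′ = ℕ-Ring.solve-∀
  4t+4≡ : 4 * t + 4 ≡ 4 * (1 + t)
  4t+4≡ = lem′ t
    where
    lem′ : ∀ t → 4 * t + 4 ≡ 4 * (1 + t)
    lem′ = ℕ-Ring.solve-∀
  top : (2 ^ κ + 4) ^ T ≤ (2 ^ κ) ^ T * 2 ^ (2 * τ)
  top = begin
    (2 ^ κ + 4) ^ T                    ≡⟨ cong (_^ T) (trans (cong (_+ 4) 2^κ≡4t) 4t+4≡) ⟩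
    (4 * (1 + t)) ^ T                  ≡⟨ [a*b]^n 4 (1 + t) T ⟩
    4 ^ T * (1 + t) ^ T                ≡⟨ cong (4 ^ T *_) (sym (^-*-assoc (1 + t) t τ)) ⟩
    4 ^ T * ((1 + t) ^ t) ^ τ          ≤⟨ *-monoʳ-≤ (4 ^ T) (^-monoˡ-≤ τ ([1+t]^t≤4t^t r)) ⟩
    4 ^ T * (4 * t ^ t) ^ τ            ≡⟨ cong (4 ^ T *_) ([a*b]^n 4 (t ^ t) τ) ⟩
    4 ^ T * (4 ^ τ * (t ^ t) ^ τ)      ≡⟨ cong₂ (λ a b → 4 ^ T * (a * b)) (^-*-assoc 2 2 τ) (^-*-assoc t t τ) ⟩
    4 ^ T * (2 ^ (2 * τ) * t ^ T)      ≡⟨ lem′ (4 ^ T) (2 ^ (2 * τ)) (t ^ T) ⟩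
    4 ^ T * t ^ T * 2 ^ (2 * τ)        ≡⟨ cong (_* 2 ^ (2 * τ)) (sym ([a*b]^n 4 t T)) ⟩
    (4 * t) ^ T * 2 ^ (2 * τ)          ≡⟨ cong (λ z → z ^ T * 2 ^ (2 * τ)) (sym 2^κ≡4t) ⟩
    (2 ^ κ) ^ T * 2 ^ (2 * τ)          ∎
    where
    lem′ : ∀ a b c → a * (b * c) ≡ a * c * b
    lem′ = ℕ-Ring.solve-∀

module _ {A C : Set} (key : C → A → ℤ) (excess : C → ℕ) (S : ℕ) (key≤S : ∀ c x → ∣ key c x ∣ ≤ suc S)
  (T : ℕ) {{T≢0 : NonZero T}} (τ : C → ℕ) (τ-def : ∀ c → 2 * 2 ^ excess c * τ c ≡ T) where

  open Pigeonhole key (λ c → 3 + excess c) (suc S) key≤S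

  mass-^ : ∀ cs → mass cs ^ T ≤ 2 ^ (T * (suc S * totalPrice cs) + 2 * Σₗ τ cs)
  mass-^ []       = ≤-reflexive (trans (^-zeroˡ T) (cong (2 ^_) (sym (trans (+-identityʳ (T * (suc S * 0)))
    (trans (cong (T *_) (*-zeroʳ (suc S))) (*-zeroʳ T))))))
  mass-^ (c ∷ cs) = begin
    (keyMass (suc S) κ * mass cs) ^ T          ≡⟨ [a*b]^n _ _ T ⟩
    keyMass (suc S) κ ^ T * mass cs ^ T        ≤⟨ *-mono-≤ one (mass-^ cs) ⟩
    2 ^ (T * (suc S * κ) + 2 * τ c) * 2 ^ (T * (suc S * totalPrice cs) + 2 * Σₗ τ cs)
                                               ≡⟨ ^-distribˡ-+-* 2 (T * (suc S * κ) + 2 * τ c) _ ⟨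
    2 ^ (T * (suc S * κ) + 2 * τ c + (T * (suc S * totalPrice cs) + 2 * Σₗ τ cs))
                                               ≡⟨ cong (2 ^_) (lem T (suc S) κ (τ c) (totalPrice cs) (Σₗ τ cs)) ⟩
    2 ^ (T * (suc S * (κ + totalPrice cs)) + 2 * (τ c + Σₗ τ cs)) ∎
    where
    open ≤-Reasoning
    κ = 3 + excess c
    one : keyMass (suc S) κ ^ T ≤ 2 ^ (T * (suc S * κ) + 2 * τ c)
    one = subst (λ z → keyMass (suc S) κ ^ z ≤ 2 ^ (z * (suc S * κ) + 2 * τ c)) (τ-def c) (keyMass-^ S (excess c) (τ c))
    lem : ∀ T s a x b y → T * (s * a) + 2 * x + (T * (s * b) + 2 * y) ≡ T * (s * (a + b)) + 2 * (x + y)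
    lem = ℕ-Ring.solve-∀

  mass-bound : ∀ cs h → 2 * Σₗ τ cs ≤ T * h → mass cs ≤ 2 ^ (suc S * totalPrice cs + h)
  mass-bound cs h le = ^-cancelˡ-≤ T (begin
    mass cs ^ T                                             ≤⟨ mass-^ cs ⟩
    2 ^ (T * (suc S * totalPrice cs) + 2 * Σₗ τ cs)         ≤⟨ ^-monoʳ-≤ 2 (+-monoʳ-≤ (T * (suc S * totalPrice cs)) le) ⟩
    2 ^ (T * (suc S * totalPrice cs) + T * h)               ≡⟨ cong (2 ^_) (trans (sym (*-distribˡ-+ T _ h)) (*-comm T _)) ⟩
    2 ^ ((suc S * totalPrice cs + h) * T)                   ≡⟨ ^-*-assoc 2 (suc S * totalPrice cs + h) T ⟨
    (2 ^ (suc S * totalPrice cs + h)) ^ T                   ∎)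
    where open ≤-Reasoning

  -- Each factor 2^h is one loss: the first comes from the average cost of the tests through
  -- `weight-average`, the second from the overhead in `mass-bound`. The common scale K cancels.
  largeFibre : ∀ cs xs h → 2 * Σₗ τ cs ≤ T * h → Σₗ (cost cs) xs ≤ length xs * h →
    length xs ≤ 2 ^ (h + h) * length (CommonFibre.fibre (commonFibre cs xs))
  largeFibre cs xs h le avg = *-cancelʳ-≤ _ _ K {{m^n≢0 2 (suc S * totalPrice cs)}} (begin
    length xs * K                          ≤⟨ weight-average cs xs h avg ⟩
    2 ^ h * Σₗ (weight cs) xs              ≤⟨ *-monoʳ-≤ (2 ^ h) F.large ⟩
    2 ^ h * (mass cs * length F.fibre)     ≤⟨ *-monoʳ-≤ (2 ^ h) (*-monoˡ-≤ (length F.fibre) (mass-bound cs h le)) ⟩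
    2 ^ h * (2 ^ (suc S * totalPrice cs + h) * length F.fibre)
      ≡⟨ cong (λ z → 2 ^ h * (z * length F.fibre)) (^-distribˡ-+-* 2 (suc S * totalPrice cs) h) ⟩
    2 ^ h * (K * 2 ^ h * length F.fibre)   ≡⟨ lem (2 ^ h) K (length F.fibre) ⟩
    2 ^ h * 2 ^ h * length F.fibre * K     ≡⟨ cong (λ z → z * length F.fibre * K) (sym (^-distribˡ-+-* 2 h h)) ⟩
    2 ^ (h + h) * length F.fibre * K       ∎)
    where
    open ≤-Reasoning
    K = 2 ^ (suc S * totalPrice cs)
    module F = CommonFibre (commonFibre cs xs)
    lem : ∀ a K l → a * (K * a * l) ≡ a * a * l * K
    lem = ℕ-Ring.solve-∀

-- Partial colourings and their moments

private variable
  n : ℕ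

size : Vec Bool n → ℕ
size []          = 0
size (true ∷ A)  = suc (size A)
size (false ∷ A) = size A

-- The vector marks the live positions. Dead ones are frozen at `false`, so every sign pattern on
-- the live positions occurs exactly once.
colourings : Vec Bool n → List (Vec Bool n)
colourings []          = [] ∷ []
colourings (true ∷ A)  = map (true ∷_) (colourings A) ++ map (false ∷_) (colourings A)
colourings (false ∷ A) = map (false ∷_) (colourings A)

Σₗ-colourings-true : ∀ (A : Vec Bool n) (f : Vec Bool (suc n) → ℕ) →
  Σₗ f (colourings (true ∷ A)) ≡ Σₗ (λ x → f (true ∷ x) + f (false ∷ x)) (colourings A)
Σₗ-colourings-true A f = trans (Σₗ-++ f (map (true ∷_) (colourings A)) _)
  (trans (cong₂ _+_ (Σₗ-map f (true ∷_) (colourings A)) (Σₗ-map f (false ∷_) (colourings A))) (sym (Σₗ-+ _ _ (colourings A))))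

Σₗ-colourings-1 : ∀ (A : Vec Bool n) → Σₗ (λ _ → 1) (colourings A) ≡ 2 ^ size A
Σₗ-colourings-1 []          = refl
Σₗ-colourings-1 (true ∷ A)  = trans (Σₗ-colourings-true A _) (trans (Σₗ-*ˡ 2 (λ _ → 1) (colourings A)) (cong (2 *_) (Σₗ-colourings-1 A)))
Σₗ-colourings-1 (false ∷ A) = trans (Σₗ-map _ (false ∷_) (colourings A)) (Σₗ-colourings-1 A)

length-colourings : ∀ (A : Vec Bool n) → length (colourings A) ≡ 2 ^ size A
length-colourings A = trans (sym (trans (Σₗ-const 1 (colourings A)) (*-identityʳ _))) (Σₗ-colourings-1 A)

signed : Bool → Bool → ℤ
signed true  b = sign b
signed false b = pos 0

dot : Vec Bool n → Vec Bool n → (Fin n → ℤ) → ℤ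
dot []      []      c = pos 0
dot (a ∷ A) (b ∷ x) c = signed a b *ℤ c Fin.zero +ℤ dot A x (c ∘ Fin.suc)

sumF : (Fin n → ℕ) → ℕ
sumF {zero}  f = 0
sumF {suc n} f = f Fin.zero + sumF (f ∘ Fin.suc)

sumF-mono : {f g : Fin n → ℕ} → (∀ i → f i ≤ g i) → sumF f ≤ sumF g
sumF-mono {zero}  le = z≤n
sumF-mono {suc n} le = +-mono-≤ (le Fin.zero) (sumF-mono (le ∘ Fin.suc))

sumF-+ : (f g : Fin n → ℕ) → sumF (λ i → f i + g i) ≡ sumF f + sumF g
sumF-+ {zero}  f g = refl
sumF-+ {suc n} f g = trans (cong (f Fin.zero + g Fin.zero +_) (sumF-+ (f ∘ Fin.suc) (g ∘ Fin.suc))) (+-interchange (f Fin.zero) _ _ _)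

sumF-*ˡ : ∀ c (f : Fin n → ℕ) → sumF (λ i → c * f i) ≡ c * sumF f
sumF-*ˡ {zero}  c f = sym (*-zeroʳ c)
sumF-*ˡ {suc n} c f = trans (cong (c * f Fin.zero +_) (sumF-*ˡ c (f ∘ Fin.suc))) (sym (*-distribˡ-+ c _ _))

sq : ℤ → ℕ
sq z = ∣ z ∣ * ∣ z ∣

pos-sq : ∀ z → pos (sq z) ≡ z *ℤ z
pos-sq (pos n)  = ℤₚ.pos-* n n
pos-sq -[1+ n ] = refl

norm² : (Fin n → ℤ) → ℕ
norm² c = sumF (sq ∘ c)

sq-pair : ∀ v s → sq (pos 1 *ℤ v +ℤ s) + sq (-[1+ 0 ] *ℤ v +ℤ s) ≡ 2 * sq s + 2 * sq v
sq-pair v s = ℤₚ.+-injective (trans (cong₂ _+ℤ_ (pos-sq (pos 1 *ℤ v +ℤ s)) (pos-sq (-[1+ 0 ] *ℤ v +ℤ s))) (trans (lem v s)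
  (sym (cong₂ _+ℤ_ (trans (ℤₚ.pos-* 2 (sq s)) (cong (pos 2 *ℤ_) (pos-sq s)))
                   (trans (ℤₚ.pos-* 2 (sq v)) (cong (pos 2 *ℤ_) (pos-sq v)))))))
  where
  lem : ∀ v s → (pos 1 *ℤ v +ℤ s) *ℤ (pos 1 *ℤ v +ℤ s) +ℤ (-[1+ 0 ] *ℤ v +ℤ s) *ℤ (-[1+ 0 ] *ℤ v +ℤ s)
              ≡ pos 2 *ℤ (s *ℤ s) +ℤ pos 2 *ℤ (v *ℤ v)
  lem = ℤ-Ring.solve-∀

sq²-pair : ∀ v s → sq (pos 1 *ℤ v +ℤ s) * sq (pos 1 *ℤ v +ℤ s) + sq (-[1+ 0 ] *ℤ v +ℤ s) * sq (-[1+ 0 ] *ℤ v +ℤ s)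
                 ≡ 2 * (sq s * sq s) + (12 * sq v * sq s + 2 * (sq v * sq v))
sq²-pair v s = ℤₚ.+-injective (trans (cong₂ _+ℤ_ (pos² (pos 1 *ℤ v +ℤ s)) (pos² (-[1+ 0 ] *ℤ v +ℤ s))) (trans (lem v s)
  (sym (cong₂ _+ℤ_ (trans (ℤₚ.pos-* 2 (sq s * sq s)) (cong (pos 2 *ℤ_) (pos² s)))
     (cong₂ _+ℤ_ (trans (ℤₚ.pos-* (12 * sq v) (sq s)) (cong₂ _*ℤ_ (trans (ℤₚ.pos-* 12 (sq v)) (cong (pos 12 *ℤ_) (pos-sq v))) (pos-sq s)))
       (trans (ℤₚ.pos-* 2 (sq v * sq v)) (cong (pos 2 *ℤ_) (pos² v))))))))
  where
  pos² : ∀ z → pos (sq z * sq z) ≡ z *ℤ z *ℤ (z *ℤ z)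
  pos² z = trans (ℤₚ.pos-* (sq z) (sq z)) (cong₂ _*ℤ_ (pos-sq z) (pos-sq z))
  lem : ∀ v s → let a = pos 1 *ℤ v +ℤ s ; b = -[1+ 0 ] *ℤ v +ℤ s in
        a *ℤ a *ℤ (a *ℤ a) +ℤ b *ℤ b *ℤ (b *ℤ b)
      ≡ pos 2 *ℤ (s *ℤ s *ℤ (s *ℤ s)) +ℤ (pos 12 *ℤ (v *ℤ v) *ℤ (s *ℤ s) +ℤ pos 2 *ℤ (v *ℤ v *ℤ (v *ℤ v)))
  lem = ℤ-Ring.solve-∀

dot-false : ∀ (A x : Vec Bool n) b c → dot (false ∷ A) (b ∷ x) c ≡ dot A x (c ∘ Fin.suc)
dot-false A x b c = trans (cong (_+ℤ dot A x (c ∘ Fin.suc)) (ℤₚ.*-zeroˡ (c Fin.zero))) (ℤₚ.+-identityˡ _)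

second-moment : ∀ (A : Vec Bool n) c → Σₗ (λ x → sq (dot A x c)) (colourings A) ≤ 2 ^ size A * norm² c
second-moment [] c = z≤n
second-moment (false ∷ A) c = begin
  Σₗ (λ x → sq (dot (false ∷ A) x c)) (map (false ∷_) (colourings A))  ≡⟨ Σₗ-map _ (false ∷_) (colourings A) ⟩
  Σₗ (λ x → sq (dot (false ∷ A) (false ∷ x) c)) (colourings A)         ≡⟨ Σₗ-cong (λ x → cong sq (dot-false A x false c)) (colourings A) ⟩
  Σₗ (λ x → sq (dot A x (c ∘ Fin.suc))) (colourings A)                 ≤⟨ second-moment A (c ∘ Fin.suc) ⟩
  2 ^ size A * norm² (c ∘ Fin.suc)                               ≤⟨ *-monoʳ-≤ (2 ^ size A) (m≤n+m _ (sq (c Fin.zero))) ⟩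
  2 ^ size A * norm² c                                           ∎
  where open ≤-Reasoning
second-moment (true ∷ A) c = begin
  Σₗ (λ x → sq (dot (true ∷ A) x c)) (colourings (true ∷ A))
    ≡⟨ Σₗ-colourings-true A _ ⟩
  Σₗ (λ x → sq (pos 1 *ℤ v +ℤ s x) + sq (-[1+ 0 ] *ℤ v +ℤ s x)) (colourings A)
    ≡⟨ Σₗ-cong (λ x → sq-pair v (s x)) (colourings A) ⟩
  Σₗ (λ x → 2 * sq (s x) + 2 * sq v) (colourings A)
    ≡⟨ trans (Σₗ-+ _ _ (colourings A)) (cong₂ _+_ (Σₗ-*ˡ 2 _ (colourings A)) (trans (Σₗ-const _ (colourings A)) (cong (_* (2 * sq v)) (length-colourings A)))) ⟩
  2 * Σₗ (λ x → sq (s x)) (colourings A) + N * (2 * sq v)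
    ≤⟨ +-monoˡ-≤ (N * (2 * sq v)) (*-monoʳ-≤ 2 (second-moment A (c ∘ Fin.suc))) ⟩
  2 * (N * σ) + N * (2 * sq v)
    ≡⟨ lem N σ (sq v) ⟩
  2 * N * (sq v + σ) ∎
  where
  open ≤-Reasoning
  v = c Fin.zero
  s = λ x → dot A x (c ∘ Fin.suc)
  N = 2 ^ size A
  σ = norm² (c ∘ Fin.suc)
  lem : ∀ N σ w → 2 * (N * σ) + N * (2 * w) ≡ 2 * N * (w + σ)
  lem = ℕ-Ring.solve-∀

-- Averaging over the sign of the first coordinate kills the odd powers and leaves s⁴ + 6v²s² + v⁴.
-- The second moment controls the middle term, and with w = v² the target 3(w + σ)² = 3σ² + 6wσ +
-- 3w² dominates the result; 3 is the Gaussian constant.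
fourth-moment : ∀ (A : Vec Bool n) c →
  Σₗ (λ x → sq (dot A x c) * sq (dot A x c)) (colourings A) ≤ 2 ^ size A * (3 * (norm² c * norm² c))
fourth-moment [] c = z≤n
fourth-moment (false ∷ A) c = begin
  Σₗ (λ x → sq (dot (false ∷ A) x c) * sq (dot (false ∷ A) x c)) (map (false ∷_) (colourings A))
    ≡⟨ Σₗ-map _ (false ∷_) (colourings A) ⟩
  Σₗ (λ x → sq (dot (false ∷ A) (false ∷ x) c) * sq (dot (false ∷ A) (false ∷ x) c)) (colourings A)
    ≡⟨ Σₗ-cong (λ x → cong (λ z → sq z * sq z) (dot-false A x false c)) (colourings A) ⟩
  Σₗ (λ x → sq (dot A x (c ∘ Fin.suc)) * sq (dot A x (c ∘ Fin.suc))) (colourings A)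
    ≤⟨ fourth-moment A (c ∘ Fin.suc) ⟩
  2 ^ size A * (3 * (norm² (c ∘ Fin.suc) * norm² (c ∘ Fin.suc)))
    ≤⟨ *-monoʳ-≤ (2 ^ size A) (*-monoʳ-≤ 3 (*-mono-≤ (m≤n+m _ (sq (c Fin.zero))) (m≤n+m _ (sq (c Fin.zero))))) ⟩
  2 ^ size A * (3 * (norm² c * norm² c)) ∎
  where open ≤-Reasoning
fourth-moment (true ∷ A) c = begin
  Σₗ (λ x → sq (dot (true ∷ A) x c) * sq (dot (true ∷ A) x c)) (colourings (true ∷ A))
    ≡⟨ Σₗ-colourings-true A _ ⟩
  Σₗ (λ x → sq (pos 1 *ℤ v +ℤ s x) * sq (pos 1 *ℤ v +ℤ s x) + sq (-[1+ 0 ] *ℤ v +ℤ s x) * sq (-[1+ 0 ] *ℤ v +ℤ s x)) (colourings A)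
    ≡⟨ Σₗ-cong (λ x → sq²-pair v (s x)) (colourings A) ⟩
  Σₗ (λ x → 2 * (sq (s x) * sq (s x)) + (12 * w * sq (s x) + 2 * (w * w))) (colourings A)
    ≡⟨ trans (Σₗ-+ _ _ (colourings A)) (cong₂ _+_ (Σₗ-*ˡ 2 _ (colourings A)) (trans (Σₗ-+ _ _ (colourings A))
         (cong₂ _+_ (Σₗ-*ˡ (12 * w) _ (colourings A)) (trans (Σₗ-const _ (colourings A)) (cong (_* (2 * (w * w))) (length-colourings A)))))) ⟩
  2 * Σₗ (λ x → sq (s x) * sq (s x)) (colourings A) + (12 * w * Σₗ (λ x → sq (s x)) (colourings A) + N * (2 * (w * w)))
    ≤⟨ +-mono-≤ (*-monoʳ-≤ 2 (fourth-moment A (c ∘ Fin.suc)))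
         (+-mono-≤ (*-monoʳ-≤ (12 * w) (second-moment A (c ∘ Fin.suc))) (*-monoʳ-≤ N (*-monoˡ-≤ (w * w) (m≤m+n 2 4)))) ⟩
  2 * (N * (3 * (σ * σ))) + (12 * w * (N * σ) + N * (6 * (w * w)))
    ≡⟨ lem N σ w ⟩
  2 * N * (3 * ((w + σ) * (w + σ))) ∎
  where
  open ≤-Reasoning
  v = c Fin.zero
  w = sq v
  s = λ x → dot A x (c ∘ Fin.suc)
  N = 2 ^ size A
  σ = norm² (c ∘ Fin.suc)
  lem : ∀ N σ w → 2 * (N * (3 * (σ * σ))) + (12 * w * (N * σ) + N * (6 * (w * w))) ≡ 2 * N * (3 * ((w + σ) * (w + σ)))
  lem = ℕ-Ring.solve-∀

-- A sign times a variable. The two points of a pair in the digit-reversed order will be literals of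
-- one variable with opposite signs, which is why a variable may occur twice in a list.
Lit : ℕ → Set
Lit n = Bool × Fin n

litValue : Vec Bool n → Vec Bool n → Lit n → ℤ
litValue A x (s , i) = sign s *ℤ signed (lookup A i) (lookup x i)

eval : Vec Bool n → Vec Bool n → List (Lit n) → ℤ
eval A x []      = pos 0
eval A x (l ∷ ℓ) = litValue A x l +ℤ eval A x ℓ

eval-++ : ∀ (A x : Vec Bool n) ℓ ℓ′ → eval A x (ℓ ++ ℓ′) ≡ eval A x ℓ +ℤ eval A x ℓ′
eval-++ A x []      ℓ′ = sym (ℤₚ.+-identityˡ _)
eval-++ A x (l ∷ ℓ) ℓ′ = trans (cong (litValue A x l +ℤ_) (eval-++ A x ℓ ℓ′)) (sym (ℤₚ.+-assoc (litValue A x l) _ _))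

δ : Fin n → Fin n → ℕ
δ Fin.zero    Fin.zero    = 1
δ Fin.zero    (Fin.suc j) = 0
δ (Fin.suc i) Fin.zero    = 0
δ (Fin.suc i) (Fin.suc j) = δ i j

coef : List (Lit n) → Fin n → ℤ
coef []            i = pos 0
coef ((s , j) ∷ ℓ) i = sign s *ℤ pos (δ j i) +ℤ coef ℓ i

cnt : List (Lit n) → Fin n → ℕ
cnt []            i = 0
cnt ((s , j) ∷ ℓ) i = δ j i + cnt ℓ i

dot-zero : ∀ (A x : Vec Bool n) → dot A x (λ _ → pos 0) ≡ pos 0
dot-zero []      []      = refl
dot-zero (a ∷ A) (b ∷ x) = trans (cong₂ _+ℤ_ (ℤₚ.*-zeroʳ (signed a b)) (dot-zero A x)) refl

dot-+ : ∀ (A x : Vec Bool n) c d → dot A x (λ i → c i +ℤ d i) ≡ dot A x c +ℤ dot A x d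
dot-+ []      []      c d = refl
dot-+ (a ∷ A) (b ∷ x) c d = trans (cong (signed a b *ℤ (c Fin.zero +ℤ d Fin.zero) +ℤ_) (dot-+ A x (c ∘ Fin.suc) (d ∘ Fin.suc)))
  (lem (signed a b) (c Fin.zero) (d Fin.zero) _ _)
  where
  lem : ∀ s c d x y → s *ℤ (c +ℤ d) +ℤ (x +ℤ y) ≡ (s *ℤ c +ℤ x) +ℤ (s *ℤ d +ℤ y)
  lem = ℤ-Ring.solve-∀

dot-δ : ∀ (A x : Vec Bool n) t j → dot A x (λ i → t *ℤ pos (δ j i)) ≡ t *ℤ signed (lookup A j) (lookup x j)
dot-δ (a ∷ A) (b ∷ x) t Fin.zero = trans (cong (signed a b *ℤ (t *ℤ pos 1) +ℤ_)
    (trans (dot-cong A x (λ i → ℤₚ.*-zeroʳ t)) (dot-zero A x)))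
  (lem (signed a b) t)
  where
  dot-cong : ∀ {n} (A x : Vec Bool n) {c d} → (∀ i → c i ≡ d i) → dot A x c ≡ dot A x d
  dot-cong []      []      eq = refl
  dot-cong (a ∷ A) (b ∷ x) eq = cong₂ _+ℤ_ (cong (signed a b *ℤ_) (eq Fin.zero)) (dot-cong A x (eq ∘ Fin.suc))
  lem : ∀ s t → s *ℤ (t *ℤ pos 1) +ℤ pos 0 ≡ t *ℤ s
  lem = ℤ-Ring.solve-∀
dot-δ (a ∷ A) (b ∷ x) t (Fin.suc j) = trans (cong₂ _+ℤ_
    (trans (cong (signed a b *ℤ_) (ℤₚ.*-zeroʳ t)) (ℤₚ.*-zeroʳ (signed a b))) (dot-δ A x t j))
  (ℤₚ.+-identityˡ _)

eval≡dot : ∀ (A x : Vec Bool n) ℓ → eval A x ℓ ≡ dot A x (coef ℓ)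
eval≡dot A x []            = sym (dot-zero A x)
eval≡dot A x ((s , j) ∷ ℓ) = sym (trans (dot-+ A x _ _) (cong₂ _+ℤ_ (dot-δ A x (sign s) j) (sym (eval≡dot A x ℓ))))

∣sign∣ : ∀ s → ∣ sign s ∣ ≡ 1
∣sign∣ true  = refl
∣sign∣ false = refl

∣coef∣≤cnt : ∀ (ℓ : List (Lit n)) i → ∣ coef ℓ i ∣ ≤ cnt ℓ i
∣coef∣≤cnt []            i = z≤n
∣coef∣≤cnt ((s , j) ∷ ℓ) i = ≤-trans (ℤₚ.∣i+j∣≤∣i∣+∣j∣ (sign s *ℤ pos (δ j i)) (coef ℓ i))
  (+-mono-≤ (≤-reflexive (trans (ℤₚ.abs-* (sign s) (pos (δ j i))) (trans (cong (_* δ j i) (∣sign∣ s)) (*-identityˡ _)))) (∣coef∣≤cnt ℓ i))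

sumF-0 : sumF {n} (λ _ → 0) ≡ 0
sumF-0 {zero}  = refl
sumF-0 {suc n} = sumF-0 {n}

sumF-δ : ∀ (j : Fin n) → sumF (δ j) ≡ 1
sumF-δ {suc n} Fin.zero = cong suc (sumF-0 {n})
sumF-δ (Fin.suc j) = sumF-δ j

sumF-cnt : ∀ (ℓ : List (Lit n)) → sumF (cnt ℓ) ≡ length ℓ
sumF-cnt {n} []        = sumF-0 {n}
sumF-cnt ((s , j) ∷ ℓ) = trans (sumF-+ (δ j) (cnt ℓ)) (cong₂ _+_ (sumF-δ j) (sumF-cnt ℓ))

-- Each coefficient is bounded both by 2 and by its count, and the counts add up to the length.
norm²-coef : ∀ (ℓ : List (Lit n)) → (∀ i → cnt ℓ i ≤ 2) → norm² (coef ℓ) ≤ 2 * length ℓ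
norm²-coef ℓ cnt≤2 = begin
  sumF (λ i → sq (coef ℓ i))   ≤⟨ sumF-mono (λ i → *-mono-≤ (≤-trans (∣coef∣≤cnt ℓ i) (cnt≤2 i)) (∣coef∣≤cnt ℓ i)) ⟩
  sumF (λ i → 2 * cnt ℓ i)     ≡⟨ sumF-*ˡ 2 (cnt ℓ) ⟩
  2 * sumF (cnt ℓ)             ≡⟨ cong (2 *_) (sumF-cnt ℓ) ⟩
  2 * length ℓ                 ∎
  where open ≤-Reasoning

cnt-take : ∀ m (ℓ : List (Lit n)) i → cnt (take m ℓ) i ≤ cnt ℓ i
cnt-take zero    ℓ             i = z≤n
cnt-take (suc m) []            i = z≤n
cnt-take (suc m) ((s , j) ∷ ℓ) i = +-monoʳ-≤ (δ j i) (cnt-take m ℓ i)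

cnt-drop : ∀ m (ℓ : List (Lit n)) i → cnt (drop m ℓ) i ≤ cnt ℓ i
cnt-drop zero    ℓ             i = ≤-refl
cnt-drop (suc m) []            i = z≤n
cnt-drop (suc m) ((s , j) ∷ ℓ) i = ≤-trans (cnt-drop m ℓ i) (m≤n+m _ (δ j i))

-- Blocks will be cut from the live literals only, so that their number decreases with the number of
-- live positions.
restrict : Vec Bool n → List (Lit n) → List (Lit n)
restrict A [] = []
restrict A ((s , j) ∷ ℓ) with lookup A j
... | true  = (s , j) ∷ restrict A ℓ
... | false = restrict A ℓ

restrict-++ : ∀ (A : Vec Bool n) ℓ ℓ′ → restrict A (ℓ ++ ℓ′) ≡ restrict A ℓ ++ restrict A ℓ′
restrict-++ A [] ℓ′ = refl
restrict-++ A ((s , j) ∷ ℓ) ℓ′ with lookup A j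
... | true  = cong ((s , j) ∷_) (restrict-++ A ℓ ℓ′)
... | false = restrict-++ A ℓ ℓ′

cnt-restrict : ∀ (A : Vec Bool n) ℓ i → cnt (restrict A ℓ) i ≤ cnt ℓ i
cnt-restrict A [] i = z≤n
cnt-restrict A ((s , j) ∷ ℓ) i with lookup A j
... | true  = +-monoʳ-≤ (δ j i) (cnt-restrict A ℓ i)
... | false = ≤-trans (cnt-restrict A ℓ i) (m≤n+m _ (δ j i))

bit : Bool → ℕ
bit true  = 1
bit false = 0

sumF-bit : ∀ (A : Vec Bool n) → sumF (λ i → bit (lookup A i)) ≡ size A
sumF-bit []          = refl
sumF-bit (true ∷ A)  = cong suc (sumF-bit A)
sumF-bit (false ∷ A) = sumF-bit A

δ-separated : ∀ (A : Vec Bool n) i j → lookup A j ≡ true → lookup A i ≡ false → δ j i ≡ 0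
δ-separated (a ∷ A) Fin.zero    Fin.zero    refl ()
δ-separated (a ∷ A) Fin.zero    (Fin.suc j) _ _ = refl
δ-separated (a ∷ A) (Fin.suc i) Fin.zero    _ _ = refl
δ-separated (a ∷ A) (Fin.suc i) (Fin.suc j) p q = δ-separated A i j p q

cnt-restrict-dead : ∀ (A : Vec Bool n) ℓ i → lookup A i ≡ false → cnt (restrict A ℓ) i ≡ 0
cnt-restrict-dead A [] i dead = refl
cnt-restrict-dead A ((s , j) ∷ ℓ) i dead with lookup A j in eq
... | true  = cong₂ _+_ (δ-separated A i j eq dead) (cnt-restrict-dead A ℓ i dead)
... | false = cnt-restrict-dead A ℓ i dead

length-restrict : ∀ (A : Vec Bool n) ℓ → (∀ i → cnt ℓ i ≤ 2) → length (restrict A ℓ) ≤ 2 * size A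
length-restrict A ℓ cnt≤2 = begin
  length (restrict A ℓ)               ≡⟨ sumF-cnt (restrict A ℓ) ⟨
  sumF (cnt (restrict A ℓ))           ≤⟨ sumF-mono bound ⟩
  sumF (λ i → 2 * bit (lookup A i))   ≡⟨ sumF-*ˡ 2 (λ i → bit (lookup A i)) ⟩
  2 * sumF (λ i → bit (lookup A i))   ≡⟨ cong (2 *_) (sumF-bit A) ⟩
  2 * size A                          ∎
  where
  open ≤-Reasoning
  bound : ∀ i → cnt (restrict A ℓ) i ≤ 2 * bit (lookup A i)
  bound i with lookup A i in eq
  ... | true  = ≤-trans (cnt-restrict A ℓ i) (cnt≤2 i)
  ... | false = ≤-reflexive (cnt-restrict-dead A ℓ i eq)

eval-restrict : ∀ (A D x : Vec Bool n) → (∀ i → lookup A i ≡ false → lookup D i ≡ false) → ∀ ℓ → eval D x (restrict A ℓ) ≡ eval D x ℓ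
eval-restrict A D x D⊆A [] = refl
eval-restrict A D x D⊆A ((s , j) ∷ ℓ) with lookup A j in eq
... | true  = cong (litValue D x (s , j) +ℤ_) (eval-restrict A D x D⊆A ℓ)
... | false = trans (eval-restrict A D x D⊆A ℓ) (sym (trans (cong (_+ℤ eval D x ℓ)
    (trans (cong (λ a → sign s *ℤ signed a (lookup x j)) (D⊆A j eq)) (ℤₚ.*-zeroʳ (sign s)))) (ℤₚ.+-identityˡ _)))

∣eval∣≤length : ∀ (A x : Vec Bool n) ℓ → ∣ eval A x ℓ ∣ ≤ length ℓ
∣eval∣≤length A x [] = z≤n
∣eval∣≤length A x ((s , j) ∷ ℓ) = ≤-trans (ℤₚ.∣i+j∣≤∣i∣+∣j∣ (litValue A x (s , j)) (eval A x ℓ))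
  (+-mono-≤ (≤-trans (≤-reflexive (trans (ℤₚ.abs-* (sign s) _) (trans (cong (_* ∣ signed (lookup A j) (lookup x j) ∣) (∣sign∣ s)) (*-identityˡ _))))
    (∣signed∣≤1 (lookup A j) (lookup x j))) (∣eval∣≤length A x ℓ))
  where
  ∣signed∣≤1 : ∀ a b → ∣ signed a b ∣ ≤ 1
  ∣signed∣≤1 true  b = ≤-reflexive (∣sign∣ b)
  ∣signed∣≤1 false b = z≤n

-- Where x and y differ on A, the colour becomes final; where they agree, the position stays live
-- for the next round.
diff same : Vec Bool n → Vec Bool n → Vec Bool n → Vec Bool n
diff A x y = zipWith _∧_ A (zipWith _xor_ x y)
same A x y = zipWith (λ a b → a ∧ not b) A (zipWith _xor_ x y)

merge : Vec Bool n → Vec Bool n → Vec Bool n → Vec Bool n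
merge []      []      []      = []
merge (d ∷ D) (b ∷ x) (c ∷ y) = (if d then b else c) ∷ merge D x y

size-diff-same : ∀ (A x y : Vec Bool n) → size (diff A x y) + size (same A x y) ≡ size A
size-diff-same [] [] [] = refl
size-diff-same (false ∷ A) (b ∷ x) (c ∷ y) = size-diff-same A x y
size-diff-same (true ∷ A) (true ∷ x) (true ∷ y) = trans (+-suc _ _) (cong suc (size-diff-same A x y))
size-diff-same (true ∷ A) (true ∷ x) (false ∷ y) = cong suc (size-diff-same A x y)
size-diff-same (true ∷ A) (false ∷ x) (true ∷ y) = cong suc (size-diff-same A x y)
size-diff-same (true ∷ A) (false ∷ x) (false ∷ y) = trans (+-suc _ _) (cong suc (size-diff-same A x y))

diff⊆ : ∀ (A x y : Vec Bool n) i → lookup A i ≡ false → lookup (diff A x y) i ≡ false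
diff⊆ (false ∷ A) (b ∷ x) (c ∷ y) Fin.zero    eq = refl
diff⊆ (a ∷ A)     (b ∷ x) (c ∷ y) (Fin.suc i) eq = diff⊆ A x y i eq

-- On the positions where x and y differ, x is half of the difference x − y.
diff-half : ∀ (A x y : Vec Bool n) i →
  signed (lookup A i) (lookup x i) -ℤ signed (lookup A i) (lookup y i) ≡ pos 2 *ℤ signed (lookup (diff A x y) i) (lookup x i)
diff-half (false ∷ A) (b ∷ x)     (c ∷ y)     Fin.zero = refl
diff-half (true ∷ A)  (true ∷ x)  (true ∷ y)  Fin.zero = refl
diff-half (true ∷ A)  (true ∷ x)  (false ∷ y) Fin.zero = refl
diff-half (true ∷ A)  (false ∷ x) (true ∷ y)  Fin.zero = refl
diff-half (true ∷ A)  (false ∷ x) (false ∷ y) Fin.zero = refl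
diff-half (a ∷ A) (b ∷ x) (c ∷ y) (Fin.suc i) = diff-half A x y i

eval-diff : ∀ (A x y : Vec Bool n) ℓ → eval A x ℓ -ℤ eval A y ℓ ≡ pos 2 *ℤ eval (diff A x y) x ℓ
eval-diff A x y [] = refl
eval-diff A x y ((s , j) ∷ ℓ) = trans (lem₁ (sign s) _ _ (eval A x ℓ) (eval A y ℓ))
  (trans (cong₂ (λ u v → sign s *ℤ u +ℤ v) (diff-half A x y j) (eval-diff A x y ℓ)) (lem₂ (sign s) _ (eval (diff A x y) x ℓ)))
  where
  lem₁ : ∀ s a b u v → (s *ℤ a +ℤ u) -ℤ (s *ℤ b +ℤ v) ≡ s *ℤ (a -ℤ b) +ℤ (u -ℤ v)
  lem₁ = ℤ-Ring.solve-∀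
  lem₂ : ∀ s a u → s *ℤ (pos 2 *ℤ a) +ℤ pos 2 *ℤ u ≡ pos 2 *ℤ (s *ℤ a +ℤ u)
  lem₂ = ℤ-Ring.solve-∀

merge-signed : ∀ (A x y z : Vec Bool n) i →
  signed (lookup A i) (lookup (merge (diff A x y) x z) i) ≡
  signed (lookup (diff A x y) i) (lookup x i) +ℤ signed (lookup (same A x y) i) (lookup z i)
merge-signed (false ∷ A) (b ∷ x)     (c ∷ y)     (w ∷ z) Fin.zero = refl
merge-signed (true ∷ A)  (true ∷ x)  (true ∷ y)  (w ∷ z) Fin.zero = sym (ℤₚ.+-identityˡ _)
merge-signed (true ∷ A)  (true ∷ x)  (false ∷ y) (w ∷ z) Fin.zero = refl
merge-signed (true ∷ A)  (false ∷ x) (true ∷ y)  (w ∷ z) Fin.zero = refl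
merge-signed (true ∷ A)  (false ∷ x) (false ∷ y) (w ∷ z) Fin.zero = sym (ℤₚ.+-identityˡ _)
merge-signed (a ∷ A) (b ∷ x) (c ∷ y) (w ∷ z) (Fin.suc i) = merge-signed A x y z i

eval-merge : ∀ (A x y z : Vec Bool n) ℓ →
  eval A (merge (diff A x y) x z) ℓ ≡ eval (diff A x y) x ℓ +ℤ eval (same A x y) z ℓ
eval-merge A x y z [] = refl
eval-merge A x y z ((s , j) ∷ ℓ) = trans (cong₂ (λ u v → sign s *ℤ u +ℤ v) (merge-signed A x y z j) (eval-merge A x y z ℓ))
  (lem (sign s) _ _ (eval (diff A x y) x ℓ) (eval (same A x y) z ℓ))
  where
  lem : ∀ s a b u v → s *ℤ (a +ℤ b) +ℤ (u +ℤ v) ≡ (s *ℤ a +ℤ u) +ℤ (s *ℤ b +ℤ v)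
  lem = ℤ-Ring.solve-∀

agreement : Vec Bool n → Vec Bool n → Vec Bool n → ℕ
agreement []          []      []      = 1
agreement (false ∷ A) (b ∷ x) (c ∷ y) = agreement A x y
agreement (true ∷ A)  (b ∷ x) (c ∷ y) = (if b xor c then 1 else 8) * agreement A x y

agreement-diff : ∀ (A x y : Vec Bool n) → agreement A x y * 8 ^ size (diff A x y) ≡ 8 ^ size A
agreement-diff [] [] [] = refl
agreement-diff (false ∷ A) (b ∷ x) (c ∷ y) = agreement-diff A x y
agreement-diff (true ∷ A) (b ∷ x) (c ∷ y) with b xor c
... | true  = trans (lem (agreement A x y) (8 ^ size (diff A x y))) (cong (8 *_) (agreement-diff A x y))
  where
  lem : ∀ a b → 1 * a * (8 * b) ≡ 8 * (a * b)
  lem = ℕ-Ring.solve-∀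
... | false = trans (*-assoc 8 (agreement A x y) _) (cong (8 *_) (agreement-diff A x y))

agreement-total : ∀ (A x : Vec Bool n) → Σₗ (agreement A x) (colourings A) ≡ 9 ^ size A
agreement-total [] [] = refl
agreement-total (false ∷ A) (b ∷ x) = trans (Σₗ-map _ (false ∷_) (colourings A)) (agreement-total A x)
agreement-total (true ∷ A) (b ∷ x) = trans (Σₗ-colourings-true A _) (trans (Σₗ-cong (two b) (colourings A))
  (trans (Σₗ-*ˡ 9 (agreement A x) (colourings A)) (cong (9 *_) (agreement-total A x))))
  where
  lem₁ : ∀ a → 1 * a + 8 * a ≡ 9 * a
  lem₁ = ℕ-Ring.solve-∀
  lem₂ : ∀ a → 8 * a + 1 * a ≡ 9 * a
  lem₂ = ℕ-Ring.solve-∀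
  two : ∀ b y → (if b xor true then 1 else 8) * agreement A x y + (if b xor false then 1 else 8) * agreement A x y ≡ 9 * agreement A x y
  two true  y = lem₂ (agreement A x y)
  two false y = lem₁ (agreement A x y)

find-or-all : ∀ {X : Set} {P Q : X → Set} → (∀ x → P x ⊎ Q x) → ∀ xs → (∃ λ x → x ∈ xs × P x) ⊎ All Q xs
find-or-all dec [] = inj₂ []
find-or-all dec (x ∷ xs) with dec x
... | inj₁ px = inj₁ (x , here refl , px)
... | inj₂ qx with find-or-all dec xs
...   | inj₁ (y , y∈ , py) = inj₁ (y , there y∈ , py)
...   | inj₂ all = inj₂ (qx ∷ all)

-- A Hamming ball is small, because Σ_y 8^(number of agreements of x and y) = 9^N.
far-pair : ∀ (A : Vec Bool n) xs h → (∀ f → Σₗ f xs ≤ Σₗ f (colourings A)) →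
  8 ^ h * 9 ^ size A < length xs * 8 ^ size A →
  ∃ λ x → ∃ λ y → x ∈ xs × y ∈ xs × h < size (diff A x y)
far-pair A [] h sub ()
far-pair A xs@(x ∷ _) h sub big with find-or-all {P = λ y → h < size (diff A x y)} {Q = λ y → size (diff A x y) ≤ h} (λ y → dec y) xs
  where
  dec : ∀ y → h < size (diff A x y) ⊎ size (diff A x y) ≤ h
  dec y with size (diff A x y) ≤? h
  ... | yes le = inj₂ le
  ... | no  ≰h = inj₁ (≰⇒> ≰h)
... | inj₁ (y , y∈ , far) = x , y , here refl , y∈ , far
... | inj₂ close = contradiction big (≤⇒≯ (begin
  length xs * 8 ^ size A                                      ≡⟨ Σₗ-const _ xs ⟨
  Σₗ (λ _ → 8 ^ size A) xs                                    ≤⟨ Σₗ-mono (All.map (λ {y} le → ball y le) close) ⟩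
  Σₗ (λ y → 8 ^ h * agreement A x y) xs                       ≡⟨ Σₗ-*ˡ (8 ^ h) (agreement A x) xs ⟩
  8 ^ h * Σₗ (agreement A x) xs                               ≤⟨ *-monoʳ-≤ (8 ^ h) (sub (agreement A x)) ⟩
  8 ^ h * Σₗ (agreement A x) (colourings A)                         ≡⟨ cong (8 ^ h *_) (agreement-total A x) ⟩
  8 ^ h * 9 ^ size A                                          ∎))
  where
  open ≤-Reasoning
  ball : ∀ y → size (diff A x y) ≤ h → 8 ^ size A ≤ 8 ^ h * agreement A x y
  ball y le = ≤-trans (≤-reflexive (sym (agreement-diff A x y)))
    (≤-trans (*-monoʳ-≤ (agreement A x y) (^-monoʳ-≤ 8 le)) (≤-reflexive (*-comm (agreement A x y) (8 ^ h))))

-- Rounding is towards zero, so that ∣z∣ < Δ gives the key 0, which costs nothing. In exchange the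
-- cell of 0 is twice as wide as the others.
truncQuot : ∀ Δ .{{_ : NonZero Δ}} → ℤ → ℤ
truncQuot Δ (pos m)  = pos (m / Δ)
truncQuot Δ -[1+ m ] = -ℤ pos (suc m / Δ)

∣truncQuot∣ : ∀ Δ .{{_ : NonZero Δ}} z → ∣ truncQuot Δ z ∣ ≡ ∣ z ∣ / Δ
∣truncQuot∣ Δ (pos m)  = refl
∣truncQuot∣ Δ -[1+ m ] = ℤₚ.∣-i∣≡∣i∣ (pos (suc m / Δ))

truncQuot-error : ∀ Δ .{{_ : NonZero Δ}} z → ∣ z -ℤ truncQuot Δ z *ℤ pos Δ ∣ ≤ Δ
truncQuot-error Δ (pos m) = ≤-trans (≤-reflexive (cong ∣_∣ (trans (cong (_-ℤ q) pm) (lem (pos (m % Δ)) q)))) (<⇒≤ (m%n<n m Δ))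
  where
  q = pos (m / Δ) *ℤ pos Δ
  pm : pos m ≡ pos (m % Δ) +ℤ q
  pm = trans (cong pos (m≡m%n+[m/n]*n m Δ)) (cong (pos (m % Δ) +ℤ_) (ℤₚ.pos-* (m / Δ) Δ))
  lem : ∀ a b → a +ℤ b -ℤ b ≡ a
  lem = ℤ-Ring.solve-∀
truncQuot-error Δ -[1+ m ] = ≤-trans (≤-reflexive (trans (cong ∣_∣ (trans (cong (λ z → -ℤ z -ℤ (-ℤ pos (suc m / Δ)) *ℤ pos Δ) pm)
    (lem (pos (suc m % Δ)) (pos (suc m / Δ)) (pos Δ)))) (ℤₚ.∣-i∣≡∣i∣ (pos (suc m % Δ))))) (<⇒≤ (m%n<n (suc m) Δ))
  where
  pm : pos (suc m) ≡ pos (suc m % Δ) +ℤ pos (suc m / Δ) *ℤ pos Δ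
  pm = trans (cong pos (m≡m%n+[m/n]*n (suc m) Δ)) (cong (pos (suc m % Δ) +ℤ_) (ℤₚ.pos-* (suc m / Δ) Δ))
  lem : ∀ a b d → -ℤ (a +ℤ b *ℤ d) -ℤ (-ℤ b) *ℤ d ≡ -ℤ a
  lem = ℤ-Ring.solve-∀

truncQuot-close : ∀ Δ .{{_ : NonZero Δ}} z z′ → truncQuot Δ z ≡ truncQuot Δ z′ → ∣ z -ℤ z′ ∣ ≤ Δ + Δ
truncQuot-close Δ z z′ eq = begin
  ∣ z -ℤ z′ ∣                                            ≡⟨ cong ∣_∣ (lem z z′ q) ⟩
  ∣ (z -ℤ q) -ℤ (z′ -ℤ q) ∣                              ≤⟨ ℤₚ.∣i-j∣≤∣i∣+∣j∣ (z -ℤ q) (z′ -ℤ q) ⟩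
  ∣ z -ℤ q ∣ + ∣ z′ -ℤ q ∣                               ≤⟨ +-mono-≤ (truncQuot-error Δ z) (subst (λ w → ∣ z′ -ℤ w *ℤ pos Δ ∣ ≤ Δ) (sym eq) (truncQuot-error Δ z′)) ⟩
  Δ + Δ                                                  ∎
  where
  open ≤-Reasoning
  q = truncQuot Δ z *ℤ pos Δ
  lem : ∀ z z′ q → z -ℤ z′ ≡ (z -ℤ q) -ℤ (z′ -ℤ q)
  lem = ℤ-Ring.solve-∀

-- Markov's inequality for the fourth power: the quotient k is a natural number, hence k ≤ k⁴.
truncQuot-fourth : ∀ Δ .{{_ : NonZero Δ}} z → ∣ truncQuot Δ z ∣ * (Δ * Δ * (Δ * Δ)) ≤ sq z * sq z
truncQuot-fourth Δ z = begin
  ∣ truncQuot Δ z ∣ * (Δ * Δ * (Δ * Δ))              ≡⟨ cong (_* (Δ * Δ * (Δ * Δ))) (∣truncQuot∣ Δ z) ⟩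
  k * (Δ * Δ * (Δ * Δ))                       ≤⟨ *-monoˡ-≤ (Δ * Δ * (Δ * Δ)) (k≤k⁴ k) ⟩
  k * k * (k * k) * (Δ * Δ * (Δ * Δ))         ≡⟨ lem k Δ ⟩
  k * Δ * (k * Δ) * (k * Δ * (k * Δ))         ≤⟨ *-mono-≤ (*-mono-≤ kΔ≤ kΔ≤) (*-mono-≤ kΔ≤ kΔ≤) ⟩
  sq z * sq z                                 ∎
  where
  open ≤-Reasoning
  k = ∣ z ∣ / Δ
  kΔ≤ : k * Δ ≤ ∣ z ∣
  kΔ≤ = m/n*n≤m ∣ z ∣ Δ
  lem : ∀ k d → k * k * (k * k) * (d * d * (d * d)) ≡ k * d * (k * d) * (k * d * (k * d))
  lem = ℕ-Ring.solve-∀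
  k≤k⁴ : ∀ k → k ≤ k * k * (k * k)
  k≤k⁴ zero    = z≤n
  k≤k⁴ (suc k) = ≤-trans (m≤m*n (suc k) (suc k)) (m≤m*n (suc k * suc k) (suc k * suc k))

-- Blocks and the partial colouring step

GoodList : ℕ → Set
GoodList n = Σ (List (Lit n)) (λ ℓ → ∀ i → cnt ℓ i ≤ 2)

take-+ : ∀ {X : Set} m b (xs : List X) → take (m + b) xs ≡ take m xs ++ take b (drop m xs)
take-+ zero    b xs       = refl
take-+ (suc m) b []       = sym (take-[] b)
  where
  take-[] : ∀ {X : Set} b → take {A = X} b [] ≡ []
  take-[] zero    = refl
  take-[] (suc b) = refl
take-+ (suc m) b (x ∷ xs) = cong (x ∷_) (take-+ m b xs)

take-length-++ : ∀ {X : Set} (xs ys : List X) → take (length xs) (xs ++ ys) ≡ xs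
take-length-++ []       ys = refl
take-length-++ (x ∷ xs) ys = cong (x ∷_) (take-length-++ xs ys)

length-take-≤ : ∀ {X : Set} m (xs : List X) → length (take m xs) ≤ m
length-take-≤ m xs = ≤-trans (≤-reflexive (length-take m xs)) (m⊓n≤m m (length xs))

length-take-drop : ∀ {X : Set} b m (xs : List X) → length (take b (drop m xs)) ≤ length xs
length-take-drop b m xs = ≤-trans (≤-reflexive (length-take b (drop m xs))) (≤-trans (m⊓n≤n b _)
  (≤-trans (≤-reflexive (length-drop m xs)) (m∸n≤m (length xs) m)))

opaque
  -- The block lengths 256^i, whose square roots 16^i are again powers of two. Opaque, so that they
  -- stay symbolic.
  β : ℕ → ℕ
  β i = 2 ^ (8 * i)

  β≡ : ∀ i → β i ≡ 2 ^ (8 * i)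
  β≡ i = refl

instance
  β≢0 : ∀ {i} → NonZero (β i)
  β≢0 {i} = subst NonZero (sym (β≡ i)) (m^n≢0 2 (8 * i))

β-zero : β 0 ≡ 1
β-zero = β≡ 0

β-suc : ∀ i → β (suc i) ≡ 256 * β i
β-suc i = trans (β≡ (suc i)) (trans (cong (2 ^_) (*-suc 8 i)) (trans (^-distribˡ-+-* 2 8 (8 * i)) (cong (256 *_) (sym (β≡ i)))))

-- Two length bounds are kept: `length≤S` limits the range of the keys, `length≤β` the moments.
record Block (n S : ℕ) : Set where
  constructor mkBlock
  field
    lits     : List (Lit n)
    cnt≤2    : ∀ i → cnt lits i ≤ 2
    length≤S : length lits ≤ S
    level    : ℕ
    length≤β : length lits ≤ β level
open Block

module Blocks {n S : ℕ} (ℓ : List (Lit n)) (cnt≤2 : ∀ i → cnt ℓ i ≤ 2) (length≤S : length ℓ ≤ S) where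

  block : ℕ → ℕ → Block n S
  block i j = mkBlock (take (β i) (drop (j * β i) ℓ))
    (λ v → ≤-trans (cnt-take (β i) (drop (j * β i) ℓ) v) (≤-trans (cnt-drop (j * β i) ℓ v) (cnt≤2 v)))
    (≤-trans (length-take-drop (β i) (j * β i) ℓ) length≤S) i (length-take-≤ (β i) _)

  blocksAt : ℕ → List (Block n S)
  blocksAt i = map (block i) (upTo (length ℓ / β i))

  blocksUpTo : ℕ → List (Block n S)
  blocksUpTo zero    = blocksAt zero
  blocksUpTo (suc L) = blocksAt (suc L) ++ blocksUpTo L

  block∈ : ∀ L i j → i ≤ L → j < length ℓ / β i → block i j ∈ blocksUpTo L
  block∈ L i j i≤L j< with m≤n⇒m<n∨m≡n i≤L
  block∈ zero    .0 j i≤L j< | inj₂ refl = ∈-map⁺ (block 0) (∈-upTo⁺ j<)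
  block∈ (suc L) .(suc L) j i≤L j< | inj₂ refl = ∈-++⁺ˡ (∈-map⁺ (block (suc L)) (∈-upTo⁺ j<))
  block∈ (suc L) i j i≤L j< | inj₁ (s≤s i≤L′) = ∈-++⁺ʳ (blocksAt (suc L)) (block∈ L i j i≤L′ j<)

  Σₗ-blocksAt : ∀ (f : Block n S → ℕ) g i → (∀ j → f (block i j) ≤ β i * g) → Σₗ f (blocksAt i) ≤ length ℓ * g
  Σₗ-blocksAt f g i le = begin
    Σₗ f (blocksAt i)                            ≡⟨ Σₗ-map f (block i) (upTo (length ℓ / β i)) ⟩
    Σₗ (f ∘ block i) (upTo (length ℓ / β i))     ≤⟨ Σₗ-mono′ le (upTo (length ℓ / β i)) ⟩
    Σₗ (λ _ → β i * g) (upTo (length ℓ / β i))   ≡⟨ Σₗ-const _ (upTo (length ℓ / β i)) ⟩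
    length (upTo (length ℓ / β i)) * (β i * g)   ≡⟨ cong (_* (β i * g)) (length-upTo (length ℓ / β i)) ⟩
    length ℓ / β i * (β i * g)                   ≡⟨ *-assoc (length ℓ / β i) (β i) g ⟨
    length ℓ / β i * β i * g                     ≤⟨ *-monoˡ-≤ g (m/n*n≤m (length ℓ) (β i)) ⟩
    length ℓ * g                                 ∎
    where open ≤-Reasoning

  -- Level i has length ℓ / β i blocks and contributes at most length ℓ · γ i. Since γ at least
  -- doubles, the top level accounts for half of the bound.
  Σₗ-blocksUpTo : ∀ (f : Block n S → ℕ) (γ : ℕ → ℕ) → (∀ i → 2 * γ i ≤ γ (suc i)) → ∀ L →
    (∀ i → i ≤ L → ∀ j → f (block i j) ≤ β i * γ i) → Σₗ f (blocksUpTo L) ≤ length ℓ * (2 * γ L)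
  Σₗ-blocksUpTo f γ double zero le = ≤-trans (Σₗ-blocksAt f (γ 0) 0 (le 0 z≤n)) (*-monoʳ-≤ (length ℓ) (m≤n*m (γ 0) 2))
  Σₗ-blocksUpTo f γ double (suc L) le = begin
    Σₗ f (blocksAt (suc L) ++ blocksUpTo L)                  ≡⟨ Σₗ-++ f (blocksAt (suc L)) (blocksUpTo L) ⟩
    Σₗ f (blocksAt (suc L)) + Σₗ f (blocksUpTo L)            ≤⟨ +-mono-≤ (Σₗ-blocksAt f (γ (suc L)) (suc L) (le (suc L) ≤-refl))
                                                                 (Σₗ-blocksUpTo f γ double L (λ i i≤L → le i (m≤n⇒m≤1+n i≤L))) ⟩
    length ℓ * γ (suc L) + length ℓ * (2 * γ L)              ≤⟨ +-monoʳ-≤ (length ℓ * γ (suc L)) (*-monoʳ-≤ (length ℓ) (double L)) ⟩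
    length ℓ * γ (suc L) + length ℓ * γ (suc L)              ≡⟨ lem (length ℓ) (γ (suc L)) ⟩
    length ℓ * (2 * γ (suc L))                               ∎
    where
    open ≤-Reasoning
    lem : ∀ a b → a * b + a * b ≡ a * (2 * b)
    lem = ℕ-Ring.solve-∀

  module Prefix (u : List (Lit n) → ℤ) (u-++ : ∀ xs ys → u (xs ++ ys) ≡ u xs +ℤ u ys) (u-[] : u [] ≡ pos 0)
    (Δ : ℕ → ℕ) (Δ-suc : ∀ i → Δ (suc i) ≡ 2 * Δ i) (L : ℕ)
    (bound : ∀ i j → i ≤ L → j < length ℓ / β i → ∣ u (lits (block i j)) ∣ ≤ Δ i) where

    step : ∀ i → i ≤ L → ∀ a r → (a + r) * β i ≤ length ℓ →
      ∣ u (take ((a + r) * β i) ℓ) ∣ ≤ ∣ u (take (a * β i) ℓ) ∣ + r * Δ i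
    step i i≤L a zero le = ≤-reflexive (trans (cong (λ z → ∣ u (take (z * β i) ℓ) ∣) (+-identityʳ a)) (sym (+-identityʳ _)))
    step i i≤L a (suc r) le = begin
      ∣ u (take ((a + suc r) * β i) ℓ) ∣
        ≡⟨ cong (λ z → ∣ u (take z ℓ) ∣) (trans (cong (_* β i) (+-suc a r)) (+-comm (β i) ((a + r) * β i))) ⟩
      ∣ u (take ((a + r) * β i + β i) ℓ) ∣
        ≡⟨ cong ∣_∣ (trans (cong u (take-+ ((a + r) * β i) (β i) ℓ)) (u-++ _ _)) ⟩
      ∣ u (take ((a + r) * β i) ℓ) +ℤ u (lits (block i (a + r))) ∣
        ≤⟨ ℤₚ.∣i+j∣≤∣i∣+∣j∣ (u (take ((a + r) * β i) ℓ)) _ ⟩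
      ∣ u (take ((a + r) * β i) ℓ) ∣ + ∣ u (lits (block i (a + r))) ∣
        ≤⟨ +-mono-≤ (step i i≤L a r (≤-trans (*-monoˡ-≤ (β i) (+-monoʳ-≤ a (n≤1+n r))) le)) (bound i (a + r) i≤L index) ⟩
      ∣ u (take (a * β i) ℓ) ∣ + r * Δ i + Δ i
        ≡⟨ lem ∣ u (take (a * β i) ℓ) ∣ (r * Δ i) (Δ i) ⟩
      ∣ u (take (a * β i) ℓ) ∣ + suc r * Δ i ∎
      where
      open ≤-Reasoning
      lem : ∀ x y z → x + y + z ≡ x + (z + y)
      lem = ℕ-Ring.solve-∀
      index : a + r < length ℓ / β i
      index = ≤-trans (≤-reflexive (trans (sym (+-suc a r)) (sym (m*n/n≡m (a + suc r) (β i))))) (/-monoˡ-≤ (β i) le)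

    -- Rounding a down to a multiple of 256 removes at most 255 blocks of level i and leaves blocks
    -- of level i + 1. As Δ doubles, 255 Δ i + 255 Δ i = 255 Δ (i+1); this is why 255 Δ i stands on
    -- the left. At level L + 1 the shortness of the list forces a = 0.
    descend : length ℓ < β (suc L) → ∀ m i → i + m ≡ suc L → ∀ a → a * β i ≤ length ℓ →
      ∣ u (take (a * β i) ℓ) ∣ + 255 * Δ i ≤ 255 * Δ (suc L)
    descend short zero i eq a le with trans (sym (+-identityʳ i)) eq
    descend short zero i eq zero le | refl = ≤-reflexive (cong (λ z → ∣ z ∣ + 255 * Δ (suc L)) u-[])
    descend short zero i eq (suc a) le | refl = contradiction short (≤⇒≯ (≤-trans (m≤m+n (β i) (a * β i)) le))
    descend short (suc m) i eq a le = begin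
      ∣ u (take (a * β i) ℓ) ∣ + 255 * Δ i
        ≡⟨ cong (λ z → ∣ u (take (z * β i) ℓ) ∣ + 255 * Δ i) a≡ ⟩
      ∣ u (take ((a / 256 * 256 + a % 256) * β i) ℓ) ∣ + 255 * Δ i
        ≤⟨ +-monoˡ-≤ (255 * Δ i) (step i i≤L (a / 256 * 256) (a % 256) (subst (λ z → z * β i ≤ length ℓ) a≡ le)) ⟩
      ∣ u (take (a / 256 * 256 * β i) ℓ) ∣ + a % 256 * Δ i + 255 * Δ i
        ≤⟨ +-monoˡ-≤ (255 * Δ i) (+-monoʳ-≤ ∣ u (take (a / 256 * 256 * β i) ℓ) ∣ (*-monoˡ-≤ (Δ i) (≤-pred (m%n<n a 256)))) ⟩
      ∣ u (take (a / 256 * 256 * β i) ℓ) ∣ + 255 * Δ i + 255 * Δ i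
        ≡⟨ trans (lem ∣ u (take (a / 256 * 256 * β i) ℓ) ∣ 255 (Δ i)) (cong₂ (λ y z → ∣ u (take y ℓ) ∣ + 255 * z) base (sym (Δ-suc i))) ⟩
      ∣ u (take (a / 256 * β (suc i)) ℓ) ∣ + 255 * Δ (suc i)
        ≤⟨ descend short m (suc i) (trans (sym (+-suc i m)) eq) (a / 256)
             (≤-trans (≤-reflexive (sym base)) (≤-trans (*-monoˡ-≤ (β i) (m/n*n≤m a 256)) le)) ⟩
      255 * Δ (suc L) ∎
      where
      open ≤-Reasoning
      a≡ : a ≡ a / 256 * 256 + a % 256
      a≡ = trans (m≡m%n+[m/n]*n a 256) (+-comm (a % 256) _)
      base : a / 256 * 256 * β i ≡ a / 256 * β (suc i)
      base = trans (*-assoc (a / 256) 256 (β i)) (cong (a / 256 *_) (sym (β-suc i)))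
      i≤L : i ≤ L
      i≤L = ≤-pred (≤-trans (≤-trans (s≤s (m≤m+n i m)) (≤-reflexive (sym (+-suc i m)))) (≤-reflexive eq))
      lem : ∀ x c d → x + c * d + c * d ≡ x + c * (2 * d)
      lem = ℕ-Ring.solve-∀

    prefix : length ℓ < β (suc L) → ∀ z → z ≤ length ℓ → ∣ u (take z ℓ) ∣ ≤ 255 * Δ (suc L)
    prefix short z le = ≤-trans (m≤m+n _ (255 * Δ 0)) (≤-trans
      (≤-reflexive (cong (λ y → ∣ u (take y ℓ) ∣ + 255 * Δ 0) (sym z*β₀)))
      (descend short (suc L) 0 refl z (≤-trans (≤-reflexive z*β₀) le)))
      where
      z*β₀ : z * β 0 ≡ z
      z*β₀ = trans (cong (z *_) β-zero) (*-identityʳ z)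

2^-+ : ∀ a b → 2 ^ a * 2 ^ b ≡ 2 ^ (a + b)
2^-+ a b = sym (^-distribˡ-+-* 2 a b)

∣eval-prefix∣ : ∀ {n} (A x : Vec Bool n) (g : GoodList n) ys zs → proj₁ g ≡ ys ++ zs → ∣ eval A x ys ∣ ≤ 2 * size A
∣eval-prefix∣ A x (ℓ , cnt≤2) ys zs eq = begin
  ∣ eval A x ys ∣                                     ≡⟨ cong ∣_∣ (eval-restrict A A x (λ i dead → dead) ys) ⟨
  ∣ eval A x (restrict A ys) ∣                        ≤⟨ ∣eval∣≤length A x (restrict A ys) ⟩
  length (restrict A ys)                            ≤⟨ m≤m+n _ (length (restrict A zs)) ⟩
  length (restrict A ys) + length (restrict A zs)   ≡⟨ trans (sym (length-++ (restrict A ys)))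
                                                         (cong length (sym (trans (cong (restrict A) eq) (restrict-++ A ys zs)))) ⟩
  length (restrict A ℓ)                             ≤⟨ length-restrict A ℓ cnt≤2 ⟩
  2 * size A                                        ∎
  where open ≤-Reasoning

-- One round of partial colouring

module Stage {n : ℕ} (Λ L : ℕ) (L≤Λ : L ≤ Λ) (A : Vec Bool n) (lists : List (GoodList n)) (few : length lists ≤ β Λ)
  (short : 2 * size A < β (suc L)) where

  private
    N S h : ℕ
    N = size A
    S = 2 * N
    -- One sixteenth of the live positions serves both as the budget of bits for the tests and as
    -- the Hamming distance to be exceeded.
    h = N / 16

  alive : GoodList n → List (Lit n)
  alive (ℓ , _) = restrict A ℓ

  alive-cnt≤2 : ∀ g i → cnt (alive g) i ≤ 2
  alive-cnt≤2 (ℓ , c) i = ≤-trans (cnt-restrict A ℓ i) (c i)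

  length-alive : ∀ g → length (alive g) ≤ S
  length-alive (ℓ , c) = length-restrict A ℓ c

  module B (g : GoodList n) = Blocks (alive g) (alive-cnt≤2 g) (length-alive g)

  tests : List (Block n S)
  tests = concatMap (λ g → B.blocksUpTo g L) lists

  tests-sum : ∀ (f : Block n S → ℕ) (γ : ℕ → ℕ) → (∀ i → 2 * γ i ≤ γ (suc i)) →
    (∀ b → Block.level b ≤ Λ → f b ≤ β (Block.level b) * γ (Block.level b)) →
    Σₗ f tests ≤ β Λ * (S * (2 * γ L))
  tests-sum f γ double le = begin
    Σₗ f tests                                  ≡⟨ Σₗ-concatMap f (λ g → B.blocksUpTo g L) lists ⟩
    Σₗ (λ g → Σₗ f (B.blocksUpTo g L)) lists    ≤⟨ Σₗ-mono′ (λ g → ≤-trans (B.Σₗ-blocksUpTo g f γ double L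
                                                       (λ i i≤L j → le (B.block g i j) (≤-trans i≤L L≤Λ)))
                                                     (*-monoˡ-≤ (2 * γ L) (length-alive g))) lists ⟩
    Σₗ (λ _ → S * (2 * γ L)) lists              ≡⟨ Σₗ-const _ lists ⟩
    length lists * (S * (2 * γ L))              ≤⟨ *-monoˡ-≤ (S * (2 * γ L)) few ⟩
    β Λ * (S * (2 * γ L))                       ∎
    where open ≤-Reasoning

  -- Δ i exceeds the standard deviation 16^i of a block by the factor 2^4 * 8^(Λ ∸ i): by the fourth moment
  -- this is rare enough to pay for the 256^(Λ ∸ i) times larger number of blocks of size 256^i.
  Δ : ℕ → ℕ
  Δ i = 2 ^ (3 * Λ + i + 4)

  Δ-suc : ∀ i → Δ (suc i) ≡ 2 * Δ i
  Δ-suc i = cong (λ z → 2 ^ (z + 4)) (+-suc (3 * Λ) i)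

  instance
    Δ≢0 : ∀ {i} → NonZero (Δ i)
    Δ≢0 {i} = m^n≢0 2 (3 * Λ + i + 4)

  key : Block n S → Vec Bool n → ℤ
  key b x = truncQuot (Δ (Block.level b)) (eval A x (Block.lits b))

  key≤S : ∀ b x → ∣ key b x ∣ ≤ suc S
  key≤S b x = begin
    ∣ key b x ∣                                        ≡⟨ ∣truncQuot∣ (Δ (Block.level b)) (eval A x (Block.lits b)) ⟩
    ∣ eval A x (Block.lits b) ∣ / Δ (Block.level b)      ≤⟨ m/n≤m _ (Δ (Block.level b)) ⟩
    ∣ eval A x (Block.lits b) ∣                          ≤⟨ ∣eval∣≤length A x (Block.lits b) ⟩
    length (Block.lits b)                              ≤⟨ Block.length≤S b ⟩
    S                                                  ≤⟨ n≤1+n S ⟩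
    suc S                                              ∎
    where open ≤-Reasoning

  -- A test adds 2^(-excess) bits of overhead to the mass. One level down there are 256 = 2^8 times
  -- as many blocks, so the slope 9 keeps the total geometric; the constant 7 fits it into h, see
  -- `τ-total`.
  excess : Block n S → ℕ
  excess b = 9 * (Λ ∸ Block.level b) + 7

  -- Common denominator of the overheads: at level 0 the excess is 9Λ + 7 and `τ` is 1.
  T : ℕ
  T = 2 ^ (9 * Λ + 8)

  instance
    T≢0 : NonZero T
    T≢0 = m^n≢0 2 (9 * Λ + 8)

  -- The double subtraction is the minimum of Λ and the level; in this form `τ-def` holds for every
  -- block, whatever its level.
  τ : Block n S → ℕ
  τ b = 2 ^ (9 * (Λ ∸ (Λ ∸ Block.level b)))

  τ-def : ∀ b → 2 * 2 ^ excess b * τ b ≡ T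
  τ-def b = trans (2^-+ (suc (9 * s + 7)) (9 * (Λ ∸ s))) (cong (2 ^_) (trans (lem s (Λ ∸ s))
    (cong (λ z → 9 * z + 8) (m+[n∸m]≡n (m∸n≤m Λ (Block.level b))))))
    where
    s = Λ ∸ Block.level b
    lem : ∀ s r → 1 + (9 * s + 7) + 9 * r ≡ 9 * (s + r) + 8
    lem = ℕ-Ring.solve-∀

  open Pigeonhole key (λ b → 3 + excess b) (suc S) key≤S

  Σₗ-cost : ∀ xs → Σₗ (cost tests) xs ≡ Σₗ (λ b → (3 + excess b) * Σₗ (λ x → ∣ key b x ∣) xs) tests
  Σₗ-cost xs = trans (Σₗ-swap _ xs tests) (Σₗ-cong (λ b → Σₗ-*ˡ (3 + excess b) (λ x → ∣ key b x ∣) xs) tests)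

  -- Δ⁴ is 2^(12Λ+16) · 16^i, and the fourth moment is at most 12 · 256^(2i) per colouring. Hence
  -- the average of ∣key∣ is at most 12 · 2^(-16) · 4096^(i-Λ).
  key-moment : ∀ b → 2 ^ (12 * Λ + 16) * Σₗ (λ x → ∣ key b x ∣) (colourings A) ≤ 12 * (2 ^ N * 2 ^ (12 * Block.level b))
  key-moment b = *-cancelʳ-≤ _ _ (2 ^ (4 * i)) {{m^n≢0 2 (4 * i)}} (begin
    2 ^ (12 * Λ + 16) * K * 2 ^ (4 * i)                   ≡⟨ lem₁ (2 ^ (12 * Λ + 16)) K (2 ^ (4 * i)) ⟩
    2 ^ (12 * Λ + 16) * 2 ^ (4 * i) * K                   ≡⟨ cong (_* K) (trans (2^-+ (12 * Λ + 16) (4 * i)) (sym Δ⁴)) ⟩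
    Δ i * Δ i * (Δ i * Δ i) * K                           ≡⟨ Σₗ-*ˡ (Δ i * Δ i * (Δ i * Δ i)) (λ x → ∣ key b x ∣) (colourings A) ⟨
    Σₗ (λ x → Δ i * Δ i * (Δ i * Δ i) * ∣ key b x ∣) (colourings A)
      ≤⟨ Σₗ-mono′ (λ x → ≤-trans (≤-reflexive (*-comm (Δ i * Δ i * (Δ i * Δ i)) ∣ key b x ∣))
           (≤-trans (truncQuot-fourth (Δ i) (eval A x (Block.lits b)))
             (≤-reflexive (cong (λ z → sq z * sq z) (eval≡dot A x (Block.lits b)))))) (colourings A) ⟩
    Σₗ (λ x → sq (dot A x c) * sq (dot A x c)) (colourings A)   ≤⟨ fourth-moment A c ⟩
    2 ^ N * (3 * (norm² c * norm² c))                     ≤⟨ *-monoʳ-≤ (2 ^ N) (*-monoʳ-≤ 3 (*-mono-≤ norm≤ norm≤)) ⟩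
    2 ^ N * (3 * (2 * β i * (2 * β i)))                   ≡⟨ lem₂ (2 ^ N) (β i) ⟩
    12 * (2 ^ N * (β i * β i))                            ≡⟨ cong (λ z → 12 * (2 ^ N * z)) ββ ⟩
    12 * (2 ^ N * (2 ^ (12 * i) * 2 ^ (4 * i)))           ≡⟨ lem₃ (2 ^ N) (2 ^ (12 * i)) (2 ^ (4 * i)) ⟩
    12 * (2 ^ N * 2 ^ (12 * i)) * 2 ^ (4 * i)             ∎)
    where
    open ≤-Reasoning
    i = Block.level b
    K = Σₗ (λ x → ∣ key b x ∣) (colourings A)
    c = coef (Block.lits b)
    norm≤ : norm² c ≤ 2 * β i
    norm≤ = ≤-trans (norm²-coef (Block.lits b) (Block.cnt≤2 b)) (*-monoʳ-≤ 2 (Block.length≤β b))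
    lem₁ : ∀ a b c → a * b * c ≡ a * c * b
    lem₁ = ℕ-Ring.solve-∀
    lem₂ : ∀ a b → a * (3 * (2 * b * (2 * b))) ≡ 12 * (a * (b * b))
    lem₂ = ℕ-Ring.solve-∀
    lem₃ : ∀ a b c → 12 * (a * (b * c)) ≡ 12 * (a * b) * c
    lem₃ = ℕ-Ring.solve-∀
    Δ⁴ : Δ i * Δ i * (Δ i * Δ i) ≡ 2 ^ (12 * Λ + 16 + 4 * i)
    Δ⁴ = trans (cong (λ z → z * z) (2^-+ d d)) (trans (2^-+ (d + d) (d + d)) (cong (2 ^_) (lem Λ i)))
      where
      d = 3 * Λ + i + 4
      lem : ∀ Λ i → (3 * Λ + i + 4) + (3 * Λ + i + 4) + ((3 * Λ + i + 4) + (3 * Λ + i + 4)) ≡ 12 * Λ + 16 + 4 * i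
      lem = ℕ-Ring.solve-∀
    ββ : β i * β i ≡ 2 ^ (12 * i) * 2 ^ (4 * i)
    ββ = trans (cong (λ z → z * z) (β≡ i)) (trans (2^-+ (8 * i) (8 * i)) (trans (cong (2 ^_) (lem i)) (sym (2^-+ (12 * i) (4 * i)))))
      where
      lem : ∀ i → 8 * i + 8 * i ≡ 12 * i + 4 * i
      lem = ℕ-Ring.solve-∀

  -- The price is linear in the depth s = Λ - i. Conceding 2^s per test still leaves the ratio 8
  -- between consecutive levels of `costRate`.
  price≤ : ∀ s → 3 + (9 * s + 7) ≤ 10 * 2 ^ s
  price≤ zero    = ≤-refl
  price≤ (suc s) = begin
    3 + (9 * suc s + 7)             ≡⟨ lem s ⟩
    9 + (3 + (9 * s + 7))           ≤⟨ +-mono-≤ (≤-trans (m≤m+n 9 1) (*-monoʳ-≤ 10 (m^n>0 2 s))) (price≤ s) ⟩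
    10 * 2 ^ s + 10 * 2 ^ s         ≡⟨ lem′ (2 ^ s) ⟩
    10 * (2 * 2 ^ s)                ∎
    where
    open ≤-Reasoning
    lem : ∀ s → 3 + (9 * (1 + s) + 7) ≡ 9 + (3 + (9 * s + 7))
    lem = ℕ-Ring.solve-∀
    lem′ : ∀ x → 10 * x + 10 * x ≡ 10 * (2 * x)
    lem′ = ℕ-Ring.solve-∀

  costRate : ℕ → ℕ
  costRate i = 120 * (2 ^ N * 2 ^ Λ) * 2 ^ (3 * i)

  costRate-double : ∀ i → 2 * costRate i ≤ costRate (suc i)
  costRate-double i = begin
    2 * (120 * (2 ^ N * 2 ^ Λ) * 2 ^ (3 * i))     ≡⟨ lem (120 * (2 ^ N * 2 ^ Λ)) (2 ^ (3 * i)) ⟩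
    120 * (2 ^ N * 2 ^ Λ) * (2 * 2 ^ (3 * i))     ≤⟨ *-monoʳ-≤ (120 * (2 ^ N * 2 ^ Λ)) (*-monoˡ-≤ (2 ^ (3 * i)) (m≤m+n 2 6)) ⟩
    120 * (2 ^ N * 2 ^ Λ) * (8 * 2 ^ (3 * i))     ≡⟨ cong (120 * (2 ^ N * 2 ^ Λ) *_) (trans (2^-+ 3 (3 * i)) (cong (2 ^_) (sym (*-suc 3 i)))) ⟩
    120 * (2 ^ N * 2 ^ Λ) * 2 ^ (3 * suc i)       ∎
    where
    open ≤-Reasoning
    lem : ∀ a b → 2 * (a * b) ≡ a * (2 * b)
    lem = ℕ-Ring.solve-∀

  test-cost : ∀ b → Block.level b ≤ Λ →
    2 ^ (12 * Λ + 16) * ((3 + excess b) * Σₗ (λ x → ∣ key b x ∣) (colourings A)) ≤ β (Block.level b) * costRate (Block.level b)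
  test-cost b i≤Λ = begin
    M * ((3 + excess b) * K)                                  ≡⟨ lem₁ M (3 + excess b) K ⟩
    (3 + excess b) * (M * K)                                  ≤⟨ *-mono-≤ (price≤ (Λ ∸ i)) (key-moment b) ⟩
    10 * 2 ^ (Λ ∸ i) * (12 * (2 ^ N * 2 ^ (12 * i)))          ≡⟨ lem₂ (2 ^ (Λ ∸ i)) (2 ^ N) (2 ^ (12 * i)) ⟩
    120 * (2 ^ N * (2 ^ (Λ ∸ i) * 2 ^ (12 * i)))              ≡⟨ cong (λ z → 120 * (2 ^ N * z)) powers ⟩
    120 * (2 ^ N * (2 ^ Λ * (2 ^ (8 * i) * 2 ^ (3 * i))))     ≡⟨ lem₃ (2 ^ N) (2 ^ Λ) (2 ^ (8 * i)) (2 ^ (3 * i)) ⟩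
    2 ^ (8 * i) * costRate i                                  ≡⟨ cong (_* costRate i) (β≡ i) ⟨
    β i * costRate i                                          ∎
    where
    open ≤-Reasoning
    i = Block.level b
    M = 2 ^ (12 * Λ + 16)
    K = Σₗ (λ x → ∣ key b x ∣) (colourings A)
    lem₁ : ∀ a b c → a * (b * c) ≡ b * (a * c)
    lem₁ = ℕ-Ring.solve-∀
    lem₂ : ∀ x n y → 10 * x * (12 * (n * y)) ≡ 120 * (n * (x * y))
    lem₂ = ℕ-Ring.solve-∀
    lem₃ : ∀ n l b c → 120 * (n * (l * (b * c))) ≡ b * (120 * (n * l) * c)
    lem₃ = ℕ-Ring.solve-∀
    powers : 2 ^ (Λ ∸ i) * 2 ^ (12 * i) ≡ 2 ^ Λ * (2 ^ (8 * i) * 2 ^ (3 * i))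
    powers = trans (2^-+ (Λ ∸ i) (12 * i)) (trans (cong (2 ^_) (trans (lem (Λ ∸ i) i) (cong (_+ (8 * i + 3 * i)) (m∸n+n≡m i≤Λ))))
      (trans (sym (2^-+ Λ (8 * i + 3 * i))) (cong (2 ^ Λ *_) (sym (2^-+ (8 * i) (3 * i))))))
      where
      lem : ∀ s i → s + 12 * i ≡ s + i + (8 * i + 3 * i)
      lem = ℕ-Ring.solve-∀

  module Big (16≤N : 16 ≤ N) where

    1≤h : 1 ≤ h
    1≤h = /-monoˡ-≤ 16 16≤N

    N<16+16h : N < 16 + h * 16
    N<16+16h = ≤-<-trans (≤-reflexive (m≡m%n+[m/n]*n N 16)) (+-monoˡ-< (h * 16) (m%n<n N 16))

    N≤32h : N ≤ 32 * h
    N≤32h = begin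
      N                ≤⟨ <⇒≤ N<16+16h ⟩
      16 * 1 + h * 16  ≤⟨ +-monoˡ-≤ (h * 16) (*-monoʳ-≤ 16 1≤h) ⟩
      16 * h + h * 16  ≡⟨ lem h ⟩
      32 * h           ∎
      where
      open ≤-Reasoning
      lem : ∀ h → 16 * h + h * 16 ≡ 32 * h
      lem = ℕ-Ring.solve-∀

    τ-total : 2 * Σₗ τ tests ≤ T * h
    τ-total = begin
      2 * Σₗ τ tests                          ≤⟨ *-monoʳ-≤ 2 (tests-sum τ (2 ^_) (λ i → ≤-refl) (λ b _ → τ≤ b)) ⟩
      2 * (β Λ * (2 * N * (2 * 2 ^ L)))       ≤⟨ *-monoʳ-≤ 2 (*-monoʳ-≤ (β Λ) (*-mono-≤ (*-monoʳ-≤ 2 N≤32h) (*-monoʳ-≤ 2 (^-monoʳ-≤ 2 L≤Λ)))) ⟩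
      2 * (β Λ * (2 * (32 * h) * (2 * 2 ^ Λ))) ≡⟨ lem (β Λ) h (2 ^ Λ) ⟩
      256 * (β Λ * 2 ^ Λ) * h                 ≡⟨ cong (λ z → 256 * z * h) (trans (cong (_* 2 ^ Λ) (β≡ Λ)) (trans (2^-+ (8 * Λ) Λ) (cong (2 ^_) (lem′ Λ)))) ⟩
      256 * 2 ^ (9 * Λ) * h                   ≡⟨ cong (_* h) (trans (*-comm 256 (2 ^ (9 * Λ))) (2^-+ (9 * Λ) 8)) ⟩
      T * h                                   ∎
      where
      open ≤-Reasoning
      lem : ∀ b h l → 2 * (b * (2 * (32 * h) * (2 * l))) ≡ 256 * (b * l) * h
      lem = ℕ-Ring.solve-∀
      lem′ : ∀ l → 8 * l + l ≡ 9 * l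
      lem′ = ℕ-Ring.solve-∀
      τ≤ : ∀ b → τ b ≤ β (Block.level b) * 2 ^ Block.level b
      τ≤ b = ≤-trans (^-monoʳ-≤ 2 (*-monoʳ-≤ 9 (≤-trans (≤-reflexive (m∸[m∸n]≡m⊓n Λ i)) (m⊓n≤n Λ i))))
        (≤-reflexive (trans (cong (2 ^_) (sym (lem′ i))) (trans (sym (2^-+ (8 * i) i)) (cong (_* 2 ^ i) (sym (β≡ i))))))
        where
        i = Block.level b
        m∸[m∸n]≡m⊓n : ∀ m n → m ∸ (m ∸ n) ≡ m ⊓ n
        m∸[m∸n]≡m⊓n m n with ≤-total m n
        ... | inj₁ m≤n = trans (cong (m ∸_) (m≤n⇒m∸n≡0 m≤n)) (sym (m≤n⇒m⊓n≡m m≤n))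
        ... | inj₂ n≤m = trans (m∸[m∸n]≡n n≤m) (sym (m≥n⇒m⊓n≡n n≤m))

    cost-total : Σₗ (cost tests) (colourings A) ≤ length (colourings A) * h
    cost-total = *-cancelˡ-≤ M {{m^n≢0 2 (12 * Λ + 16)}} (begin
      M * Σₗ (cost tests) (colourings A)
        ≡⟨ cong (M *_) (Σₗ-cost (colourings A)) ⟩
      M * Σₗ (λ b → (3 + excess b) * Σₗ (λ x → ∣ key b x ∣) (colourings A)) tests
        ≡⟨ Σₗ-*ˡ M _ tests ⟨
      Σₗ (λ b → M * ((3 + excess b) * Σₗ (λ x → ∣ key b x ∣) (colourings A))) tests
        ≤⟨ tests-sum _ costRate costRate-double test-cost ⟩
      β Λ * (2 * N * (2 * costRate L))
        ≤⟨ *-monoʳ-≤ (β Λ) (*-mono-≤ (*-monoʳ-≤ 2 N≤32h) (*-monoʳ-≤ 2 (*-monoʳ-≤ (120 * (2 ^ N * 2 ^ Λ)) (^-monoʳ-≤ 2 (*-monoʳ-≤ 3 L≤Λ))))) ⟩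
      β Λ * (2 * (32 * h) * (2 * costRate Λ))
        ≡⟨ lem₁ 2 32 120 (β Λ) h (2 ^ N) (2 ^ Λ) (2 ^ (3 * Λ)) ⟩
      15360 * (β Λ * (2 ^ Λ * 2 ^ (3 * Λ)) * (2 ^ N * h))
        -- 15360 = 2 · 32 · 2 · 120 collects the constants, while 65536 is the fourth power of the
        -- factor 2^4 in Δ, which is there for this comparison.
        ≤⟨ *-monoˡ-≤ (β Λ * (2 ^ Λ * 2 ^ (3 * Λ)) * (2 ^ N * h)) (toWitness {a? = 15360 ≤? 65536} _) ⟩
      65536 * (β Λ * (2 ^ Λ * 2 ^ (3 * Λ)) * (2 ^ N * h))
        ≡⟨ *-assoc 65536 (β Λ * (2 ^ Λ * 2 ^ (3 * Λ))) (2 ^ N * h) ⟨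
      65536 * (β Λ * (2 ^ Λ * 2 ^ (3 * Λ))) * (2 ^ N * h)
        ≡⟨ cong₂ (λ y z → y * (z * h)) powers (sym (length-colourings A)) ⟩
      M * (length (colourings A) * h) ∎)
      where
      open ≤-Reasoning
      M = 2 ^ (12 * Λ + 16)
      lem₁ : ∀ u v w b h n l c → b * (u * (v * h) * (u * (w * (n * l) * c))) ≡ u * v * u * w * (b * (l * c) * (n * h))
      lem₁ = ℕ-Ring.solve-∀
      lem₂ : ∀ l → 8 * l + (l + 3 * l) ≡ 12 * l
      lem₂ = ℕ-Ring.solve-∀
      powers : 65536 * (β Λ * (2 ^ Λ * 2 ^ (3 * Λ))) ≡ M
      powers = trans (cong (65536 *_) (trans (cong₂ _*_ (β≡ Λ) (2^-+ Λ (3 * Λ)))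
        (trans (2^-+ (8 * Λ) (Λ + 3 * Λ)) (cong (2 ^_) (lem₂ Λ))))) (trans (*-comm 65536 (2 ^ (12 * Λ))) (2^-+ (12 * Λ) 16))

    module F = CommonFibre (commonFibre tests (colourings A))

    fibre-large : 2 ^ N ≤ 2 ^ (h + h) * length F.fibre
    fibre-large = ≤-trans (≤-reflexive (sym (length-colourings A))) (largeFibre key excess S key≤S T τ τ-def tests (colourings A) h τ-total cost-total)

    -- Here 32 = 4 · 8: the fibre may have lost a factor 2^(2h), and a Hamming ball of radius h
    -- costs 8^h. Since h is N / 16, everything reduces to 32 · 9^16 < 16^16; the remainder of N is
    -- harmless because 9 ≤ 16.
    32^h*9^N<16^N : 32 ^ h * 9 ^ N < 16 ^ N
    32^h*9^N<16^N = begin-strict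
      32 ^ h * 9 ^ N                              ≡⟨ cong (λ z → 32 ^ h * 9 ^ z) N≡ ⟩
      32 ^ h * 9 ^ (r + 16 * h)                   ≡⟨ cong (32 ^ h *_) (trans (^-distribˡ-+-* 9 r (16 * h)) (cong (9 ^ r *_) (sym (^-*-assoc 9 16 h)))) ⟩
      32 ^ h * (9 ^ r * (9 ^ 16) ^ h)             ≡⟨ lem (32 ^ h) (9 ^ r) ((9 ^ 16) ^ h) ⟩
      9 ^ r * (32 ^ h * (9 ^ 16) ^ h)             ≡⟨ cong (9 ^ r *_) (sym ([a*b]^n 32 (9 ^ 16) h)) ⟩
      9 ^ r * (32 * 9 ^ 16) ^ h                   <⟨ *-monoʳ-< (9 ^ r) {{m^n≢0 9 r}} (^-monoˡ-< h {{>-nonZero 1≤h}} (toWitness {a? = 32 * 9 ^ 16 <? 16 ^ 16} _)) ⟩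
      9 ^ r * (16 ^ 16) ^ h                       ≤⟨ *-monoˡ-≤ ((16 ^ 16) ^ h) (^-monoˡ-≤ r (m≤m+n 9 7)) ⟩
      16 ^ r * (16 ^ 16) ^ h                      ≡⟨ cong (16 ^ r *_) (^-*-assoc 16 16 h) ⟩
      16 ^ r * 16 ^ (16 * h)                      ≡⟨ ^-distribˡ-+-* 16 r (16 * h) ⟨
      16 ^ (r + 16 * h)                           ≡⟨ cong (16 ^_) (sym N≡) ⟩
      16 ^ N                                      ∎
      where
      open ≤-Reasoning
      r = N % 16
      N≡ : N ≡ r + 16 * h
      N≡ = trans (m≡m%n+[m/n]*n N 16) (cong (r +_) (*-comm h 16))
      lem : ∀ a b c → a * (b * c) ≡ b * (a * c)
      lem = ℕ-Ring.solve-∀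

    fibre-spread : 8 ^ h * 9 ^ N < length F.fibre * 8 ^ N
    fibre-spread = *-cancelˡ-< (2 ^ (h + h)) _ _ (begin-strict
      2 ^ (h + h) * (8 ^ h * 9 ^ N)               ≡⟨ cong (_* (8 ^ h * 9 ^ N)) (trans (sym (2^-+ h h)) (sym ([a*b]^n 2 2 h))) ⟩
      4 ^ h * (8 ^ h * 9 ^ N)                     ≡⟨ *-assoc (4 ^ h) (8 ^ h) (9 ^ N) ⟨
      4 ^ h * 8 ^ h * 9 ^ N                       ≡⟨ cong (_* 9 ^ N) (sym ([a*b]^n 4 8 h)) ⟩
      32 ^ h * 9 ^ N                              <⟨ 32^h*9^N<16^N ⟩
      16 ^ N                                      ≡⟨ [a*b]^n 2 8 N ⟩
      2 ^ N * 8 ^ N                               ≤⟨ *-monoˡ-≤ (8 ^ N) fibre-large ⟩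
      2 ^ (h + h) * length F.fibre * 8 ^ N        ≡⟨ *-assoc (2 ^ (h + h)) (length F.fibre) (8 ^ N) ⟩
      2 ^ (h + h) * (length F.fibre * 8 ^ N)      ∎)
      where open ≤-Reasoning

  record Partial : Set where
    field
      x y      : Vec Bool n
      progress : 16 * size (same A x y) ≤ 15 * size A
      balanced : ∀ g → g ∈ lists → ∀ ys zs → proj₁ g ≡ ys ++ zs → ∣ eval (diff A x y) x ys ∣ ≤ 2 ^ (3 * Λ + L + 13)

  far⇒partial : (16≤N : 16 ≤ N) → ∀ x y → x ∈ Big.F.fibre 16≤N → y ∈ Big.F.fibre 16≤N → h < size (diff A x y) → Partial
  far⇒partial 16≤N x y x∈ y∈ far = record { x = x ; y = y ; progress = progress ; balanced = balanced }
    where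
    open Big 16≤N
    open ≤-Reasoning
    progress : 16 * size (same A x y) ≤ 15 * N
    progress = +-cancelˡ-≤ N _ _ (begin
      N + 16 * size (same A x y)                            ≤⟨ +-monoˡ-≤ (16 * size (same A x y)) (<⇒≤ N<16+16h) ⟩
      16 + h * 16 + 16 * size (same A x y)                  ≡⟨ lem₁ h (size (same A x y)) ⟩
      16 * (suc h + size (same A x y))                      ≤⟨ *-monoʳ-≤ 16 (+-monoˡ-≤ (size (same A x y)) far) ⟩
      16 * (size (diff A x y) + size (same A x y))          ≡⟨ cong (16 *_) (size-diff-same A x y) ⟩
      16 * N                                                ≡⟨ lem₂ N ⟩
      N + 15 * N                                            ∎)
      where
      lem₁ : ∀ h s → 16 + h * 16 + 16 * s ≡ 16 * ((1 + h) + s)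
      lem₁ = ℕ-Ring.solve-∀
      lem₂ : ∀ N → 16 * N ≡ N + 15 * N
      lem₂ = ℕ-Ring.solve-∀
    -- x and y share every key, so their block sums differ by at most 2Δ; this difference is twice
    -- the sum on `diff A x y`.
    test-small : ∀ b → b ∈ tests → ∣ eval (diff A x y) x (Block.lits b) ∣ ≤ Δ (Block.level b)
    test-small b b∈ = *-cancelˡ-≤ 2 (begin
      2 * ∣ eval (diff A x y) x ℓ ∣            ≡⟨ ℤₚ.abs-* (pos 2) (eval (diff A x y) x ℓ) ⟨
      ∣ pos 2 *ℤ eval (diff A x y) x ℓ ∣       ≡⟨ cong ∣_∣ (sym (eval-diff A x y ℓ)) ⟩
      ∣ eval A x ℓ -ℤ eval A y ℓ ∣               ≤⟨ truncQuot-close (Δ i) (eval A x ℓ) (eval A y ℓ) (trans (All.lookup same-key x∈) (sym (All.lookup same-key y∈))) ⟩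
      Δ i + Δ i                              ≡⟨ cong (Δ i +_) (sym (+-identityʳ (Δ i))) ⟩
      2 * Δ i                                ∎)
      where
      ℓ = Block.lits b
      i = Block.level b
      same-key = proj₂ (All.lookup F.constant b∈)
    balanced : ∀ g → g ∈ lists → ∀ ys zs → proj₁ g ≡ ys ++ zs → ∣ eval (diff A x y) x ys ∣ ≤ 2 ^ (3 * Λ + L + 13)
    balanced g g∈ ys zs eq = begin
      ∣ eval D x ys ∣                                    ≡⟨ cong ∣_∣ (eval-restrict A D x (diff⊆ A x y) ys) ⟨
      ∣ eval D x (restrict A ys) ∣                       ≡⟨ cong (λ w → ∣ eval D x w ∣) (sym take≡) ⟩
      ∣ eval D x (take z (alive g)) ∣                    ≤⟨ P.prefix (≤-<-trans (length-alive g) short) z z≤ ⟩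
      255 * Δ (suc L)                                  ≤⟨ *-monoˡ-≤ (Δ (suc L)) (n≤1+n 255) ⟩
      256 * Δ (suc L)                                  ≡⟨ trans (*-comm 256 (Δ (suc L))) (trans (2^-+ (3 * Λ + suc L + 4) 8) (cong (2 ^_) (lem Λ L))) ⟩
      2 ^ (3 * Λ + L + 13)                             ∎
      where
      D = diff A x y
      -- A prefix `ys` of the list restricts to a prefix of its live part, of this length.
      z = length (restrict A ys)
      alive≡ : alive g ≡ restrict A ys ++ restrict A zs
      alive≡ = trans (cong (restrict A) eq) (restrict-++ A ys zs)
      take≡ : take z (alive g) ≡ restrict A ys
      take≡ = trans (cong (take z) alive≡) (take-length-++ (restrict A ys) (restrict A zs))
      z≤ : z ≤ length (alive g)
      z≤ = ≤-trans (m≤m+n z (length (restrict A zs))) (≤-reflexive (sym (trans (cong length alive≡) (length-++ (restrict A ys)))))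
      lem : ∀ Λ L → 3 * Λ + (1 + L) + 4 + 8 ≡ 3 * Λ + L + 13
      lem = ℕ-Ring.solve-∀
      block-small : ∀ i j → i ≤ L → j < length (alive g) / β i → ∣ eval D x (Block.lits (B.block g i j)) ∣ ≤ Δ i
      block-small i j i≤L j< = test-small (B.block g i j)
        (∈-concatMap⁺ (λ g → B.blocksUpTo g L) (Any.map (λ { refl → B.block∈ g L i j i≤L j< }) g∈))
      module P = B.Prefix g (eval D x) (eval-++ D x) refl Δ Δ-suc L
        block-small

  partial-big : 16 ≤ N → Partial
  partial-big 16≤N =
    let x , y , x∈ , y∈ , far = far-pair A F.fibre h F.⊆-Σₗ fibre-spread in far⇒partial 16≤N x y x∈ y∈ far
    where open Big 16≤N

  -- Below 16 live positions h is 0, which leaves no budget for the tests. The two constant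
  -- colourings differ everywhere, so all of A is coloured at once, at a cost of at most 2N ≤ 32.
  partial-small : N < 16 → Partial
  partial-small N<16 = record
    { x = replicate n true ; y = replicate n false
    ; progress = ≤-trans (≤-reflexive (cong (16 *_) same≡0)) z≤n
    ; balanced = balanced }
    where
    open ≤-Reasoning
    diff≡ : ∀ {m} (B : Vec Bool m) → diff B (replicate m true) (replicate m false) ≡ B
    diff≡ []          = refl
    diff≡ (true ∷ B)  = cong (true ∷_) (diff≡ B)
    diff≡ (false ∷ B) = cong (false ∷_) (diff≡ B)
    same≡0 : size (same A (replicate n true) (replicate n false)) ≡ 0
    same≡0 = +-cancelˡ-≡ N _ _ (trans (cong (λ D → size D + size (same A (replicate n true) (replicate n false))) (sym (diff≡ A)))
      (trans (size-diff-same A (replicate n true) (replicate n false)) (sym (+-identityʳ N))))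
    balanced : ∀ g → g ∈ lists → ∀ ys zs → proj₁ g ≡ ys ++ zs →
      ∣ eval (diff A (replicate n true) (replicate n false)) (replicate n true) ys ∣ ≤ 2 ^ (3 * Λ + L + 13)
    balanced g g∈ ys zs eq = begin
      ∣ eval (diff A _ _) 𝟙 ys ∣             ≡⟨ cong (λ D → ∣ eval D 𝟙 ys ∣) (diff≡ A) ⟩
      ∣ eval A 𝟙 ys ∣                        ≤⟨ ∣eval-prefix∣ A 𝟙 g ys zs eq ⟩
      2 * N                                ≤⟨ *-monoʳ-≤ 2 (<⇒≤ N<16) ⟩
      32                                   ≤⟨ ^-monoʳ-≤ 2 {5} (≤-trans (m≤m+n 5 8) (m≤n+m 13 (3 * Λ + L))) ⟩
      2 ^ (3 * Λ + L + 13)                 ∎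
      where
      𝟙 = replicate n true

  partialColouring : Partial
  partialColouring with 16 ≤? N
  ... | yes 16≤N = partial-big 16≤N
  ... | no  16≰N = partial-small (≰⇒> 16≰N)

-- Iterating partial colourings

opaque
  -- Enough rounds for (15/16)^stages ≤ 1/256, after which the live positions fit one level lower.
  stages : ℕ
  stages = 88

  stages-suffice : 256 * 15 ^ stages ≤ 16 ^ stages
  stages-suffice = toWitness {a? = 256 * 15 ^ 88 ≤? 16 ^ 88} _

module Iterate {n : ℕ} (Λ : ℕ) (lists : List (GoodList n)) (few : length lists ≤ β Λ) where

  Balanced : Vec Bool n → ℕ → Set
  Balanced A B = ∃ λ x → ∀ g → g ∈ lists → ∀ ys zs → proj₁ g ≡ ys ++ zs → ∣ eval A x ys ∣ ≤ B

  -- j rounds remain at level L, and `stages` further ones are held in reserve for all lower levels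
  -- together: costs halve from level to level, so (stages + stages) · 2^L is stages · 2^(L+1).
  balance : ∀ L j → L ≤ Λ → (A : Vec Bool n) → 2 * size A < β (suc L) → 2 * size A * 15 ^ j < β L * 16 ^ j →
    Balanced A ((j + stages) * 2 ^ (3 * Λ + L + 13))
  -- No position is live any more; `A` merely supplies a vector of the right length.
  balance zero zero L≤Λ A _ small = A , λ g g∈ ys zs eq → ≤-trans (∣eval-prefix∣ A A g ys zs eq)
    (≤-trans (≤-pred (subst (2 * size A <_) β-zero (subst₂ _<_ (*-identityʳ _) (*-identityʳ _) small))) z≤n)
  balance (suc L) zero L≤Λ A _ small = proj₁ rec , λ g g∈ ys zs eq → ≤-trans (proj₂ rec g g∈ ys zs eq) (≤-reflexive (begin-equality
    (stages + stages) * 2 ^ (3 * Λ + L + 13)      ≡⟨ lem stages (2 ^ (3 * Λ + L + 13)) ⟩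
    stages * (2 * 2 ^ (3 * Λ + L + 13))           ≡⟨ cong (λ z → stages * 2 ^ (z + 13)) (sym (+-suc (3 * Λ) L)) ⟩
    stages * 2 ^ (3 * Λ + suc L + 13)             ∎))
    where
    open ≤-Reasoning
    lem : ∀ a b → (a + a) * b ≡ a * (2 * b)
    lem = ℕ-Ring.solve-∀
    small′ : 2 * size A < β (suc L)
    small′ = subst₂ _<_ (*-identityʳ _) (*-identityʳ _) small
    rec : Balanced A ((stages + stages) * 2 ^ (3 * Λ + L + 13))
    rec = balance L stages (<⇒≤ L≤Λ) A small′ (begin-strict
      2 * size A * 15 ^ stages         <⟨ *-monoˡ-< (15 ^ stages) {{m^n≢0 15 stages}} small′ ⟩
      β (suc L) * 15 ^ stages          ≡⟨ cong (_* 15 ^ stages) (trans (β-suc L) (*-comm 256 (β L))) ⟩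
      β L * 256 * 15 ^ stages          ≡⟨ *-assoc (β L) 256 (15 ^ stages) ⟩
      β L * (256 * 15 ^ stages)        ≤⟨ *-monoʳ-≤ (β L) stages-suffice ⟩
      β L * 16 ^ stages                ∎)
  balance L (suc j) L≤Λ A short small = merge (diff A x y) x (proj₁ rec) , λ g g∈ ys zs eq → begin
    ∣ eval A (merge (diff A x y) x (proj₁ rec)) ys ∣                      ≡⟨ cong ∣_∣ (eval-merge A x y (proj₁ rec) ys) ⟩
    ∣ eval (diff A x y) x ys +ℤ eval (same A x y) (proj₁ rec) ys ∣          ≤⟨ ℤₚ.∣i+j∣≤∣i∣+∣j∣ (eval (diff A x y) x ys) _ ⟩
    ∣ eval (diff A x y) x ys ∣ + ∣ eval (same A x y) (proj₁ rec) ys ∣       ≤⟨ +-mono-≤ (balanced g g∈ ys zs eq) (proj₂ rec g g∈ ys zs eq) ⟩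
    (suc j + stages) * 2 ^ (3 * Λ + L + 13)                             ∎
    where
    open ≤-Reasoning
    open Stage.Partial (Stage.partialColouring Λ L L≤Λ A lists few short)
    size′≤ : size (same A x y) ≤ size A
    size′≤ = ≤-trans (m≤n+m _ (size (diff A x y))) (≤-reflexive (size-diff-same A x y))
    lem₁ : ∀ s p → 2 * s * p * 16 ≡ 2 * (16 * s) * p
    lem₁ = ℕ-Ring.solve-∀
    lem₂ : ∀ s p → 2 * (15 * s) * p ≡ 2 * s * (15 * p)
    lem₂ = ℕ-Ring.solve-∀
    lem₃ : ∀ b p → b * (16 * p) ≡ b * p * 16
    lem₃ = ℕ-Ring.solve-∀
    rec : Balanced (same A x y) ((j + stages) * 2 ^ (3 * Λ + L + 13))
    rec = balance L j L≤Λ (same A x y) (≤-<-trans (*-monoʳ-≤ 2 size′≤) short) (*-cancelʳ-< 16 _ _ (begin-strict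
      2 * size (same A x y) * 15 ^ j * 16      ≡⟨ lem₁ (size (same A x y)) (15 ^ j) ⟩
      2 * (16 * size (same A x y)) * 15 ^ j    ≤⟨ *-monoˡ-≤ (15 ^ j) (*-monoʳ-≤ 2 progress) ⟩
      2 * (15 * size A) * 15 ^ j               ≡⟨ lem₂ (size A) (15 ^ j) ⟩
      2 * size A * 15 ^ suc j                  <⟨ small ⟩
      β L * 16 ^ suc j                         ≡⟨ lem₃ (β L) (16 ^ j) ⟩
      β L * 16 ^ j * 16                        ∎))

opaque
  K₀ : ℕ
  K₀ = (stages + stages) * 2 ^ 13

  K₀≡ : K₀ ≡ (stages + stages) * 2 ^ 13
  K₀≡ = refl

size-full : ∀ n → size (replicate n true) ≡ n
size-full zero    = refl
size-full (suc n) = cong suc (size-full n)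

-- 2^(4Λ) is the square root of β Λ, so the error is of square-root order without a logarithm.
balancedColouring : ∀ {n} Λ (lists : List (GoodList n)) → length lists ≤ β Λ → n ≤ β Λ →
  ∃ λ x → ∀ g → g ∈ lists → ∀ ys zs → proj₁ g ≡ ys ++ zs → ∣ eval (replicate n true) x ys ∣ ≤ K₀ * 2 ^ (4 * Λ)
balancedColouring {n} Λ lists few n≤ = proj₁ colouring , λ g g∈ ys zs eq → ≤-trans (proj₂ colouring g g∈ ys zs eq) (≤-reflexive (begin-equality
  (stages + stages) * 2 ^ (3 * Λ + Λ + 13)          ≡⟨ cong ((stages + stages) *_) (trans (sym (2^-+ (3 * Λ + Λ) 13)) (*-comm (2 ^ (3 * Λ + Λ)) (2 ^ 13))) ⟩
  (stages + stages) * (2 ^ 13 * 2 ^ (3 * Λ + Λ))    ≡⟨ *-assoc (stages + stages) (2 ^ 13) _ ⟨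
  (stages + stages) * 2 ^ 13 * 2 ^ (3 * Λ + Λ)      ≡⟨ cong₂ (λ y z → y * 2 ^ z) (sym K₀≡) (lem Λ) ⟩
  K₀ * 2 ^ (4 * Λ)                                  ∎))
  where
  open ≤-Reasoning
  lem : ∀ Λ → 3 * Λ + Λ ≡ 4 * Λ
  lem = ℕ-Ring.solve-∀
  A = replicate n true
  short : 2 * size A < β (suc Λ)
  short = begin-strict
    2 * size A     ≡⟨ cong (2 *_) (size-full n) ⟩
    2 * n          ≤⟨ *-monoʳ-≤ 2 n≤ ⟩
    2 * β Λ        <⟨ *-monoˡ-< (β Λ) (toWitness {a? = 3 ≤? 256} _) ⟩
    256 * β Λ      ≡⟨ β-suc Λ ⟨
    β (suc Λ)      ∎
  colouring = Iterate.balance Λ lists few Λ stages ≤-refl A short (begin-strict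
    2 * size A * 15 ^ stages         <⟨ *-monoˡ-< (15 ^ stages) {{m^n≢0 15 stages}} short ⟩
    β (suc Λ) * 15 ^ stages          ≡⟨ cong (_* 15 ^ stages) (trans (β-suc Λ) (*-comm 256 (β Λ))) ⟩
    β Λ * 256 * 15 ^ stages          ≡⟨ *-assoc (β Λ) 256 (15 ^ stages) ⟩
    β Λ * (256 * 15 ^ stages)        ≤⟨ *-monoʳ-≤ (β Λ) stages-suffice ⟩
    β Λ * 16 ^ stages                ∎)

-- Progressions in ℤ/p^e

parity : ℕ → Bool
parity zero          = true
parity (suc zero)    = false
parity (suc (suc n)) = parity n

parity-double : ∀ c → parity (c + c) ≡ true × parity (suc (c + c)) ≡ false
parity-double zero    = refl , refl
parity-double (suc c) rewrite +-suc c c = parity-double c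

half-double : ∀ c → ⌊ c + c /2⌋ ≡ c × ⌊ suc (c + c) /2⌋ ≡ c
half-double zero    = refl , refl
half-double (suc c) rewrite +-suc c c = cong suc (proj₁ (half-double c)) , cong suc (proj₂ (half-double c))

∑-alternating : ∀ m (H : ℕ → ℤ) → (∀ c → H (c + c) +ℤ H (suc (c + c)) ≡ pos 0) → (∀ z → ∣ H z ∣ ≤ 1) → ∣ ∑ m H ∣ ≤ 1
∑-alternating zero          H alt H≤1 = z≤n
∑-alternating (suc zero)    H alt H≤1 = ≤-trans (≤-reflexive (cong ∣_∣ (ℤₚ.+-identityʳ (H 0)))) (H≤1 0)
∑-alternating (suc (suc m)) H alt H≤1 = ≤-trans (≤-reflexive (cong ∣_∣ (trans (sym (ℤₚ.+-assoc (H 0) (H 1) _))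
    (trans (cong (_+ℤ ∑ m (λ z → H (suc (suc z)))) (alt 0)) (ℤₚ.+-identityˡ (∑ m (λ z → H (suc (suc z)))))))))
  (∑-alternating m (λ z → H (suc (suc z))) (λ c → trans (cong₂ (λ a b → H (suc a) +ℤ H (suc (suc b))) (sym (+-suc c c)) (sym (+-suc c c))) (alt (suc c)))
    (λ z → H≤1 (suc (suc z))))

∑-interval : ∀ b m (H : ℕ → ℤ) B → (∀ k → k ≤ b + m → ∣ ∑ k H ∣ ≤ B) → ∣ ∑ m (λ z → H (b + z)) ∣ ≤ B + B
∑-interval b m H B prefix = ≤-trans (≤-reflexive (cong ∣_∣ (trans (lem (∑ b H) _) (cong (_-ℤ ∑ b H) (sym (∑-split b m H))))))
  (≤-trans (ℤₚ.∣i-j∣≤∣i∣+∣j∣ (∑ (b + m) H) (∑ b H)) (+-mono-≤ (prefix (b + m) ≤-refl) (prefix b (m≤m+n b m))))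
  where
  lem : ∀ a b → b ≡ (a +ℤ b) -ℤ a
  lem = ℤ-Ring.solve-∀

∑-halves : ∀ m (φ : ℕ → ℤ) → ∑ (m + m) (λ z → φ ⌊ z /2⌋) ≡ ∑ m φ +ℤ ∑ m φ
∑-halves zero    φ = refl
∑-halves (suc m) φ rewrite +-suc m m = trans (cong (λ z → φ 0 +ℤ (φ 0 +ℤ z)) (∑-halves m (φ ∘ suc))) (lem (φ 0) (∑ m (φ ∘ suc)))
  where
  lem : ∀ a b → a +ℤ (a +ℤ (b +ℤ b)) ≡ (a +ℤ b) +ℤ (a +ℤ b)
  lem = ℤ-Ring.solve-∀

module Digits (p : ℕ) {{p≢0 : NonZero p}} where

  -- Digit reversal in base p: it maps every residue class mod p^j onto an interval.
  rev : ℕ → ℕ → ℕ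
  rev zero    x = 0
  rev (suc m) x = (x % p) * p ^ m + rev m (x / p)

  /-+* : ∀ x y → (x + p * y) / p ≡ x / p + y
  /-+* x y = trans (+-distrib-/-∣ʳ x {p * y} {p} (m∣m*n y)) (cong (x / p +_) (trans (cong (_/ p) (*-comm p y)) (m*n/n≡m y p)))

  %-+* : ∀ x y → (x + p * y) % p ≡ x % p
  %-+* x y = trans (cong (λ z → (x + z) % p) (*-comm p y)) ([m+kn]%n≡m%n x y p)

  rev-+* : ∀ m x y → rev (suc m) (x + p * y) ≡ (x % p) * p ^ m + rev m (x / p + y)
  rev-+* m x y = cong₂ (λ a b → a * p ^ m + rev m b) (%-+* x y) (/-+* x y)

  rev-digit : ∀ m c y → c < p → rev (suc m) (c + p * y) ≡ c * p ^ m + rev m y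
  rev-digit m c y c<p = trans (rev-+* m c y) (cong₂ (λ a b → a * p ^ m + rev m (b + y)) (m<n⇒m%n≡m c<p) (m<n⇒m/n≡0 c<p))

  rev-periodic : ∀ m x → rev m (x + p ^ m) ≡ rev m x
  rev-periodic zero    x = refl
  rev-periodic (suc m) x = trans (rev-+* m x (p ^ m)) (cong (λ z → (x % p) * p ^ m + z) (rev-periodic m (x / p)))

  -- Digit reversal permutes the residues; summing one digit at a time shows this without an
  -- explicit inverse.
  ∑-rev : ∀ m (g : ℕ → ℤ) → ∑ (p ^ m) (λ x → g (rev m x)) ≡ ∑ (p ^ m) g
  ∑-rev zero    g = refl
  ∑-rev (suc m) g = trans (∑-residues p (p ^ m) _) (trans
    (∑-cong< p (λ c c<p → trans (∑-cong (p ^ m) (λ y → cong g (rev-digit m c y c<p))) (∑-rev m (λ z → g (c * p ^ m + z)))))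
    (sym (∑-blocks p (p ^ m) g)))

  -- The low j digits, fixed within the class of c, become the leading ones and only shift the
  -- interval.
  rev-class : ∀ j m c → c < p ^ j → ∃ λ base → ∀ y → rev (j + m) (c + p ^ j * y) ≡ base + rev m y
  rev-class zero    m zero _ = 0 , λ y → cong (rev m) (+-identityʳ y)
  rev-class zero    m (suc c) (s≤s ())
  rev-class (suc j) m c c< = (c % p) * p ^ (j + m) + proj₁ ih , λ y → trans
      (cong (λ z → rev (suc j + m) (c + z)) (*-assoc p (p ^ j) y))
      (trans (rev-+* (j + m) c (p ^ j * y))
        (trans (cong ((c % p) * p ^ (j + m) +_) (proj₂ ih y)) (sym (+-assoc ((c % p) * p ^ (j + m)) (proj₁ ih) (rev m y)))))
    where
    ih = rev-class j m (c / p) (m<n*o⇒m/o<n (≤-trans c< (≤-reflexive (*-comm p (p ^ j)))))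

module Residues (p e : ℕ) (pp : Prime p) where

  instance
    p≢0 : NonZero p
    p≢0 = prime⇒nonZero pp

  q : ℕ
  q = p ^ e

  instance
    q≢0 : NonZero q
    q≢0 = m^n≢0 p e

  open Digits p

  variableOf : ℕ → Fin q
  variableOf c = fromℕ< (m%n<n c q)

  -- Positions 2c and 2c + 1 share the variable c with signs + and -. `Fin q` offers more variables
  -- than the roughly q/2 that occur, which spares a rounding.
  literal : ℕ → Lit q
  literal z = parity z , variableOf ⌊ z /2⌋

  -- gcd q d is a power p^j, and the cofactor d′ is invertible modulo p^(e∸j). For d = 0 this means
  -- j = e and modulus 1.
  record Difference (d : ℕ) : Set where
    field
      j d′ w  : ℕ
      j≤e     : j ≤ e
      gcd≡    : gcd q d ≡ p ^ j
      d≡      : d ≡ p ^ j * d′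
      inverse : _%_ (d′ * w) (p ^ (e ∸ j)) {{m^n≢0 p (e ∸ j)}} ≡ _%_ 1 (p ^ (e ∸ j)) {{m^n≢0 p (e ∸ j)}}

  difference : ∀ d → Difference d
  difference d with ∣p^m⇒≡p^j pp e (gcd[m,n]∣m q d) | gcd[m,n]∣n q d
  ... | j , j≤e , gcd≡ | divides d′ d≡ = record
    { j = j ; d′ = d′ ; w = proj₁ inv ; j≤e = j≤e ; gcd≡ = gcd≡
    ; d≡ = d≡p^j*d′ ; inverse = proj₂ inv }
    where
    M = p ^ (e ∸ j)
    instance
      M≢0 : NonZero M
      M≢0 = m^n≢0 p (e ∸ j)
    d≡p^j*d′ : d ≡ p ^ j * d′
    d≡p^j*d′ = trans d≡ (trans (*-comm d′ (gcd q d)) (cong (_* d′) gcd≡))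
    q≡ : q ≡ p ^ j * M
    q≡ = trans (cong (p ^_) (sym (m+[n∸m]≡n j≤e))) (^-distribˡ-+-* p j (e ∸ j))
    coprime : Coprime d′ M
    coprime = gcd≡1⇒coprime (trans (gcd-comm d′ M) (*-cancelˡ-≡ _ 1 (p ^ j) {{m^n≢0 p j}} (trans (c*gcd[m,n]≡gcd[cm,cn] (p ^ j) M d′)
      (trans (cong₂ gcd (sym q≡) (sym d≡p^j*d′)) (trans gcd≡ (sym (*-identityʳ (p ^ j))))))))
    inv = coprime⇒inverse d′ M coprime

  module Orbit {d : ℕ} (D : Difference d) where
    open Difference D public

    M : ℕ
    M = p ^ (e ∸ j)

    instance
      M≢0 : NonZero M
      M≢0 = m^n≢0 p (e ∸ j)

    q≡ : p ^ j * M ≡ q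
    q≡ = trans (sym (^-distribˡ-+-* p j (e ∸ j))) (cong (p ^_) (m+[n∸m]≡n j≤e))

    i*d : ∀ i → i * d ≡ p ^ j * (d′ * i)
    i*d i = trans (cong (i *_) d≡) (lem i (p ^ j) d′)
      where
      lem : ∀ i P d → i * (P * d) ≡ P * (d * i)
      lem = ℕ-Ring.solve-∀

    -- The cosets of the subgroup generated by d, each listed as a progression, one after the other.
    point : ℕ → ℕ
    point z = z / M + (z % M) * d

    point-block : ∀ c i → i < M → point (c * M + i) ≡ c + i * d
    point-block c i i<M = cong₂ (λ a b → a + b * d)
      (trans (cong (_/ M) (+-comm (c * M) i)) (trans (+-distrib-/-∣ʳ i {c * M} {M} (n∣m*n c)) (cong₂ _+_ (m<n⇒m/n≡0 i<M) (m*n/n≡m c M))))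
      (trans (cong (_% M) (+-comm (c * M) i)) (trans ([m+kn]%n≡m%n i c M) (m<n⇒m%n≡m i<M)))

    class-periodic : ∀ {Ψ} → Periodic q Ψ → ∀ c → Periodic M (λ y → Ψ (c + p ^ j * y))
    class-periodic {Ψ} per c y = trans (cong Ψ (trans (cong (c +_) (*-distribˡ-+ (p ^ j) y M))
      (trans (sym (+-assoc c (p ^ j * y) (p ^ j * M))) (cong (c + p ^ j * y +_) q≡)))) (per (c + p ^ j * y))

    ∑-class : ∀ {Ψ} → Periodic q Ψ → ∀ c → ∑ M (λ i → Ψ (c + i * d)) ≡ ∑ M (λ y → Ψ (c + p ^ j * y))
    ∑-class {Ψ} per c = trans (∑-cong M (λ i → cong (λ z → Ψ (c + z)) (i*d i))) (∑-unit M (class-periodic per c) d′ w inverse)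

    -- The bijectivity of `point` modulo q, expressed through sums because occurrences of a variable
    -- are counted in that form. Within each coset the unit d′ only permutes the terms.
    ∑-point : ∀ {Ψ} → Periodic q Ψ → ∑ q (λ z → Ψ (point z)) ≡ ∑ q Ψ
    ∑-point {Ψ} per = begin
      ∑ q (λ z → Ψ (point z))                            ≡⟨ cong (λ m → ∑ m (λ z → Ψ (point z))) (sym q≡) ⟩
      ∑ (p ^ j * M) (λ z → Ψ (point z))                  ≡⟨ ∑-blocks (p ^ j) M _ ⟩
      ∑ (p ^ j) (λ c → ∑ M (λ i → Ψ (point (c * M + i)))) ≡⟨ ∑-cong (p ^ j) (λ c → trans
                                                              (∑-cong< M (λ i i<M → cong Ψ (point-block c i i<M))) (∑-class per c)) ⟩
      ∑ (p ^ j) (λ c → ∑ M (λ y → Ψ (c + p ^ j * y)))    ≡⟨ ∑-residues (p ^ j) M Ψ ⟨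
      ∑ (p ^ j * M) Ψ                                    ≡⟨ cong (λ m → ∑ m Ψ) q≡ ⟩
      ∑ q Ψ                                              ∎
      where open ≡-Reasoning

    literals : List (Lit q)
    literals = applyUpTo (λ z → literal (rev e (point z))) q

  cnt-applyUpTo : ∀ m (f : ℕ → Lit q) i → pos (cnt (applyUpTo f m) i) ≡ ∑ m (λ z → pos (δ (proj₂ (f z)) i))
  cnt-applyUpTo zero    f i = refl
  cnt-applyUpTo (suc m) f i = cong (pos (δ (proj₂ (f 0)) i) +ℤ_) (cnt-applyUpTo m (f ∘ suc) i)

  ∑-sumF : ∀ m (f : ℕ → ℤ) (g : Fin m → ℕ) → (∀ i → f (toℕ i) ≡ pos (g i)) → ∑ m f ≡ pos (sumF g)
  ∑-sumF zero    f g eq = refl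
  ∑-sumF (suc m) f g eq = cong₂ _+ℤ_ (eq Fin.zero) (∑-sumF m (f ∘ suc) (g ∘ Fin.suc) (eq ∘ Fin.suc))

  variableOf-toℕ : ∀ i → variableOf (toℕ i) ≡ i
  variableOf-toℕ i = Finₚ.toℕ-injective (trans (Finₚ.toℕ-fromℕ< _) (m<n⇒m%n≡m (Finₚ.toℕ<n i)))

  sumF-δʳ : ∀ {m} (i : Fin m) → sumF (λ j → δ j i) ≡ 1
  sumF-δʳ {suc m} Fin.zero    = cong suc (sumF-0 {m})
  sumF-δʳ         (Fin.suc i) = sumF-δʳ i

  -- Extending the range from q to 2q completes every pair, and then each variable is met exactly
  -- twice.
  ∑-variable : ∀ i → ∑ q (λ z → pos (δ (variableOf ⌊ z /2⌋) i)) ≤ℤ pos 2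
  ∑-variable i = ℤₚ.≤-trans (ℤₚ.≤-trans (ℤₚ.≤-reflexive (sym (ℤₚ.+-identityʳ _))) (ℤₚ.≤-trans
      (ℤₚ.+-monoʳ-≤ (∑ q H) (ℤₚ.≤-trans (ℤₚ.≤-reflexive (sym (trans (∑-const q (pos 0)) (ℤₚ.*-zeroʳ (pos q)))))
        (∑-mono< q (λ _ _ → ℤ.+≤+ z≤n))))
      (ℤₚ.≤-reflexive (sym (∑-split q q H)))))
    (ℤₚ.≤-reflexive (trans (∑-halves q φ) (cong₂ _+ℤ_ ∑φ≡1 ∑φ≡1)))
    where
    φ : ℕ → ℤ
    φ c = pos (δ (variableOf c) i)
    H : ℕ → ℤ
    H z = φ ⌊ z /2⌋
    ∑φ≡1 : ∑ q φ ≡ pos 1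
    ∑φ≡1 = trans (∑-sumF q φ (λ j → δ j i) (λ j → cong (λ v → pos (δ v i)) (variableOf-toℕ j))) (cong pos (sumF-δʳ i))

  literals-good : ∀ {d} (D : Difference d) i → cnt (Orbit.literals D) i ≤ 2
  literals-good D i = ℤₚ.drop‿+≤+ (ℤₚ.≤-trans (ℤₚ.≤-reflexive (trans (cnt-applyUpTo q _ i)
    (trans (∑-point (λ x → cong (λ z → pos (δ (variableOf ⌊ z /2⌋) i)) (rev-periodic e x))) (∑-rev e (λ z → pos (δ (variableOf ⌊ z /2⌋) i))))))
    (∑-variable i))
    where open Orbit D

  lists : List (GoodList q)
  lists = map (λ d → Orbit.literals (difference d) , literals-good (difference d)) (upTo q)

  length-lists : length lists ≡ q
  length-lists = trans (length-map _ (upTo q)) (length-upTo q)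

applyUpTo-+ : ∀ {X : Set} (g : ℕ → X) m r → applyUpTo g (m + r) ≡ applyUpTo g m ++ applyUpTo (λ i → g (m + i)) r
applyUpTo-+ g zero    r = refl
applyUpTo-+ g (suc m) r = cong (g 0 ∷_) (applyUpTo-+ (g ∘ suc) m r)

eval-applyUpTo : ∀ {n} (A x : Vec Bool n) (g : ℕ → Lit n) m → eval A x (applyUpTo g m) ≡ ∑ m (λ z → litValue A x (g z))
eval-applyUpTo A x g zero    = refl
eval-applyUpTo A x g (suc m) = cong (litValue A x (g 0) +ℤ_) (eval-applyUpTo A x (g ∘ suc) m)

sign-* : ∀ s b → sign s *ℤ sign b ≡ sign (not (s xor b))
sign-* true  true  = refl
sign-* true  false = refl
sign-* false true  = refl
sign-* false false = refl

-- The colouring along a progression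

module Colouring (p e : ℕ) (pp : Prime p) (x : Vec Bool (p ^ e)) (B : ℕ)
  (balanced : ∀ g → g ∈ Residues.lists p e pp → ∀ ys zs → proj₁ g ≡ ys ++ zs → ∣ eval (replicate (p ^ e) true) x ys ∣ ≤ B) where

  open Residues p e pp
  open Digits p

  -- The negated `xor` is multiplication of signs: the sign of the position in its pair times the
  -- value of the variable of that pair.
  colour : ℕ → Bool
  colour z = not (parity z xor lookup x (variableOf ⌊ z /2⌋))

  G f : ℕ → ℤ
  G z = sign (colour z)
  f y = G (rev e y)

  litValue≡G : ∀ z → litValue (replicate q true) x (literal z) ≡ G z
  litValue≡G z = trans (cong (λ a → sign (parity z) *ℤ signed a (lookup x (variableOf ⌊ z /2⌋))) (lookup-replicate (variableOf ⌊ z /2⌋) true))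
    (sign-* (parity z) (lookup x (variableOf ⌊ z /2⌋)))

  G-alternates : ∀ c → G (c + c) +ℤ G (suc (c + c)) ≡ pos 0
  G-alternates c = trans (cong₂ (λ u v → sign (not (u xor lookup x (variableOf ⌊ c + c /2⌋))) +ℤ sign (not (v xor lookup x (variableOf ⌊ suc (c + c) /2⌋))))
      (proj₁ (parity-double c)) (proj₂ (parity-double c)))
    (trans (cong₂ (λ u v → sign (not (not (lookup x (variableOf u)))) +ℤ sign (not (lookup x (variableOf v)))) (proj₁ (half-double c)) (proj₂ (half-double c)))
      (lem (lookup x (variableOf c))))
    where
    lem : ∀ b → sign (not (not b)) +ℤ sign (not b) ≡ pos 0
    lem true  = refl
    lem false = refl

  G-interval : ∀ b m → ∣ ∑ m (λ z → G (b + z)) ∣ ≤ 2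
  G-interval b m = ∑-interval b m G 1 (λ k _ → ∑-alternating k G G-alternates (λ z → ≤-reflexive (∣sign∣ (colour z))))

  f-periodic : Periodic q f
  f-periodic y = cong G (rev-periodic e y)

  module _ (d : ℕ) (d<q : d < q) where

    open Orbit (difference d)

    prefix : ∀ m → m ≤ q → ∣ ∑ m (λ z → f (point z)) ∣ ≤ B
    prefix m m≤q = subst (_≤ B) (cong ∣_∣ (trans (eval-applyUpTo (replicate q true) x g m) (∑-cong m (λ z → litValue≡G (rev e (point z))))))
      (balanced _ (∈-map⁺ _ (∈-upTo⁺ d<q)) (applyUpTo g m) (applyUpTo (λ i → g (m + i)) (q ∸ m))
        (trans (cong (applyUpTo g) (sym (m+[n∸m]≡n m≤q))) (applyUpTo-+ g m (q ∸ m))))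
      where
      g : ℕ → Lit q
      g z = literal (rev e (point z))

    module _ (c : ℕ) (c< : c < p ^ j) where

      h : ℕ → ℤ
      h i = f (c + i * d)

      h-periodic : Periodic M h
      h-periodic i = trans (cong f (trans (lem c i M d) (cong (c + i * d +_) M*d≡))) (periodic-+* q f-periodic (c + i * d) d′)
        where
        lem : ∀ c i M d → c + (i + M) * d ≡ c + i * d + M * d
        lem = ℕ-Ring.solve-∀
        M*d≡ : M * d ≡ d′ * q
        M*d≡ = trans (cong (M *_) d≡) (trans (lem′ M (p ^ j) d′) (cong (d′ *_) q≡))
          where
          lem′ : ∀ M P d → M * (P * d) ≡ d * (P * M)
          lem′ = ℕ-Ring.solve-∀

      full-orbit : ∣ ∑ M h ∣ ≤ 2
      full-orbit = subst (_≤ 2) (cong ∣_∣ (sym (begin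
        ∑ M h                                      ≡⟨ ∑-class f-periodic c ⟩
        ∑ M (λ y → G (rev e (c + p ^ j * y)))      ≡⟨ ∑-cong M (λ y → cong G (trans (cong (λ k → rev k (c + p ^ j * y)) (sym (m+[n∸m]≡n j≤e))) (proj₂ class y))) ⟩
        ∑ M (λ y → G (base + rev (e ∸ j) y))       ≡⟨ ∑-rev (e ∸ j) (λ z → G (base + z)) ⟩
        ∑ M (λ z → G (base + z))                   ∎))) (G-interval base M)
        where
        open ≡-Reasoning
        class = rev-class j (e ∸ j) c c<
        base = proj₁ class

      -- An incomplete turn is an interval of the listing `point`, hence a difference of two
      -- prefixes.
      part-orbit : ∀ z → z ≤ M → ∣ ∑ z h ∣ ≤ B + B
      part-orbit z z≤M = subst (_≤ B + B) (cong ∣_∣ (∑-cong< z (λ i i<z → cong f (point-block c i (<-≤-trans i<z z≤M)))))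
        (∑-interval (c * M) z (λ y → f (point y)) B (λ k k≤ → prefix k (≤-trans k≤ cM+z≤q)))
        where
        cM+z≤q : c * M + z ≤ q
        cM+z≤q = begin
          c * M + z   ≤⟨ +-monoʳ-≤ (c * M) z≤M ⟩
          c * M + M   ≡⟨ +-comm (c * M) M ⟩
          suc c * M   ≤⟨ *-monoˡ-≤ M c< ⟩
          p ^ j * M   ≡⟨ q≡ ⟩
          q           ∎
          where open ≤-Reasoning

      orbit : ∀ W z → z / M ≤ W → ∣ ∑ z h ∣ ≤ W * 2 + (B + B)
      orbit W z z/M≤W = begin
        ∣ ∑ z h ∣                                          ≡⟨ cong ∣_∣ decompose ⟩
        ∣ pos (z / M) *ℤ ∑ M h +ℤ ∑ (z % M) h ∣            ≤⟨ ℤₚ.∣i+j∣≤∣i∣+∣j∣ (pos (z / M) *ℤ ∑ M h) _ ⟩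
        ∣ pos (z / M) *ℤ ∑ M h ∣ + ∣ ∑ (z % M) h ∣         ≡⟨ cong (_+ ∣ ∑ (z % M) h ∣) (ℤₚ.abs-* (pos (z / M)) (∑ M h)) ⟩
        z / M * ∣ ∑ M h ∣ + ∣ ∑ (z % M) h ∣                ≤⟨ +-mono-≤ (*-mono-≤ z/M≤W full-orbit) (part-orbit (z % M) (<⇒≤ (m%n<n z M))) ⟩
        W * 2 + (B + B)                                    ∎
        where
        open ≤-Reasoning
        decompose : ∑ z h ≡ pos (z / M) *ℤ ∑ M h +ℤ ∑ (z % M) h
        decompose = trans (cong (λ y → ∑ y h) (trans (m≡m%n+[m/n]*n z M) (+-comm (z % M) (z / M * M))))
          (trans (∑-split (z / M * M) (z % M) h) (cong₂ _+ℤ_ (∑-copies (z / M) M h-periodic)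
            (∑-cong (z % M) (λ i → trans (cong h (+-comm (z / M * M) i)) (periodic-+* M h-periodic i (z / M))))))

    -- Modulo q, the progression is the stretch from i₀ to i₀ + l of the orbit that starts at c = a
    -- mod p^j, hence a difference of two sums starting at c. The longer one makes at most W full
    -- turns, the shorter one none.
    ap-bound : ∀ W a l → a < q → l ≤ W * M → ∣ ∑ l (λ i → f (a + i * d)) ∣ ≤ W * 2 + (B + B) + (B + B)
    ap-bound W a l a<q l≤ = let open ≤-Reasoning in begin
      ∣ ∑ l (λ i → f (a + i * d)) ∣              ≡⟨ cong ∣_∣ (trans (∑-cong l (λ i → sym (reindex i))) (trans (lem (∑ i₀ H) _) (cong (_-ℤ ∑ i₀ H) (sym (∑-split i₀ l H))))) ⟩
      ∣ ∑ (i₀ + l) H -ℤ ∑ i₀ H ∣                 ≤⟨ ℤₚ.∣i-j∣≤∣i∣+∣j∣ (∑ (i₀ + l) H) (∑ i₀ H) ⟩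
      ∣ ∑ (i₀ + l) H ∣ + ∣ ∑ i₀ H ∣              ≤⟨ +-mono-≤ (orbit c c< W (i₀ + l) wraps) (part-orbit c c< i₀ (<⇒≤ i₀<M)) ⟩
      W * 2 + (B + B) + (B + B)                  ∎
      where
      instance
        P≢0 : NonZero (p ^ j)
        P≢0 = m^n≢0 p j
      c = a % p ^ j
      y = a / p ^ j
      c< : c < p ^ j
      c< = m%n<n a (p ^ j)
      H = h c c<
      y<M : y < M
      y<M = m<n*o⇒m/o<n (≤-trans a<q (≤-reflexive (trans (sym q≡) (*-comm (p ^ j) M))))
      -- The index of a in the orbit of c: it solves d′ i₀ ≡ y modulo M, with w the inverse of d′.
      i₀ = (w * y) % M
      i₀<M : i₀ < M
      i₀<M = m%n<n (w * y) M
      lem : ∀ a b → b ≡ (a +ℤ b) -ℤ a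
      lem = ℤ-Ring.solve-∀
      wraps : (i₀ + l) / M ≤ W
      wraps = ≤-pred (m<n*o⇒m/o<n (≤-trans (+-mono-≤ i₀<M l≤) ≤-refl))
      d′i₀ : (d′ * i₀) % M ≡ y
      d′i₀ = inverse-cancel M w d′ (trans (cong (_% M) (*-comm w d′)) inverse) y y<M
      Φ : ℕ → ℤ
      Φ u = f (c + p ^ j * u)
      Φ-% : ∀ u → Φ (u % M) ≡ Φ u
      Φ-% = periodic-% M (class-periodic f-periodic c)
      reindex : ∀ i → H (i₀ + i) ≡ f (a + i * d)
      reindex i = begin
        f (c + (i₀ + i) * d)                ≡⟨ cong (λ z → f (c + z)) (i*d (i₀ + i)) ⟩
        Φ (d′ * (i₀ + i))                   ≡⟨ cong Φ (*-distribˡ-+ d′ i₀ i) ⟩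
        Φ (d′ * i₀ + d′ * i)                ≡⟨ Φ-% (d′ * i₀ + d′ * i) ⟨
        Φ ((d′ * i₀ + d′ * i) % M)          ≡⟨ cong Φ (trans (%-distribˡ-+ (d′ * i₀) (d′ * i) M)
                                                 (trans (cong (λ z → (z + (d′ * i) % M) % M) (trans d′i₀ (sym (m<n⇒m%n≡m y<M)))) (sym (%-distribˡ-+ y (d′ * i) M)))) ⟩
        Φ ((y + d′ * i) % M)                ≡⟨ Φ-% (y + d′ * i) ⟩
        f (c + p ^ j * (y + d′ * i))        ≡⟨ cong f (trans (lem′ c (p ^ j) y (d′ * i)) (cong₂ _+_ (sym (trans (m≡m%n+[m/n]*n a (p ^ j)) (cong (c +_) (*-comm y (p ^ j))))) (sym (i*d i)))) ⟩
        f (a + i * d)                       ∎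
        where
        open ≡-Reasoning
        lem′ : ∀ c P y u → c + P * (y + u) ≡ (c + P * y) + P * u
        lem′ = ℕ-Ring.solve-∀

-- The search descends from Λ = m. When the next lower power of 256 falls below m, the current one
-- is at most 256 m.
log-β : ∀ m → 1 ≤ m → ∃ λ Λ → m ≤ β Λ × β Λ ≤ 256 * m
log-β m 1≤m = search m (≤-trans (m≤2^m m) (≤-trans (^-monoʳ-≤ 2 (m≤n*m m 8)) (≤-reflexive (sym (β≡ m)))))
  where
  m≤2^m : ∀ m → m ≤ 2 ^ m
  m≤2^m zero    = z≤n
  m≤2^m (suc m) = ≤-trans (+-mono-≤ (m^n>0 2 m) (m≤2^m m)) (≤-reflexive (cong (2 ^ m +_) (sym (+-identityʳ (2 ^ m)))))
  search : ∀ Λ → m ≤ β Λ → ∃ λ Λ → m ≤ β Λ × β Λ ≤ 256 * m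
  search zero le = 0 , le , ≤-trans (≤-reflexive β-zero) (≤-trans 1≤m (m≤n*m m 256))
  search (suc Λ) le with m ≤? β Λ
  ... | yes le′ = search Λ le′
  ... | no  ≰β  = suc Λ , le , ≤-trans (≤-reflexive (β-suc Λ)) (*-monoʳ-≤ 256 (<⇒≤ (≰⇒> ≰β)))

-- Discrepancy

∈⇒≤maxList : ∀ {x xs} → x ∈ xs → x ≤ maxList xs
∈⇒≤maxList {xs = y ∷ xs} (here refl) = m≤m⊔n y (maxList xs)
∈⇒≤maxList {xs = y ∷ xs} (there x∈)  = ≤-trans (∈⇒≤maxList x∈) (m≤n⊔m y (maxList xs))

maxList≤ : ∀ {B} xs → (∀ {x} → x ∈ xs → x ≤ B) → maxList xs ≤ B
maxList≤ []       le = z≤n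
maxList≤ (x ∷ xs) le = ⊔-lub (le (here refl)) (maxList≤ xs (le ∘ there))

minList≤ : ∀ {x xs} → x ∈ xs → minList xs ≤ x
minList≤ {xs = y ∷ ys} (here refl) = foldr≤init ys
  where
  foldr≤init : ∀ {y} ys → foldr _⊓_ y ys ≤ y
  foldr≤init []       = ≤-refl
  foldr≤init (z ∷ zs) = ≤-trans (m⊓n≤n z _) (foldr≤init zs)
minList≤ {xs = y ∷ ys} (there x∈) = foldr≤ x∈
  where
  foldr≤ : ∀ {x y ys} → x ∈ ys → foldr _⊓_ y ys ≤ x
  foldr≤ {ys = z ∷ zs} (here refl) = m⊓n≤m z _
  foldr≤ {ys = z ∷ zs} (there x∈)  = ≤-trans (m⊓n≤n z _) (foldr≤ x∈)

minList∈ : ∀ {x xs} → x ∈ xs → minList xs ∈ xs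
minList∈ {xs = y ∷ ys} _ = foldr∈ ys
  where
  foldr∈ : ∀ {y} ys → foldr _⊓_ y ys ∈ y ∷ ys
  foldr∈ [] = here refl
  foldr∈ {y} (z ∷ zs) with ≤-total z (foldr _⊓_ y zs)
  ... | inj₁ le = there (here (m≤n⇒m⊓n≡m le))
  ... | inj₂ ge with foldr∈ {y} zs
  ...   | here eq  = here (trans (m≥n⇒m⊓n≡n ge) eq)
  ...   | there ∈z = there (there (subst (_∈ zs) (sym (m≥n⇒m⊓n≡n ge)) ∈z))

∈-allColorings : ∀ {n} (v : Vec Bool n) → v ∈ allColorings n
∈-allColorings []      = here refl
∈-allColorings (b ∷ v) = ∈-concatMap⁺ _ (Any.map (λ { refl → extend b }) (∈-allColorings v))
  where
  extend : ∀ b → b ∷ v ∈ (true ∷ v) ∷ (false ∷ v) ∷ []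
  extend true  = here refl
  extend false = there (here refl)

lengths : ℕ → ℕ → List ℕ
lengths m d = filter (λ l → T? (l * gcd (suc m) d ≤ᵇ suc m)) (upTo (suc (suc m)))

apsWith : ℕ → ℕ → ℕ → List (ℕ × ℕ × ℕ)
apsWith m a d = map (λ l → (a , d , l)) (lengths m d)

apsFrom : ℕ → ℕ → List (ℕ × ℕ × ℕ)
apsFrom m a = concatMap (apsWith m a) (upTo (suc m))

aps≡ : ∀ m → aps m ≡ concatMap (apsFrom m) (upTo (suc m))
aps≡ m = refl

∈-aps⁺ : ∀ m {a d l} → a < suc m → d < suc m → l * gcd (suc m) d ≤ suc m → (a , d , l) ∈ aps m
∈-aps⁺ m {a} {d} {l} a< d< le = subst ((a , d , l) ∈_) (sym (aps≡ m))
  (∈-concatMap⁺ (apsFrom m) (Any.map (λ { refl → from }) (∈-upTo⁺ a<)))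
  where
  l≤ : l ≤ suc m
  l≤ = ≤-trans (m≤m*n l (gcd (suc m) d) {{≢-nonZero (gcd[m,n]≢0 (suc m) d (inj₁ λ ()))}}) le
  with-d : (a , d , l) ∈ apsWith m a d
  with-d = ∈-map⁺ (λ l → (a , d , l)) (∈-filter⁺ (λ l → T? (l * gcd (suc m) d ≤ᵇ suc m)) (∈-upTo⁺ (s≤s l≤)) (≤⇒≤ᵇ le))
  from : (a , d , l) ∈ apsFrom m a
  from = ∈-concatMap⁺ (apsWith m a) (Any.map (λ { refl → with-d }) (∈-upTo⁺ d<))

∈-aps⁻ : ∀ m {a d l} → (a , d , l) ∈ aps m → a < suc m × d < suc m × l * gcd (suc m) d ≤ suc m
∈-aps⁻ m {a} {d} {l} t∈ with find (∈-concatMap⁻ (apsFrom m) {xs = upTo (suc m)} (subst ((a , d , l) ∈_) (aps≡ m) t∈))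
... | a′ , a∈ , t∈₁ with find (∈-concatMap⁻ (apsWith m a′) {xs = upTo (suc m)} t∈₁)
...   | d′ , d∈ , t∈₂ with ∈-map⁻ (λ l → (a′ , d′ , l)) {xs = lengths m d′} t∈₂
...     | l′ , l∈ , refl = ∈-upTo⁻ a∈ , ∈-upTo⁻ d∈ ,
  ≤ᵇ⇒≤ _ _ (proj₂ (∈-filter⁻ (λ l → T? (l * gcd (suc m) d′ ≤ᵇ suc m)) {xs = upTo (suc (suc m))} l∈))

apSum≡∑ : ∀ m v a d l → apSum m v a d l ≡ ∑ l (λ i → χat m v (a + i * d))
apSum≡∑ m v a d l = foldr≡∑ l id
  where
  foldr≡∑ : ∀ l (h : ℕ → ℕ) → foldr _+ℤ_ (pos 0) (map (λ i → χat m v (a + i * d)) (applyUpTo h l)) ≡ ∑ l (λ i → χat m v (a + h i * d))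
  foldr≡∑ zero    h = refl
  foldr≡∑ (suc l) h = cong (χat m v (a + h 0 * d) +ℤ_) (foldr≡∑ l (h ∘ suc))

apAbs : ∀ m → Vec Bool (suc m) → ℕ × ℕ × ℕ → ℕ
apAbs m v t = ∣ apSum m v (proj₁ t) (proj₁ (proj₂ t)) (proj₂ (proj₂ t)) ∣

maxAP≡ : ∀ m v → maxAP m v ≡ maxList (map (apAbs m v) (aps m))
maxAP≡ m v = refl

disc≤ : ∀ m B (c : ℕ → Bool) → (∀ x → c (x % suc m) ≡ c x) →
  (∀ a d l → a < suc m → d < suc m → l * gcd (suc m) d ≤ suc m → ∣ ∑ l (λ i → sign (c (a + i * d))) ∣ ≤ B) →
  disc (suc m) ≤ B
disc≤ m B c per bound = ≤-trans (minList≤ (∈-map⁺ (maxAP m) (∈-allColorings v))) (≤-trans (≤-reflexive (maxAP≡ m v)) (maxList≤ (map (apAbs m v) (aps m)) each))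
  where
  v : Vec Bool (suc m)
  v = tabulate (c ∘ toℕ)
  χat≡ : ∀ x → χat m v x ≡ sign (c x)
  χat≡ x = cong sign (trans (lookup∘tabulate (c ∘ toℕ) (fromℕ< (m%n<n x (suc m)))) (trans (cong c (Finₚ.toℕ-fromℕ< (m%n<n x (suc m)))) (per x)))
  each : ∀ {y} → y ∈ map (apAbs m v) (aps m) → y ≤ B
  each y∈ with ∈-map⁻ (apAbs m v) y∈
  ... | (a , d , l) , t∈ , refl =
    let a< , d< , le = ∈-aps⁻ m t∈
    in subst (_≤ B) (cong ∣_∣ (sym (trans (apSum≡∑ m v a d l) (∑-cong l (λ i → χat≡ (a + i * d)))))) (bound a d l a< d< le)

gcd-% : ∀ n d .{{_ : NonZero n}} → gcd n (d % n) ≡ gcd n d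
gcd-% n d = ∣-antisym
  (gcd-greatest (gcd[m,n]∣m n (d % n)) (∣n∣m%n⇒∣m (gcd[m,n]∣m n (d % n)) (gcd[m,n]∣n n (d % n))))
  (gcd-greatest (gcd[m,n]∣m n d) (%-presˡ-∣ (gcd[m,n]∣n n d) (gcd[m,n]∣m n d)))

periodic-ap : ∀ n .{{_ : NonZero n}} {f} → Periodic n f → ∀ a d i → f (a % n + i * (d % n)) ≡ f (a + i * d)
periodic-ap n {f} per a d i = trans (sym (periodic-+* n per (a % n + i * (d % n)) (a / n + i * (d / n))))
  (cong f (trans (lem (a % n) i (d % n) (a / n) (d / n) n) (sym (cong₂ (λ u v → u + i * v) (m≡m%n+[m/n]*n a n) (m≡m%n+[m/n]*n d n)))))
  where
  lem : ∀ a i d a′ d′ n → a + i * d + (a′ + i * d′) * n ≡ (a + a′ * n) + i * (d + d′ * n)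
  lem = ℕ-Ring.solve-∀

-- The minimum over the colourings is attained at some `v`. Its bound, given for a, d < n, extends
-- to all a and d by reduction modulo n, which preserves gcd n d.
optimalColouring : ∀ m → Σ (ℕ → ℤ) λ f → Periodic (suc m) f × (∀ x → f x *ℤ f x ≡ pos 1) ×
  (∀ a d l → l * gcd (suc m) d ≤ suc m → ∣ ∑ l (λ i → f (a + i * d)) ∣ ≤ disc (suc m))
optimalColouring m with ∈-map⁻ (maxAP m) (minList∈ (∈-map⁺ (maxAP m) (∈-allColorings (replicate (suc m) true))))
... | v , _ , disc≡ = χat m v , per , square , bound
  where
  N = suc m
  per : Periodic N (χat m v)
  per x = cong (λ i → sign (lookup v i)) (Finₚ.fromℕ<-cong _ _ ([m+n]%n≡m%n x N) _ _)
  square : ∀ x → χat m v x *ℤ χat m v x ≡ pos 1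
  square x with lookup v (fromℕ< (m%n<n x N))
  ... | true  = refl
  ... | false = refl
  bound : ∀ a d l → l * gcd N d ≤ N → ∣ ∑ l (λ i → χat m v (a + i * d)) ∣ ≤ disc N
  bound a d l le = subst₂ _≤_
    (cong ∣_∣ (trans (apSum≡∑ m v (a % N) (d % N) l) (∑-cong l (λ i → periodic-ap N per a d i)))) (sym (trans disc≡ (maxAP≡ m v)))
    (∈⇒≤maxList (∈-map⁺ (apAbs m v) (∈-aps⁺ m {a % N} {d % N} {l} (m%n<n a N) (m%n<n d N) (subst (λ g → l * g ≤ N) (sym (gcd-% N d)) le))))

lower-bound : ∀ p k → Prime p → 0 < k → p ^ (k ∸ k / 3) ≤ 12 * (disc (p ^ k) * disc (p ^ k))
lower-bound zero      k pp 0<k = contradiction pp (λ ())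
lower-bound p@(suc p′) k pp 0<k = LowerBound.lower p′ k pp 0<k f (subst (λ N → Periodic N f) (sym n≡) (proj₁ props))
  (proj₁ (proj₂ props)) (disc N)
  (subst (λ N → ∀ a d l → l * gcd N d ≤ N → ∣ ∑ l (λ i → f (a + i * d)) ∣ ≤ disc N) (sym n≡) (proj₂ (proj₂ props)))
  where
  N = p ^ k
  m = N ∸ 1
  n≡ : N ≡ suc m
  n≡ = sym (m+[n∸m]≡n (m^n>0 p k))
  f = proj₁ (optimalColouring m)
  props = proj₂ (optimalColouring m)

disc≤′ : ∀ n .{{_ : NonZero n}} B (c : ℕ → Bool) → (∀ x → c (x % n) ≡ c x) →
  (∀ a d l → a < n → d < n → l * gcd n d ≤ n → ∣ ∑ l (λ i → sign (c (a + i * d))) ∣ ≤ B) →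
  disc n ≤ B
disc≤′ (suc m) = disc≤ m

[x+y]²≤ : ∀ x y → (x + y) * (x + y) ≤ 2 * (x * x) + 2 * (y * y)
[x+y]²≤ x y with ≤-total x y
... | inj₁ x≤y = subst (λ y → (x + y) * (x + y) ≤ 2 * (x * x) + 2 * (y * y)) (m+[n∸m]≡n x≤y) (≤-trans (m≤m+n _ _) (≤-reflexive (lem x (y ∸ x))))
  where
  lem : ∀ x z → (x + (x + z)) * (x + (x + z)) + z * z ≡ 2 * (x * x) + 2 * ((x + z) * (x + z))
  lem = ℕ-Ring.solve-∀
... | inj₂ y≤x = subst (λ x → (x + y) * (x + y) ≤ 2 * (x * x) + 2 * (y * y)) (m+[n∸m]≡n y≤x) (≤-trans (m≤m+n _ _) (≤-reflexive (lem y (x ∸ y))))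
  where
  lem : ∀ y z → (y + z + y) * (y + z + y) + z * z ≡ 2 * ((y + z) * (y + z)) + 2 * (y * y)
  lem = ℕ-Ring.solve-∀

-- The discrepancy is at most 2u + 4B, where u = p^t bounds the number of full turns and B = K₀ √(β
-- Λ). Here u² ≤ q because 2t ≤ k - t, and B² ≤ 256 K₀² q because β Λ ≤ 256 q; finally (2u + 4B)² ≤
-- 8u² + 32B².
upper-bound : ∀ p k → Prime p → disc (p ^ k) * disc (p ^ k) ≤ (8 + 32 * (K₀ * K₀ * 256)) * p ^ (k ∸ k / 3)
upper-bound p k pp = begin
  disc N * disc N                                        ≤⟨ *-mono-≤ disc-bound disc-bound ⟩
  (2 * u + 4 * B) * (2 * u + 4 * B)                      ≤⟨ [x+y]²≤ (2 * u) (4 * B) ⟩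
  2 * (2 * u * (2 * u)) + 2 * (4 * B * (4 * B))          ≡⟨ lem₁ u B ⟩
  8 * (u * u) + 32 * (B * B)                             ≤⟨ +-mono-≤ (*-monoʳ-≤ 8 uu≤q) (*-monoʳ-≤ 32 BB≤) ⟩
  8 * q + 32 * (K₀ * K₀ * (256 * q))                     ≡⟨ lem₂ 8 32 (K₀ * K₀) 256 q ⟩
  (8 + 32 * (K₀ * K₀ * 256)) * q                         ∎
  where
  open ≤-Reasoning
  open Residues p (k ∸ k / 3) pp using (q; lists; length-lists; difference; q≢0; p≢0)
  t = k / 3
  e = k ∸ t
  N = p ^ k
  u = p ^ t
  t≤k : t ≤ k
  t≤k = m/n≤m k 3
  n≡uq : N ≡ u * q
  n≡uq = trans (cong (p ^_) (sym (m+[n∸m]≡n t≤k))) (^-distribˡ-+-* p t e)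
  instance
    n≢0 : NonZero N
    n≢0 = m^n≢0 p k
  logq = log-β q (m^n>0 p e)
  Λ = proj₁ logq
  balanced = balancedColouring Λ lists (≤-trans (≤-reflexive length-lists) (proj₁ (proj₂ logq))) (proj₁ (proj₂ logq))
  B = K₀ * 2 ^ (4 * Λ)
  module C = Colouring p e pp (proj₁ balanced) B (proj₂ balanced)
  open Digits p
  lem₁ : ∀ u B → 2 * (2 * u * (2 * u)) + 2 * (4 * B * (4 * B)) ≡ 8 * (u * u) + 32 * (B * B)
  lem₁ = ℕ-Ring.solve-∀
  lem₂ : ∀ a b c d q → a * q + b * (c * (d * q)) ≡ (a + b * (c * d)) * q
  lem₂ = ℕ-Ring.solve-∀
  uu≤q : u * u ≤ q
  uu≤q = ≤-trans (≤-reflexive (sym (^-distribˡ-+-* p t t))) (^-monoʳ-≤ p (m+n≤o⇒m≤o∸n (t + t)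
    (≤-trans (≤-reflexive (lem t)) (m/n*n≤m k 3))))
    where
    lem : ∀ t → t + t + t ≡ t * 3
    lem = ℕ-Ring.solve-∀
  BB≤ : B * B ≤ K₀ * K₀ * (256 * q)
  BB≤ = ≤-trans (≤-reflexive (trans (lem K₀ (2 ^ (4 * Λ))) (cong (K₀ * K₀ *_) (trans (2^-+ (4 * Λ) (4 * Λ)) (trans (cong (2 ^_) (lem′ Λ)) (sym (β≡ Λ)))))))
    (*-monoʳ-≤ (K₀ * K₀) (proj₂ (proj₂ logq)))
    where
    lem : ∀ k x → k * x * (k * x) ≡ k * k * (x * x)
    lem = ℕ-Ring.solve-∀
    lem′ : ∀ l → 4 * l + 4 * l ≡ 8 * l
    lem′ = ℕ-Ring.solve-∀
  c : ℕ → Bool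
  c y = C.colour (rev e y)
  c-% : ∀ y → c (y % N) ≡ c y
  c-% y = cong C.colour (trans (sym (rev-+*q (y % N) (y / N * u)))
    (cong (rev e) (trans (cong (y % N +_) (trans (*-assoc (y / N) u q) (cong (y / N *_) (sym n≡uq)))) (sym (m≡m%n+[m/n]*n y N)))))
    where
    rev-+*q : ∀ x i → rev e (x + i * q) ≡ rev e x
    rev-+*q x zero    = cong (rev e) (+-identityʳ x)
    rev-+*q x (suc i) = trans (cong (rev e) (trans (cong (x +_) (+-comm q (i * q))) (sym (+-assoc x (i * q) q))))
      (trans (rev-periodic e (x + i * q)) (rev-+*q x i))
  disc-bound : disc N ≤ 2 * u + 4 * B
  disc-bound = disc≤′ N (2 * u + 4 * B) c c-% ap
    where
    ap : ∀ a d l → a < N → d < N → l * gcd N d ≤ N → ∣ ∑ l (λ i → sign (c (a + i * d))) ∣ ≤ 2 * u + 4 * B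
    ap a d l _ _ le = begin
      ∣ ∑ l (λ i → C.f (a + i * d)) ∣                  ≡⟨ cong ∣_∣ (∑-cong l (λ i → sym (periodic-ap q C.f-periodic a d i))) ⟩
      ∣ ∑ l (λ i → C.f (a % q + i * (d % q))) ∣        ≤⟨ C.ap-bound (d % q) (m%n<n d q) u (a % q) l (m%n<n a q) l≤ ⟩
      u * 2 + (B + B) + (B + B)                        ≡⟨ lem u B ⟩
      2 * u + 4 * B                                    ∎
      where
      lem : ∀ u B → u * 2 + (B + B) + (B + B) ≡ 2 * u + 4 * B
      lem = ℕ-Ring.solve-∀
      open Residues.Orbit p e pp (difference (d % q)) using (M; j; gcd≡; q≡)
      p^j≡ : p ^ j ≡ gcd q d
      p^j≡ = trans (sym gcd≡) (gcd-% q d)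
      p^j≤ : p ^ j ≤ gcd N d
      p^j≤ = ∣⇒≤ {{≢-nonZero (gcd[m,n]≢0 N d (inj₁ (≢-nonZero⁻¹ N)))}}
        (subst (_∣ gcd N d) (sym p^j≡) (gcd-greatest (∣-trans (gcd[m,n]∣m q d) (divides u n≡uq)) (gcd[m,n]∣n q d)))
      -- gcd q d divides gcd N d, so a legal length makes at most u turns around an orbit of length
      -- M.
      l≤ : l ≤ u * M
      l≤ = *-cancelʳ-≤ l (u * M) (p ^ j) {{m^n≢0 p j}} (begin
        l * p ^ j         ≤⟨ *-monoʳ-≤ l p^j≤ ⟩
        l * gcd N d       ≤⟨ le ⟩
        N                 ≡⟨ trans n≡uq (cong (u *_) (sym q≡)) ⟩
        u * (p ^ j * M)   ≡⟨ lem′ u (p ^ j) M ⟩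
        u * M * p ^ j     ∎)
        where
        lem′ : ∀ u P M → u * (P * M) ≡ u * M * P
        lem′ = ℕ-Ring.solve-∀

-- Both inequalities are squared to keep the exponent integral: c₁ is 12^(-1/2), and c₂ is the
-- square root of the second constant.
theorem1p2 : Σ ℕ λ a → Σ ℕ λ b → (0 < a) × (0 < b) ×
    ((p k : ℕ) → Prime p → 0 < k →
    (p ^ (k ∸ k / 3) ≤ a * (disc (p ^ k) * disc (p ^ k)))
    × (disc (p ^ k) * disc (p ^ k) ≤ b * p ^ (k ∸ k / 3)))
theorem1p2 = 12 , 8 + 32 * (K₀ * K₀ * 256) , s≤s z≤n , s≤s z≤n , λ p k pp 0<k → lower-bound p k pp 0<k , upper-bound p k pp
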